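{- Let $q$ be an odd prime power, $A=\mathbb{F}_q[T]$, $F=\mathbb{F}_q(T)$, and let $\psi: A\to F\{\tau\}$ be a Drinfeld module of rank $2$ over $F$ with $\operatorname{End}_{F^{\mathrm{alg}}}(\psi)=A$. Then there is a constant $C>0$, depending only on $q$ and on the coefficients of $\psi_T\in F\{\tau\}$, such that for every prime $\mathfrak{p}=pA$ of good reduction for $\psi$ (with $p$ the monic generator of $\mathfrak{p}$), $$|\Delta_{\mathfrak{p}}|\ \geq\ C\,\frac{\log|p|}{(\log\log|p|)^2},$$ where $\Delta_{\mathfrak{p}}$ is the discriminant of the $A$-order $\operatorname{End}_{\mathbb{F}_{\mathfrak{p}}}(\psi\otimes\mathbb{F}_{\mathfrak{p}})$.
   Context: $F^{\mathrm{alg}}$ is a fixed algebraic closure of $F$. A prime of $A$ is a nonzero prime ideal $\mathfrak{p}$ of $A$, and $\mathbb{F}_{\mathfrak{p}}=A/\mathfrak{p}$. An $A$-field is a field $L$ with a ring homomorphism $\gamma:A\to L$ (the natural inclusion if $L\supseteq F$; the natural map $A\to A/\mathfrak{p}\hookrightarrow L$ if $L$ is a finite extension of $\mathbb{F}_{\mathfrak{p}}$). $L\{\tau\}$ is the ring of noncommutative polynomials in $\tau$ with $\tau c=c^q\tau$ for $c\in L$. A Drinfeld module of rank $r\ge 1$ over $L$ is an $\mathbb{F}_q$-algebra homomorphism $\psi:A\to L\{\tau\}$, $a\mapsto\psi_a$, with $\psi_T=\gamma(T)+\sum_{i=1}^r g_i\tau^i$, $g_i\in L$, $g_r\ne0$.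 For $L'\supseteq L$, $\operatorname{End}_{L'}(\psi)=\{u\in L'\{\tau\}: u\psi_a=\psi_a u\ \forall a\in A\}$; it contains $\psi(A)\cong A$, and $\operatorname{End}_{F^{\mathrm{alg}}}(\psi)=A$ means that it equals $\psi(A)$. For $\psi$ of rank $2$ over $F$ with $\psi_T=T+g_1\tau+g_2\tau^2$, a prime $\mathfrak{p}$ is of good reduction if $\operatorname{ord}_{\mathfrak{p}}(g_1)\ge0$ and $\operatorname{ord}_{\mathfrak{p}}(g_2)=0$; then the reduction $\psi\otimes\mathbb{F}_{\mathfrak{p}}:A\to\mathbb{F}_{\mathfrak{p}}\{\tau\}$ is the rank $2$ Drinfeld module obtained by reducing the coefficients of $\psi_T$ modulo $\mathfrak{p}$. Let $\pi_{\mathfrak{p}}=\tau^{\deg p}$. It is known that $\mathcal{E}_{\psi,\mathfrak{p}}=\operatorname{End}_{\mathbb{F}_{\mathfrak{p}}}(\psi\otimes\mathbb{F}_{\mathfrak{p}})$ is an $A$-order (free of rank $2$ over $A$) in the quadratic extension $F(\pi_{\mathfrak{p}})$ of $F$, which is imaginary (only one place lies over the place $\infty=1/T$). For an $A$-basis $\alpha_1,\alpha_2$ of $\mathcal{E}_{\psi,\mathfrak{p}}$, $\Delta_{\mathfrak{p}}=\det(\operatorname{Tr}_{F(\pi_{\mathfrak{p}})/F}(\alpha_i\alpha_j))_{1\le i,j\le2}\in A$, well defined up to multiplication by a square in $\mathbb{F}_q^\times$. The absolute value is $|a|=q^{\deg a}$ for $a\in A$. -}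

module Defs where

open import Algebra.Bundles using (CommutativeRing; RawRing)
open import Algebra.Morphism.Structures using (module RingMorphisms)
import Algebra.Definitions.RawSemiring as SemiringNotions
import Algebra.Definitions.RawMagma as Divisibility
open import Data.Empty using (⊥-elim)
open import Data.Fin.Base using (Fin; zero; suc)
open import Data.Fin.Properties using () renaming (_≟_ to _≟ᶠ_)
open import Data.Integer.Base as ℤ using (ℤ; +_; 0ℤ; _⊖_)
import Data.Integer.Properties as ℤₚ
open import Data.List.Base as List using (List; []; _∷_; foldr)
open import Data.Maybe.Base using (Maybe; nothing; just; maybe)
open import Data.Nat.Base as ℕ using (ℕ; zero; suc)
open import Data.Nat.Divisibility using () renaming (_∣_ to _∣ⁿ_; ∣-refl to ∣ⁿ-refl)
open import Data.Nat.Primality as ℕPrime using (prime⇒nonTrivial)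
import Data.Nat.Properties as ℕₚ
open import Data.Product.Base using (∃; ∃₂; _×_; _,_; proj₁; proj₂)
open import Data.Rational.Base as Q using (ℚ; 0ℚ; 1ℚ; _/_)
import Data.Rational.Properties as ℚₚ
import Data.Rational.Unnormalised.Base as Qᵘ
import Data.Rational.Unnormalised.Properties as ℚᵘₚ
open import Data.Rational.Solver using (module +-*-Solver)
open import Data.Sum.Base using (_⊎_; inj₁; inj₂)
open import Function.Base using (id)
open import Function.Bundles using (Bijection; _⇔_)
open import Level using (_⊔_) renaming (suc to lsuc)
open import Relation.Binary.Definitions using (tri<; tri≈; tri>)
open import Relation.Binary.PropositionalEquality using (_≡_; refl; sym; trans; cong; subst; setoid)
open import Relation.Nullary.Decidable using (Dec; yes; no; from-yes; map′)
open import Relation.Nullary.Negation using (¬_)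

module Reals where

  open Q using (_<_; _≤_; _+_; _*_; _-_; -_)
  open CommutativeRing ℚₚ.+-*-commutativeRing using (rawRing)
  open SemiringNotions (RawRing.rawSemiring rawRing) using () renaming (_^_ to _^ℚ_; _×_ to _·ℚ_) public

  -- A real number is a Dedekind cut, given by its lower part: an open proper
  -- nonempty initial segment of ℚ.  Thus `x ∋ r` means `r < x`.

  record ℝ : Set₁ where
    infix 4 _∋_
    field
      _∋_       : ℚ → Set
      inhabited : ∃ λ r → _∋_ r
      bounded   : ∃ λ b → ¬ _∋_ b
      downward  : ∀ {r s} → r < s → _∋_ s → _∋_ r
      isOpen    : ∀ {r} → _∋_ r → ∃ λ s → r < s × _∋_ s

  open ℝ public using (_∋_)

  infix 4 _≤ℝ_ _<ℝ_

  _≤ℝ_ : ℝ → ℝ → Set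
  x ≤ℝ y = ∀ r → x ∋ r → y ∋ r

  _<ℝ_ : ℝ → ℝ → Set
  x <ℝ y = ∃ λ r → y ∋ r × ¬ x ∋ r

  fromℚ : ℚ → ℝ
  fromℚ q = record
    { _∋_       = _< q
    ; inhabited = q - 1ℚ , subst (q - 1ℚ <_) (ℚₚ.+-identityʳ q) (ℚₚ.+-monoʳ-< q { - 1ℚ} {0ℚ} (from-yes (- 1ℚ ℚₚ.<? 0ℚ)))
    ; bounded   = q , ℚₚ.<-irrefl refl
    ; downward  = ℚₚ.<-trans
    ; isOpen    = λ {r} r<q → let s , r<s , s<q = ℚₚ.<-dense r<q in s , r<s , s<q
    }

  fromℕ : ℕ → ℝ
  fromℕ n = fromℚ (+ n / 1)

  record ℝ⁺ : Set₁ where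
    field
      real     : ℝ
      positive : fromℚ 0ℚ <ℝ real

  open ℝ⁺ public using (real)

  above : ∀ (x : ℝ) {b a} → ¬ x ∋ b → x ∋ a → a < b
  above x {b} {a} x∌b x∋a with ℚₚ.<-cmp a b
  ... | tri< a<b _ _    = a<b
  ... | tri≈ _ refl _   = ⊥-elim (x∌b x∋a)
  ... | tri> _ _ b<a    = ⊥-elim (x∌b (ℝ.downward x b<a x∋a))

  pick : ∀ (x : ℝ) q → fromℚ q <ℝ x → ∃ λ a → q < a × x ∋ a
  pick x q (r , x∋r , r≮q) = let a , r<a , x∋a = ℝ.isOpen x x∋r in
    a , ℚₚ.≤-<-trans (ℚₚ.≮⇒≥ r≮q) r<a , x∋a

  pick⁺ : ∀ (x : ℝ⁺) → ∃ λ a → 0ℚ < a × real x ∋ a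
  pick⁺ x = pick (real x) 0ℚ (ℝ⁺.positive x)

  *-pos : ∀ {a b} → 0ℚ < a → 0ℚ < b → 0ℚ < a * b
  *-pos {a} {b} 0<a 0<b = subst (_< a * b) (ℚₚ.*-zeroʳ a)
    (ℚₚ.*-monoʳ-<-pos a {{Q.positive 0<a}} 0<b)

  *-mono : ∀ {a b c d} → 0ℚ < b → 0ℚ < c → a < c → b < d → a * b < c * d
  *-mono {a} {b} {c} {d} 0<b 0<c a<c b<d = ℚₚ.<-trans
    (ℚₚ.*-monoˡ-<-pos b {{Q.positive 0<b}} a<c)
    (ℚₚ.*-monoʳ-<-pos c {{Q.positive 0<c}} b<d)

  1/⁺ : ∀ {c} → 0ℚ < c → ∃ λ d → 0ℚ < d × d * c ≡ 1ℚ
  1/⁺ {c} 0<c = Q.1/ c , ℚₚ.positive⁻¹ (Q.1/ c) {{ℚₚ.1/pos⇒pos c}} , ℚₚ.*-inverseˡ c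
    where instance
      c-positive = Q.positive 0<c
      c-nonZero  = ℚₚ.pos⇒nonZero c

  ^ℚ-pos : ∀ {t} → 0ℚ < t → ∀ n → 0ℚ < t ^ℚ n
  ^ℚ-pos 0<t zero    = from-yes (0ℚ ℚₚ.<? 1ℚ)
  ^ℚ-pos 0<t (suc n) = *-pos 0<t (^ℚ-pos 0<t n)

  infixl 7 _*⁺_ _/⁺_

  _*⁺_ : ℝ⁺ → ℝ⁺ → ℝ⁺
  x *⁺ y = record
    { real     = record
      { _∋_       = λ r → ∃₂ λ a b → (0ℚ < a × real x ∋ a) × (0ℚ < b × real y ∋ b) × r < a * b
      ; inhabited = 0ℚ , zero∈
      ; bounded   = proj₁ (ℝ.bounded (real x)) * proj₁ (ℝ.bounded (real y)) ,
          λ (a , b , (0<a , x∋a) , (0<b , y∋b) , bound<ab) →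
            let a<bx = above (real x) (proj₂ (ℝ.bounded (real x))) x∋a
                b<by = above (real y) (proj₂ (ℝ.bounded (real y))) y∋b
            in ℚₚ.<-asym bound<ab (*-mono 0<b (ℚₚ.<-trans 0<a a<bx) a<bx b<by)
      ; downward  = λ r<s (a , b , x∋a , y∋b , s<ab) → a , b , x∋a , y∋b , ℚₚ.<-trans r<s s<ab
      ; isOpen    = λ (a , b , x∋a , y∋b , r<ab) →
          let s , r<s , s<ab = ℚₚ.<-dense r<ab in s , r<s , a , b , x∋a , y∋b , s<ab
      }
    ; positive = 0ℚ , zero∈ , ℚₚ.<-irrefl refl
    }
    where
    zero∈ = let a , 0<a , x∋a = pick⁺ x ; b , 0<b , y∋b = pick⁺ y in
      a , b , (0<a , x∋a) , (0<b , y∋b) , *-pos 0<a 0<b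

  -- `r < x / y` iff `r * b < a` for some `a < x` and some upper bound `b` of `y`.

  _/⁺_ : ℝ⁺ → ℝ⁺ → ℝ⁺
  x /⁺ y = record
    { real     = record
      { _∋_       = λ r → ∃₂ λ a b → real x ∋ a × (0ℚ < b × ¬ real y ∋ b) × r * b < a
      ; inhabited = 0ℚ , zero∈
      ; bounded   = bx * d , λ (a , b , x∋a , (_ , y∌b) , bxdb<a) →
          let c<b = above (real y) y∌b y∋c
              a<bx = above (real x) x∌bx x∋a
              bxdc<bxdb = ℚₚ.*-monoʳ-<-pos (bx * d) {{Q.positive (*-pos 0<bx 0<d)}} c<b
          in ℚₚ.<-asym a<bx (subst (_< a) bxdc≡bx (ℚₚ.<-trans bxdc<bxdb bxdb<a))
      ; downward  = λ r<s (a , b , x∋a , (0<b , y∌b) , sb<a) → a , b , x∋a , (0<b , y∌b) ,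
          ℚₚ.<-trans (ℚₚ.*-monoˡ-<-pos b {{Q.positive 0<b}} r<s) sb<a
      ; isOpen    = λ {r} (a , b , x∋a , (0<b , y∌b) , rb<a) →
          let m , rb<m , m<a = ℚₚ.<-dense rb<a
              e , _ , eb≡1   = 1/⁺ 0<b
              meb≡m = trans (ℚₚ.*-assoc m e b) (trans (cong (m *_) eb≡1) (ℚₚ.*-identityʳ m))
          in m * e
           , ℚₚ.*-cancelʳ-<-nonNeg b {{ℚₚ.pos⇒nonNeg b {{Q.positive 0<b}}}} (subst (r * b <_) (sym meb≡m) rb<m)
           , a , b , x∋a , (0<b , y∌b) , subst (_< a) (sym meb≡m) m<a
      }
    ; positive = 0ℚ , zero∈ , ℚₚ.<-irrefl refl
    }
    where
    by   = proj₁ (ℝ.bounded (real y))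
    y∌by = proj₂ (ℝ.bounded (real y))
    bx   = proj₁ (ℝ.bounded (real x))
    x∌bx = proj₂ (ℝ.bounded (real x))
    a₀   = proj₁ (pick⁺ x)
    0<a₀ = proj₁ (proj₂ (pick⁺ x))
    x∋a₀ = proj₂ (proj₂ (pick⁺ x))
    c    = proj₁ (pick⁺ y)
    0<c  = proj₁ (proj₂ (pick⁺ y))
    y∋c  = proj₂ (proj₂ (pick⁺ y))
    d    = proj₁ (1/⁺ 0<c)
    0<d  = proj₁ (proj₂ (1/⁺ 0<c))
    dc≡1 = proj₂ (proj₂ (1/⁺ 0<c))
    0<bx = ℚₚ.<-trans 0<a₀ (above (real x) x∌bx x∋a₀)
    bxdc≡bx : bx * d * c ≡ bx
    bxdc≡bx = trans (ℚₚ.*-assoc bx d c) (trans (cong (bx *_) dc≡1) (ℚₚ.*-identityʳ bx))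
    zero∈ : ∃₂ λ a b → real x ∋ a × (0ℚ < b × ¬ real y ∋ b) × 0ℚ * b < a
    zero∈ = a₀ , by , x∋a₀ , (ℚₚ.<-trans 0<c (above (real y) y∌by y∋c) , y∌by) ,
      subst (_< a₀) (sym (ℚₚ.*-zeroˡ by)) 0<a₀

  square≥0 : ∀ u → 0ℚ ≤ u * u
  square≥0 u with ℚₚ.≤-total 0ℚ u
  ... | inj₁ 0≤u = subst (_≤ u * u) (ℚₚ.*-zeroˡ u) (ℚₚ.*-monoʳ-≤-nonNeg u {{Q.nonNegative 0≤u}} 0≤u)
  ... | inj₂ u≤0 = subst (_≤ u * u) (ℚₚ.*-zeroˡ u) (ℚₚ.*-monoʳ-≤-nonPos u {{Q.nonPositive u≤0}} u≤0)

  multiple≥0 : ∀ u n → 0ℚ ≤ (n ·ℚ u) * u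
  multiple≥0 u zero    = ℚₚ.≤-reflexive (sym (ℚₚ.*-zeroˡ u))
  multiple≥0 u (suc n) = subst (0ℚ ≤_) (sym (ℚₚ.*-distribʳ-+ u u (n ·ℚ u)))
    (ℚₚ.+-mono-≤ (square≥0 u) (multiple≥0 u n))

  rearrange : ∀ t u v → t * (1ℚ + v - (u * u + v * u)) ≡ (1ℚ - u) * t * (1ℚ + (u + v))
  rearrange = solve 3 (λ t u v → t :* (con 1ℚ :+ v :- (u :* u :+ v :* u))
                              := (con 1ℚ :- u) :* t :* (con 1ℚ :+ (u :+ v))) refl
    where open +-*-Solver

  bernoulli : ∀ {u} → 0ℚ < 1ℚ - u → ∀ n → (1ℚ - u) ^ℚ n * (1ℚ + n ·ℚ u) ≤ 1ℚ
  bernoulli {u} 0<t zero    = from-yes (1ℚ * (1ℚ + 0ℚ) ℚₚ.≤? 1ℚ)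
  bernoulli {u} 0<t (suc n) = ℚₚ.≤-trans
    (subst (_≤ t * (1ℚ + v)) (rearrange t u v)
      (ℚₚ.*-monoˡ-≤-nonNeg t {{ℚₚ.pos⇒nonNeg t {{Q.positive (^ℚ-pos 0<t n)}}}} step))
    (bernoulli 0<t n)
    where
    t = (1ℚ - u) ^ℚ n
    v = n ·ℚ u
    step : 1ℚ + v - (u * u + v * u) ≤ 1ℚ + v
    step = subst (1ℚ + v - (u * u + v * u) ≤_) (ℚₚ.+-identityʳ (1ℚ + v))
      (ℚₚ.+-monoʳ-≤ (1ℚ + v) (ℚₚ.neg-antimono-≤ (ℚₚ.+-mono-≤ (square≥0 u) (multiple≥0 u n))))

  -- Natural logarithm: log x is the supremum of the n u (n ∈ ℕ, u < 1 rational)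
  -- with (1 - u)⁻ⁿ < x.  Indeed exp (n u) ≤ (1 - u)⁻ⁿ, and for fixed s the bound
  -- (1 - s/n)⁻ⁿ tends to exp s.

  log : ℝ⁺ → ℝ
  log x = record
    { _∋_       = λ r → ∃₂ λ n u → ∃ λ a →
                    r < n ·ℚ u × 0ℚ < 1ℚ - u × real x ∋ a × 1ℚ ≤ a * (1ℚ - u) ^ℚ n
    ; inhabited = u₀ - 1ℚ , 1 , u₀ , a₀ , u₀-1<u₀ , subst (0ℚ <_) (sym 1-u₀≡d) 0<d , x∋a₀ ,
                    ℚₚ.≤-reflexive (sym a₀*≡1)
    ; bounded   = B , λ (n , u , a , B<nu , 0<1-u , x∋a , 1≤at) →
        let t     = (1ℚ - u) ^ℚ n
            0<t   = ^ℚ-pos 0<1-u n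
            a<1+v = ℚₚ.<-trans (above (real x) x∌B x∋a) (ℚₚ.<-trans B<nu
                      (subst (_< 1ℚ + n ·ℚ u) (ℚₚ.+-identityˡ (n ·ℚ u))
                        (ℚₚ.+-monoˡ-< (n ·ℚ u) (from-yes (0ℚ ℚₚ.<? 1ℚ)))))
            at<1  = ℚₚ.<-≤-trans (ℚₚ.*-monoˡ-<-pos t {{Q.positive 0<t}} a<1+v)
                      (subst (_≤ 1ℚ) (ℚₚ.*-comm t (1ℚ + n ·ℚ u)) (bernoulli 0<1-u n))
        in ℚₚ.<-irrefl refl (ℚₚ.≤-<-trans 1≤at at<1)
    ; downward  = λ r<s (n , u , a , s<nu , rest) → n , u , a , ℚₚ.<-trans r<s s<nu , rest
    ; isOpen    = λ (n , u , a , r<nu , rest) →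
        let s , r<s , s<nu = ℚₚ.<-dense r<nu in s , r<s , n , u , a , s<nu , rest
    }
    where
    B    = proj₁ (ℝ.bounded (real x))
    x∌B  = proj₂ (ℝ.bounded (real x))
    a₀   = proj₁ (pick⁺ x)
    0<a₀ = proj₁ (proj₂ (pick⁺ x))
    x∋a₀ = proj₂ (proj₂ (pick⁺ x))
    d    = proj₁ (1/⁺ 0<a₀)
    0<d  = proj₁ (proj₂ (1/⁺ 0<a₀))
    u₀   = 1ℚ - d
    1-u₀≡d : 1ℚ - u₀ ≡ d
    1-u₀≡d = solve 1 (λ d → con 1ℚ :- (con 1ℚ :- d) := d) refl d
      where open +-*-Solver
    a₀*≡1 : a₀ * (1ℚ - u₀) ^ℚ 1 ≡ 1ℚ
    a₀*≡1 = trans (cong (a₀ *_) (trans (ℚₚ.*-identityʳ (1ℚ - u₀)) 1-u₀≡d))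
                  (trans (ℚₚ.*-comm a₀ d) (proj₂ (proj₂ (1/⁺ 0<a₀))))
    u₀-1<u₀ : u₀ - 1ℚ < 1 ·ℚ u₀
    u₀-1<u₀ = ℚₚ.+-monoʳ-< u₀ { - 1ℚ} {0ℚ} (from-yes (- 1ℚ ℚₚ.<? 0ℚ))

  log⁺ : (x : ℝ⁺) → fromℚ 1ℚ <ℝ real x → ℝ⁺
  log⁺ x 1<x = record
    { real     = log x
    ; positive = 0ℚ , (1 , u , a , 0<1u , subst (0ℚ <_) (sym 1-u≡d) 0<d , x∋a , ℚₚ.≤-reflexive (sym a*≡1)) ,
                 ℚₚ.<-irrefl refl
    }
    where
    a   = proj₁ (pick (real x) 1ℚ 1<x)
    1<a = proj₁ (proj₂ (pick (real x) 1ℚ 1<x))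
    x∋a = proj₂ (proj₂ (pick (real x) 1ℚ 1<x))
    0<a = ℚₚ.<-trans (from-yes (0ℚ ℚₚ.<? 1ℚ)) 1<a
    d   = proj₁ (1/⁺ 0<a)
    0<d = proj₁ (proj₂ (1/⁺ 0<a))
    u   = 1ℚ - d
    1-u≡d : 1ℚ - u ≡ d
    1-u≡d = solve 1 (λ d → con 1ℚ :- (con 1ℚ :- d) := d) refl d
      where open +-*-Solver
    a*≡1 : a * (1ℚ - u) ^ℚ 1 ≡ 1ℚ
    a*≡1 = trans (cong (a *_) (trans (ℚₚ.*-identityʳ (1ℚ - u)) 1-u≡d))
                 (trans (ℚₚ.*-comm a d) (proj₂ (proj₂ (1/⁺ 0<a))))
    d<1 : d < 1ℚ
    d<1 = subst (d <_) (proj₂ (proj₂ (1/⁺ 0<a)))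
      (subst (_< d * a) (ℚₚ.*-identityʳ d) (ℚₚ.*-monoʳ-<-pos d {{Q.positive 0<d}} 1<a))
    0<1u : 0ℚ < 1 ·ℚ u
    0<1u = subst (0ℚ <_) (sym (ℚₚ.+-identityʳ u))
      (subst (_< u) (ℚₚ.+-inverseʳ d) (ℚₚ.+-monoˡ-< (- d) d<1))

  /1-mono : ∀ {m n} → m ℕ.≤ n → + m / 1 ≤ + n / 1
  /1-mono {m} {n} m≤n = ℚₚ.toℚᵘ-cancel-≤ (begin
    Q.toℚᵘ (+ m / 1)   ≃⟨ ℚₚ.toℚᵘ-fromℚᵘ (Qᵘ.mkℚᵘ (+ m) 0) ⟩
    Qᵘ.mkℚᵘ (+ m) 0    ≤⟨ Qᵘ.*≤* (ℤₚ.*-monoʳ-≤-nonNeg (+ 1) (ℤ.+≤+ m≤n)) ⟩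
    Qᵘ.mkℚᵘ (+ n) 0    ≃⟨ ℚₚ.toℚᵘ-fromℚᵘ (Qᵘ.mkℚᵘ (+ n) 0) ⟨
    Q.toℚᵘ (+ n / 1)   ∎)
    where open ℚᵘₚ.≤-Reasoning

  fromℕ-∋ : ∀ {m n r} → m ℕ.≤ n → r < + m / 1 → fromℕ n ∋ r
  fromℕ-∋ {m} {n} m≤n r<m = ℚₚ.<-≤-trans r<m (/1-mono m≤n)

  1<fromℕ : ∀ {n} → 3 ℕ.≤ n → fromℚ 1ℚ <ℝ fromℕ n
  1<fromℕ 3≤n = 1ℚ , fromℕ-∋ 3≤n (from-yes (1ℚ ℚₚ.<? + 3 / 1)) , ℚₚ.<-irrefl refl

  -- Both log n and log log n are positive for n ≥ 3.

  fromℕ⁺ : ∀ n → 3 ℕ.≤ n → ℝ⁺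
  fromℕ⁺ n 3≤n = record
    { real = fromℕ n
    ; positive = 0ℚ , fromℕ-∋ 3≤n (from-yes (0ℚ ℚₚ.<? + 3 / 1)) , ℚₚ.<-irrefl refl
    }

  logℕ : ∀ n → 3 ℕ.≤ n → ℝ⁺
  logℕ n 3≤n = log⁺ (fromℕ⁺ n 3≤n) (1<fromℕ 3≤n)

  1<logℕ : ∀ {n} (3≤n : 3 ℕ.≤ n) → fromℚ 1ℚ <ℝ real (logℕ n 3≤n)
  1<logℕ 3≤n = 1ℚ , (21 , + 1 / 20 , + 59 / 20 , from-yes (1ℚ ℚₚ.<? 21 ·ℚ (+ 1 / 20)) , from-yes (0ℚ ℚₚ.<? 1ℚ - + 1 / 20)
    , fromℕ-∋ 3≤n (from-yes (+ 59 / 20 ℚₚ.<? + 3 / 1)) , from-yes (1ℚ ℚₚ.≤? + 59 / 20 * (1ℚ - + 1 / 20) ^ℚ 21)) , ℚₚ.<-irrefl refl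

  loglogℕ : ∀ n → 3 ℕ.≤ n → ℝ⁺
  loglogℕ n 3≤n = log⁺ (logℕ n 3≤n) (1<logℕ 3≤n)

record Field c ℓ : Set (lsuc (c ⊔ ℓ)) where
  field
    commutativeRing : CommutativeRing c ℓ
  open CommutativeRing commutativeRing public
  field
    1≉0     : 1# ≉ 0#
    inverse : ∀ x → x ≉ 0# → ∃ λ y → x * y ≈ 1#

record FiniteField c ℓ (q : ℕ) : Set (lsuc (c ⊔ ℓ)) where
  field
    base        : Field c ℓ
    enumeration : Bijection (Field.setoid base) (setoid (Fin q))
  open Field base public

  infix 4 _≟_
  _≟_ : ∀ x y → Dec (x ≈ y)
  x ≟ y = map′ injective to-cong (to x ≟ᶠ to y)
    where
    open Bijection enumeration using (to; injective) renaming (cong to to-cong)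

-- The ring of skew polynomials Σ aᵢ Xⁱ over R, with X a = σ(a) X.  A polynomial is
-- the list of its coefficients, lowest first; trailing zeros are immaterial.

module SkewPolynomials {c ℓ} (R : RawRing c ℓ) (σ : RawRing.Carrier R → RawRing.Carrier R) where
  private module R = RawRing R

  Poly : Set c
  Poly = List R.Carrier

  coeff : Poly → ℕ → R.Carrier
  coeff []      _       = R.0#
  coeff (a ∷ f) zero    = a
  coeff (a ∷ f) (suc n) = coeff f n

  infix  4 _≈_
  infixl 6 _+_
  infixl 7 _*_
  infix  8 -_

  _≈_ : Poly → Poly → Set ℓ
  f ≈ g = ∀ n → coeff f n R.≈ coeff g n

  _+_ : Poly → Poly → Poly
  []      + g       = g
  (a ∷ f) + []      = a ∷ f
  (a ∷ f) + (b ∷ g) = a R.+ b ∷ f + g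

  -_ : Poly → Poly
  -_ = List.map R.-_

  -- (a + f X) g = a g + f (X g)
  _*_ : Poly → Poly → Poly
  []      * g = []
  (a ∷ f) * g = List.map (a R.*_) g + f * (R.0# ∷ List.map σ g)

  const : R.Carrier → Poly
  const a = a ∷ []

  X : Poly
  X = R.0# ∷ R.1# ∷ []

  rawRing : RawRing c ℓ
  rawRing = record
    { Carrier = Poly ; _≈_ = _≈_ ; _+_ = _+_ ; _*_ = _*_ ; -_ = -_ ; 0# = [] ; 1# = const R.1# }

  open SemiringNotions (RawRing.rawSemiring rawRing) public using (_^_)

  HasDegree : Poly → ℕ → Set ℓ
  HasDegree f n = coeff f n R.≉ R.0# × (∀ m → n ℕ.< m → coeff f m R.≈ R.0#)

module Polynomials {c ℓ} (R : RawRing c ℓ) where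
  open SkewPolynomials R id public
  private module R = RawRing R

  eval : Poly → R.Carrier → R.Carrier
  eval f x = foldr (λ a v → a R.+ x R.* v) R.0# f

record AlgebraicClosure {c ℓ} (F : Field c ℓ) c′ ℓ′ : Set (c ⊔ ℓ ⊔ lsuc (c′ ⊔ ℓ′)) where
  field
    closure : Field c′ ℓ′
  module F = Field F
  module K = Field closure
  module F[X] = Polynomials F.rawRing
  module K[X] = Polynomials K.rawRing
  field
    embed       : F.Carrier → K.Carrier
    isEmbedding : RingMorphisms.IsRingMonomorphism F.rawRing K.rawRing embed
    algebraic   : ∀ x → ∃ λ f → ¬ f F[X].≈ [] × K[X].eval (List.map embed f) x K.≈ K.0#
    closed      : ∀ f n → K[X].HasDegree f (suc n) → ∃ λ x → K[X].eval f x K.≈ K.0#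

OddPrimePower : ℕ → Set
OddPrimePower q = ¬ 2 ∣ⁿ q × ∃₂ λ ℓ k → ℕPrime.Prime ℓ × q ≡ ℓ ℕ.^ suc k

module FunctionField {c ℓ q} (𝔽 : FiniteField c ℓ q) where
  module 𝔽 = FiniteField 𝔽
  module A = Polynomials 𝔽.rawRing
  open SemiringNotions (RawRing.rawSemiring A.rawRing) using (_∣_; _∤_; Prime)

  T : A.Poly
  T = A.X

  deg : A.Poly → Maybe ℕ
  deg []      = nothing
  deg (a ∷ f) with deg f
  ... | just n  = just (suc n)
  ... | nothing with a 𝔽.≟ 𝔽.0#
  ...   | yes _ = nothing
  ...   | no _  = just 0

  ∣_∣ : A.Poly → ℕ
  ∣ a ∣ = maybe (q ℕ.^_) 0 (deg a)

  record MonicPrime : Set (c ⊔ ℓ) where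
    field
      p       : A.Poly
      d       : ℕ
      deg≡d   : deg p ≡ just d
      monic   : A.coeff p d 𝔽.≈ 𝔽.1#
      isPrime : Prime p

  deg-nothing : ∀ f → deg f ≡ nothing → ∀ n → A.coeff f n 𝔽.≈ 𝔽.0#
  deg-nothing []      _ _ = 𝔽.refl
  deg-nothing (a ∷ f) e n with deg f in eq
  deg-nothing (a ∷ f) () n | just _
  ... | nothing with a 𝔽.≟ 𝔽.0#
  deg-nothing (a ∷ f) e  zero    | nothing | yes a≈0 = a≈0
  deg-nothing (a ∷ f) e  (suc n) | nothing | yes _   = deg-nothing f eq n
  deg-nothing (a ∷ f) () n       | nothing | no _

  deg-zero : ∀ f → deg f ≡ just 0 → ∀ n → A.coeff f (suc n) 𝔽.≈ 𝔽.0#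
  deg-zero (a ∷ f) e n with deg f in eq
  deg-zero (a ∷ f) () n | just _
  ... | nothing = deg-nothing f eq n

  coeff-map-1* : ∀ f n → A.coeff (List.map (𝔽.1# 𝔽.*_) f A.+ []) n 𝔽.≈ A.coeff f n
  coeff-map-1* []      n       = 𝔽.refl
  coeff-map-1* (a ∷ f) zero    = 𝔽.*-identityˡ a
  coeff-map-1* (a ∷ []) (suc n) = 𝔽.refl
  coeff-map-1* (a ∷ f@(b ∷ g)) (suc n) = 𝔽.trans (lemma (List.map (𝔽.1# 𝔽.*_) f) n) (coeff-map-1* f n)
    where
    lemma : ∀ h n → A.coeff h n 𝔽.≈ A.coeff (h A.+ []) n
    lemma []      n = 𝔽.refl
    lemma (x ∷ h) n = 𝔽.refl

  3≤∣p∣ : OddPrimePower q → (P : MonicPrime) → 3 ℕ.≤ ∣ MonicPrime.p P ∣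
  3≤∣p∣ (2∤q , r , k , r-prime , q≡) record { p = p ; d = d ; deg≡d = deg≡d ; monic = monic ; isPrime = isPrime }
    rewrite deg≡d = bound d deg≡d monic
    where
    2≤q : 2 ℕ.≤ q
    2≤q = subst (2 ℕ.≤_) (sym q≡) (ℕₚ.≤-trans (ℕ.nonTrivial⇒n>1 r {{prime⇒nonTrivial r-prime}})
      (ℕₚ.m≤m*n r (r ℕ.^ k) {{ℕₚ.m^n≢0 r k {{ℕ.nonTrivial⇒nonZero r {{prime⇒nonTrivial r-prime}}}}}}))

    3≤q : 3 ℕ.≤ q
    3≤q = ℕₚ.≤∧≢⇒< 2≤q (λ 2≡q → 2∤q (subst (2 ∣ⁿ_) 2≡q ∣ⁿ-refl))

    bound : ∀ d → deg p ≡ just d → A.coeff p d 𝔽.≈ 𝔽.1# → 3 ℕ.≤ q ℕ.^ d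
    bound zero    e m = ⊥-elim (Prime.p∤1 isPrime (A.const 𝔽.1# Divisibility., p∣1))
      where
      p∣1 : A.const 𝔽.1# A.* p A.≈ A.const 𝔽.1#
      p∣1 zero    = 𝔽.trans (coeff-map-1* p 0) m
      p∣1 (suc n) = 𝔽.trans (coeff-map-1* p (suc n)) (deg-zero p e n)
    bound (suc d) _ _ = ℕₚ.≤-trans 3≤q (ℕₚ.m≤m*n q (q ℕ.^ d) {{ℕₚ.m^n≢0 q d {{ℕ.>-nonZero (ℕₚ.<-trans ℕ.z<s 2≤q)}}}})

  record FractionField c′ ℓ′ : Set (c ⊔ ℓ ⊔ lsuc (c′ ⊔ ℓ′)) where
    field
      base : Field c′ ℓ′
    open Field base public
    field
      ι           : A.Poly → Carrier
      isEmbedding : RingMorphisms.IsRingMonomorphism A.rawRing rawRing ι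
      fraction    : ∀ x → ∃₂ λ a b → ι b ≉ 0# × x * ι b ≈ ι a

  -- A/p, with elements of A as representatives of their classes
  residueField : A.Poly → RawRing c (c ⊔ ℓ)
  residueField p = record
    { Carrier = A.Poly ; _≈_ = λ a b → p ∣ (a A.+ A.- b)
    ; _+_ = A._+_ ; _*_ = A._*_ ; -_ = A.-_ ; 0# = [] ; 1# = A.const 𝔽.1# }

  module Valuation {c′ ℓ′} (F : FractionField c′ ℓ′) (P : MonicPrime) where
    private module F = FractionField F
    open MonicPrime P using (p)

    ExactPower : A.Poly → ℕ → Set _
    ExactPower a n = (p A.^ n) ∣ a × (p A.^ suc n) ∤ a

    Ord : F.Carrier → ℤ → Set _
    Ord x k = ∃₂ λ a b → x F.* F.ι b F.≈ F.ι a ×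
              ∃₂ λ m n → ExactPower a m × ExactPower b n × k ≡ m ⊖ n

    -- ord x ≥ 0, where ord 0 = ∞
    Ord≥0 : F.Carrier → Set _
    Ord≥0 x = x F.≈ F.0# ⊎ ∃ λ k → Ord x k × 0ℤ ℤ.≤ k

    -- x = a/b with p ∤ b, and c is a representative of (a mod p)/(b mod p)
    ReducesTo : F.Carrier → A.Poly → Set _
    ReducesTo x c = ∃₂ λ a b → x F.* F.ι b F.≈ F.ι a × p ∤ b ×
                    RawRing._≈_ (residueField p) (c A.* b) a

  -- L{τ}, with τ c = c^q τ; only the operations of L enter, so a raw ring suffices here
  -- and below.
  module Twisted {c′ ℓ′} (L : RawRing c′ ℓ′) =
    SkewPolynomials L (λ x → SemiringNotions._^_ (RawRing.rawSemiring L) x q)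

  -- γ : A → L is the structure map of the A-field L; an 𝔽_q-algebra homomorphism is a
  -- ring homomorphism satisfying 𝔽-linear.
  record DrinfeldModule {c′ ℓ′} (L : RawRing c′ ℓ′) (γ : A.Poly → RawRing.Carrier L) (r : ℕ)
         : Set (c ⊔ ℓ ⊔ c′ ⊔ ℓ′) where
    module L = RawRing L
    module L⟨τ⟩ = Twisted L
    field
      ψ                  : A.Poly → L⟨τ⟩.Poly
      isRingHomomorphism : RingMorphisms.IsRingHomomorphism A.rawRing L⟨τ⟩.rawRing ψ
      𝔽-linear           : ∀ c → ψ (A.const c) L⟨τ⟩.≈ L⟨τ⟩.const (γ (A.const c))
      rank≥1             : 1 ℕ.≤ r
      constant           : L⟨τ⟩.coeff (ψ T) 0 L.≈ γ T
      degree             : L⟨τ⟩.HasDegree (ψ T) r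

    g : ℕ → L.Carrier
    g = L⟨τ⟩.coeff (ψ T)

  module _ {c′ ℓ′} (L : RawRing c′ ℓ′) (ψ : A.Poly → Twisted.Poly L) where
    private module L⟨τ⟩ = Twisted L

    IsEndomorphism : L⟨τ⟩.Poly → Set _
    IsEndomorphism u = ∀ a → u L⟨τ⟩.* ψ a L⟨τ⟩.≈ ψ a L⟨τ⟩.* u

    OnlyScalarEndomorphisms : Set _
    OnlyScalarEndomorphisms = ∀ u → IsEndomorphism u ⇔ ∃ λ a → u L⟨τ⟩.≈ ψ a

    record IsBasisOfEnd (α : Fin 2 → L⟨τ⟩.Poly) : Set (c ⊔ ℓ ⊔ c′ ⊔ ℓ′) where
      combination : (Fin 2 → A.Poly) → L⟨τ⟩.Poly
      combination a = ψ (a zero) L⟨τ⟩.* α zero L⟨τ⟩.+ ψ (a (suc zero)) L⟨τ⟩.* α (suc zero)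
      field
        member      : ∀ i → IsEndomorphism (α i)
        spanning    : ∀ u → IsEndomorphism u → ∃ λ a → u L⟨τ⟩.≈ combination a
        independent : ∀ a → combination a L⟨τ⟩.≈ [] → ∀ i → a i A.≈ []

  module Rank2 {c′ ℓ′} (F : FractionField c′ ℓ′)
               (Ψ : DrinfeldModule (FractionField.rawRing F) (FractionField.ι F) 2) where
    private
      module F = FractionField F
      module Ψ = DrinfeldModule Ψ

    EndomorphismsOverClosureAreScalar : ∀ {c″ ℓ″} → AlgebraicClosure F.base c″ ℓ″ → Set _
    EndomorphismsOverClosureAreScalar K =
      OnlyScalarEndomorphisms K.rawRing (λ a → List.map embed (Ψ.ψ a))
      where
      open AlgebraicClosure K using (embed; closure)
      module K = Field closure

    module AtPrime (P : MonicPrime) where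
      open MonicPrime P using (p; d)
      open Valuation F P

      GoodReduction : Set _
      GoodReduction = Ord≥0 (Ψ.g 1) × Ord (Ψ.g 2) 0ℤ

      𝔽ₚ : RawRing c (c ⊔ ℓ)
      𝔽ₚ = residueField p

      module 𝔽ₚ⟨τ⟩ = Twisted 𝔽ₚ

      record Reduction : Set (c ⊔ ℓ ⊔ c′ ⊔ ℓ′) where
        field
          module′ : DrinfeldModule 𝔽ₚ id 2
        open DrinfeldModule module′ public using () renaming (ψ to φ; g to ḡ)
        field
          reduces : ∀ i → ReducesTo (Ψ.g i) (ḡ i)

      module _ (Φ : Reduction) where
        open Reduction Φ using (φ)
        open 𝔽ₚ⟨τ⟩

        π : Poly
        π = X ^ d

        -- Tr_{F(π)/F} u = t, as the trace of the matrix of multiplication by u in the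
        -- F-basis 1, π of F(π).  That matrix is n/s: a common denominator s ∈ A is cleared
        -- so that the two columns become identities in End(φ).
        IsTrace : Poly → F.Carrier → Set _
        IsTrace u t = ∃ λ s → ∃ λ (n : Fin 2 → Fin 2 → A.Poly) →
          ¬ s A.≈ []
          × φ s * u       ≈ φ (n zero zero)       + φ (n (suc zero) zero)       * π
          × φ s * (u * π) ≈ φ (n zero (suc zero)) + φ (n (suc zero) (suc zero)) * π
          × t F.* F.ι s F.≈ F.ι (n zero zero A.+ n (suc zero) (suc zero))

        -- A relation, because the discriminant is only defined up to (𝔽_q^×)².
        IsDiscriminant : A.Poly → Set _
        IsDiscriminant Δ = ∃ λ α → IsBasisOfEnd 𝔽ₚ φ α ×
          ∃ λ (t : Fin 2 → Fin 2 → F.Carrier) →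
            (∀ i j → IsTrace (α i * α j) (t i j))
            × F.ι Δ F.≈ t zero zero F.* t (suc zero) (suc zero) F.- t zero (suc zero) F.* t (suc zero) zero

{-# OPTIONS --safe #-}

-- Let 1, u be an A-basis of the endomorphism ring of the reduction φ modulo p, and t the
-- trace of u.  The element v = 2 u - t is not in A, satisfies v² = Δ and has degree n = deg Δ
-- in τ.  Commuting with φ_T, it is determined by its constant coefficient v₀, a square root
-- of Δ: its coefficients are (N / M) v₀, where the numerators N and denominators M in A come
-- from a recursion that does not depend on p.  The coefficients of index n + 1 and n + 2
-- vanish, so p divides Δ or both of these N, whose degrees are O((n + 1)² q^n); this bounds
-- deg p unless both N are zero.  In that case the same recursion over F^alg, started from
-- a square root of Δ, terminates, and gives an endomorphism of ψ that is not in A.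

module Submission where

open import Defs
open import Algebra.Bundles using (CommutativeRing; Ring; RawRing)
import Algebra.Definitions.RawMagma as Divisibility
import Algebra.Definitions.RawSemiring as SemiringNotions
import Algebra.Morphism.Construct.Composition as Composition
import Algebra.Morphism.Construct.Identity as Identity
open import Algebra.Morphism.Structures using (module RingMorphisms)
import Algebra.Properties.AbelianGroup as AbelianGroupProperties
import Algebra.Properties.CommutativeMonoid.Sum as Sum
import Algebra.Properties.CommutativeSemiring.Binomial as Binomial
import Algebra.Properties.CommutativeSemiring.Exp as Exp
import Algebra.Properties.Group as GroupProperties
import Algebra.Properties.Ring as RingProperties
import Algebra.Properties.Semiring.Exp as SemiringExp
import Algebra.Properties.Semiring.Mult as Mult
import Algebra.Solver.Ring as RingSolver
open import Algebra.Solver.Ring.AlmostCommutativeRing using (_-Raw-AlmostCommutative⟶_; fromCommutativeRing)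
open import Algebra.Structures using (IsRing)
open import Data.Empty using (⊥; ⊥-elim)
open import Data.Fin.Base as Fin using (Fin; zero; suc; toℕ; inject₁)
open import Data.Fin.Permutation using (Permutation; permutation)
import Data.Fin.Properties as Finₚ
open import Data.Integer.Base as ℤ using (+_)
import Data.Integer.Properties as ℤₚ
open import Data.List.Base as List using (List; []; _∷_)
import Data.List.Properties as Listₚ
open import Data.Maybe.Base using (Maybe; nothing; just; maybe)
open import Data.Nat.Base as ℕ using (ℕ; zero; suc)
open import Data.Nat.Combinatorics using (_C_; nCk≡n!/k![n-k]!; k![n∸k]!∣n!; nCn≡1)
open import Data.Nat.Divisibility as ∣ⁿ using (divides) renaming (_∣_ to _∣ⁿ_; ∣-refl to ∣ⁿ-refl)
open import Data.Nat.DivMod using (m/n*n≡m; _/_; _%_; m≡m%n+[m/n]*n; m%n<n)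
open import Data.Nat.Primality as ℕPrime using (euclidsLemma; prime⇒nonZero; prime⇒nonTrivial)
import Data.Nat.Properties as ℕₚ
import Data.Nat.Solver as ℕSolver
open import Data.Product.Base using (∃; ∃₂; _×_; _,_; proj₁; proj₂)
open import Data.Rational.Base as Q using (ℚ; 0ℚ; 1ℚ)
import Data.Rational.Properties as ℚₚ
open import Data.Rational.Solver using (module +-*-Solver)
import Data.Rational.Unnormalised.Base as Qᵘ
import Data.Rational.Unnormalised.Properties as ℚᵘₚ
open import Data.Sum.Base using (_⊎_; inj₁; inj₂)
open import Data.Vec.Functional using (Vector)
open import Function.Base using (id; _∘_)
open import Function.Bundles using (Bijection; Equivalence)
open import Level using (_⊔_)
open import Relation.Binary.Bundles using (Setoid)
open import Relation.Binary.PropositionalEquality as ≡ using (_≡_; _≢_)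
import Relation.Binary.Reasoning.Setoid as ≈-Reasoning
open import Relation.Nullary.Decidable using (Dec; yes; no; from-yes)
open import Relation.Nullary.Negation using (¬_; contradiction)

-- Division is impossible modulo `p`: the factor `T^(q^(k+1)) - T` vanishes there when deg p divides
-- k + 1, and a common denominator `B` of the coefficients of `ψ_T` may be divisible by `p` as well.
-- The proof therefore rests on the denominator-free identity `M k * w k ≈ N k * s`, valid for a
-- solution of the recursion in any commutative ring; modulo `p` it serves only to conclude that
-- `N k * s` vanishes when `w k` does. Division is confined to the closure, where no `M k` vanishes.
-- Two numerators are tested because the recursion has order two: a single zero would not stop it.
--
-- The discriminant varies with `p`, so it enters the numerators as a parameter `D`, and their
-- degrees are bounded through n and the coefficients of `ψ_T` alone. One factor n + 1 in the bound
-- comes from the degree of `D`, the other from the number of steps of the recursion; together they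
-- become the square of log log |p|. That the endomorphism found over the closure lies outside A
-- rests on Δ not being a square in A, which in turn follows from v not being a scalar.

-- Skew polynomial rings over a commutative ring.

module SkewRing {c ℓ} (R : CommutativeRing c ℓ) (σ : CommutativeRing.Carrier R → CommutativeRing.Carrier R)
                (σ-hom : RingMorphisms.IsRingHomomorphism (CommutativeRing.rawRing R) (CommutativeRing.rawRing R) σ)
                where
  private module R = CommutativeRing R
  open RingMorphisms.IsRingHomomorphism σ-hom renaming (⟦⟧-cong to σ-cong; +-homo to σ-+; *-homo to σ-*; 0#-homo to σ-0; 1#-homo to σ-1; -‿homo to σ--) public
  open SkewPolynomials R.rawRing σ public
  open RingProperties R.ring using (-0#≈0#)

  -- `_≈_` is a function type, from which Agda cannot infer the two polynomials.
  infix 4 _≋_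
  record _≋_ (f g : Poly) : Set ℓ where
    constructor coeffwise
    field at : f ≈ g
  open _≋_ public

  ≋-setoid : Setoid c ℓ
  ≋-setoid = record
    { Carrier = Poly ; _≈_ = _≋_
    ; isEquivalence = record
      { refl  = coeffwise λ n → R.refl
      ; sym   = λ e → coeffwise λ n → R.sym (e .at n)
      ; trans = λ e e′ → coeffwise λ n → R.trans (e .at n) (e′ .at n) } }

  open Setoid ≋-setoid public using () renaming (refl to ≋-refl; sym to ≋-sym; trans to ≋-trans; reflexive to ≋-reflexive)

  shift : Poly → Poly
  shift f = R.0# ∷ f

  coeff-+ : ∀ f g n → coeff (f + g) n R.≈ coeff f n R.+ coeff g n
  coeff-+ []      g       n       = R.sym (R.+-identityˡ _)
  coeff-+ (a ∷ f) []      n       = R.sym (R.+-identityʳ _)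
  coeff-+ (a ∷ f) (b ∷ g) zero    = R.refl
  coeff-+ (a ∷ f) (b ∷ g) (suc n) = coeff-+ f g n

  coeff-map : ∀ {h : R.Carrier → R.Carrier} → h R.0# R.≈ R.0# → ∀ f n → coeff (List.map h f) n R.≈ h (coeff f n)
  coeff-map h0 []      n       = R.sym h0
  coeff-map h0 (a ∷ f) zero    = R.refl
  coeff-map h0 (a ∷ f) (suc n) = coeff-map h0 f n

  coeff-neg : ∀ f n → coeff (- f) n R.≈ R.- coeff f n
  coeff-neg = coeff-map -0#≈0#

  coeff-scale : ∀ a f n → coeff (List.map (a R.*_) f) n R.≈ a R.* coeff f n
  coeff-scale a = coeff-map (R.zeroʳ a)

  coeff-σ : ∀ f n → coeff (List.map σ f) n R.≈ σ (coeff f n)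
  coeff-σ = coeff-map σ-0

  +-cong : ∀ {f f′ g g′} → f ≋ f′ → g ≋ g′ → f + g ≋ f′ + g′
  +-cong {f} {f′} {g} {g′} e e′ .at n = R.trans (coeff-+ f g n) (R.trans (R.+-cong (e .at n) (e′ .at n)) (R.sym (coeff-+ f′ g′ n)))

  +-congˡ : ∀ f {g g′} → g ≋ g′ → f + g ≋ f + g′
  +-congˡ f = +-cong {f} ≋-refl

  +-assoc : ∀ f g h → (f + g) + h ≋ f + (g + h)
  +-assoc f g h .at n = begin
    coeff ((f + g) + h) n  ≈⟨ coeff-+ (f + g) h n ⟩
    coeff (f + g) n R.+ coeff h n  ≈⟨ R.+-congʳ (coeff-+ f g n) ⟩
    (coeff f n R.+ coeff g n) R.+ coeff h n  ≈⟨ R.+-assoc _ _ _ ⟩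
    coeff f n R.+ (coeff g n R.+ coeff h n)  ≈⟨ R.+-congˡ (coeff-+ g h n) ⟨
    coeff f n R.+ coeff (g + h) n  ≈⟨ coeff-+ f (g + h) n ⟨
    coeff (f + (g + h)) n  ∎
    where open ≈-Reasoning R.setoid

  +-comm : ∀ f g → f + g ≋ g + f
  +-comm f g .at n = R.trans (coeff-+ f g n) (R.trans (R.+-comm _ _) (R.sym (coeff-+ g f n)))

  +-identityʳ : ∀ f → f + [] ≋ f
  +-identityʳ f .at n = R.trans (coeff-+ f [] n) (R.+-identityʳ _)

  -‿cong : ∀ {f g} → f ≋ g → - f ≋ - g
  -‿cong {f} {g} e .at n = R.trans (coeff-neg f n) (R.trans (R.-‿cong (e .at n)) (R.sym (coeff-neg g n)))

  +-inverseʳ : ∀ f → f + - f ≋ []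
  +-inverseʳ f .at n = R.trans (coeff-+ f (- f) n) (R.trans (R.+-congˡ (coeff-neg f n)) (R.-‿inverseʳ _))

  +-inverseˡ : ∀ f → - f + f ≋ []
  +-inverseˡ f = ≋-trans (+-comm (- f) f) (+-inverseʳ f)

  ∷-cong : ∀ {a b f g} → a R.≈ b → f ≋ g → (a ∷ f) ≋ (b ∷ g)
  ∷-cong e e′ .at zero    = e
  ∷-cong e e′ .at (suc n) = e′ .at n

  shift-cong : ∀ {f g} → f ≋ g → shift f ≋ shift g
  shift-cong = ∷-cong R.refl

  scale-cong : ∀ {a b} {f g} → a R.≈ b → f ≋ g → List.map (a R.*_) f ≋ List.map (b R.*_) g
  scale-cong {a} {b} {f} {g} e e′ .at n = R.trans (coeff-scale a f n) (R.trans (R.*-cong e (e′ .at n)) (R.sym (coeff-scale b g n)))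

  map-σ-cong : ∀ {f g} → f ≋ g → List.map σ f ≋ List.map σ g
  map-σ-cong {f} {g} e .at n = R.trans (coeff-σ f n) (R.trans (σ-cong (e .at n)) (R.sym (coeff-σ g n)))

  -- This is `X * g`: moving X to the right past the coefficients of g applies σ to them.
  twist : Poly → Poly
  twist g = shift (List.map σ g)

  twist-cong : ∀ {f g} → f ≋ g → twist f ≋ twist g
  twist-cong e = shift-cong (map-σ-cong e)

  map-+ : ∀ {h} → (∀ {x y} → x R.≈ y → h x R.≈ h y) → h R.0# R.≈ R.0# → (∀ x y → h (x R.+ y) R.≈ h x R.+ h y) →
          ∀ f g → List.map h (f + g) ≋ List.map h f + List.map h g
  map-+ {h} h-cong h0 h-+ f g .at n = begin
    coeff (List.map h (f + g)) n  ≈⟨ coeff-map h0 (f + g) n ⟩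
    h (coeff (f + g) n)  ≈⟨ h-cong (coeff-+ f g n) ⟩
    h (coeff f n R.+ coeff g n)  ≈⟨ h-+ _ _ ⟩
    h (coeff f n) R.+ h (coeff g n)  ≈⟨ R.+-cong (coeff-map h0 f n) (coeff-map h0 g n) ⟨
    coeff (List.map h f) n R.+ coeff (List.map h g) n ≈⟨ coeff-+ (List.map h f) _ n ⟨
    coeff (List.map h f + List.map h g) n  ∎
    where open ≈-Reasoning R.setoid

  scale-+ : ∀ a f g → List.map (a R.*_) (f + g) ≋ List.map (a R.*_) f + List.map (a R.*_) g
  scale-+ a = map-+ R.*-congˡ (R.zeroʳ a) (R.distribˡ a)

  +-scale : ∀ a b f → List.map ((a R.+ b) R.*_) f ≋ List.map (a R.*_) f + List.map (b R.*_) f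
  +-scale a b f .at n = begin
    coeff (List.map ((a R.+ b) R.*_) f) n  ≈⟨ coeff-scale (a R.+ b) f n ⟩
    (a R.+ b) R.* coeff f n  ≈⟨ R.distribʳ _ _ _ ⟩
    a R.* coeff f n R.+ b R.* coeff f n  ≈⟨ R.+-cong (coeff-scale a f n) (coeff-scale b f n) ⟨
    coeff (List.map (a R.*_) f) n R.+ coeff (List.map (b R.*_) f) n  ≈⟨ coeff-+ (List.map (a R.*_) f) _ n ⟨
    coeff (List.map (a R.*_) f + List.map (b R.*_) f) n ∎
    where open ≈-Reasoning R.setoid

  scale-scale : ∀ a b f → List.map (a R.*_) (List.map (b R.*_) f) ≋ List.map ((a R.* b) R.*_) f
  scale-scale a b f .at n = begin
    coeff (List.map (a R.*_) (List.map (b R.*_) f)) n  ≈⟨ coeff-scale a (List.map (b R.*_) f) n ⟩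
    a R.* coeff (List.map (b R.*_) f) n  ≈⟨ R.*-congˡ (coeff-scale b f n) ⟩
    a R.* (b R.* coeff f n)  ≈⟨ R.*-assoc _ _ _ ⟨
    (a R.* b) R.* coeff f n  ≈⟨ coeff-scale (a R.* b) f n ⟨
    coeff (List.map ((a R.* b) R.*_) f) n  ∎
    where open ≈-Reasoning R.setoid

  scale-0 : ∀ f → List.map (R.0# R.*_) f ≋ []
  scale-0 f .at n = R.trans (coeff-scale R.0# f n) (R.zeroˡ _)

  scale-1 : ∀ f → List.map (R.1# R.*_) f ≋ f
  scale-1 f .at n = R.trans (coeff-scale R.1# f n) (R.*-identityˡ _)

  map-σ-+ : ∀ f g → List.map σ (f + g) ≋ List.map σ f + List.map σ g
  map-σ-+ = map-+ σ-cong σ-0 σ-+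

  map-σ-scale : ∀ a f → List.map σ (List.map (a R.*_) f) ≋ List.map (σ a R.*_) (List.map σ f)
  map-σ-scale a f .at n = begin
    coeff (List.map σ (List.map (a R.*_) f)) n  ≈⟨ coeff-σ (List.map (a R.*_) f) n ⟩
    σ (coeff (List.map (a R.*_) f) n)  ≈⟨ σ-cong (coeff-scale a f n) ⟩
    σ (a R.* coeff f n)  ≈⟨ σ-* _ _ ⟩
    σ a R.* σ (coeff f n)  ≈⟨ R.*-congˡ (coeff-σ f n) ⟨
    σ a R.* coeff (List.map σ f) n  ≈⟨ coeff-scale (σ a) (List.map σ f) n ⟨
    coeff (List.map (σ a R.*_) (List.map σ f)) n  ∎
    where open ≈-Reasoning R.setoid

  twist-+ : ∀ f g → twist (f + g) ≋ twist f + twist g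
  twist-+ f g = ∷-cong (R.sym (R.+-identityʳ _)) (map-σ-+ f g)

  *-congˡ : ∀ f {g g′} → g ≋ g′ → f * g ≋ f * g′
  *-congˡ []      e = ≋-refl
  *-congˡ (a ∷ f) e = +-cong (scale-cong R.refl e) (*-congˡ f (twist-cong e))

  shift-[] : shift [] ≋ []
  shift-[] .at zero    = R.refl
  shift-[] .at (suc n) = R.refl

  *-zeroʳ : ∀ f → f * [] ≋ []
  *-zeroʳ []      = ≋-refl
  *-zeroʳ (a ∷ f) = ≋-trans (*-congˡ f shift-[]) (*-zeroʳ f)

  ∷≋[]⇒tail : ∀ {a f} → a ∷ f ≋ [] → f ≋ []
  ∷≋[]⇒tail e .at n = e .at (suc n)

  zero-* : ∀ {f} g → f ≋ [] → f * g ≋ []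
  zero-* {[]}    g e = ≋-refl
  zero-* {a ∷ f} g e = ≋-trans (+-cong (scale-cong {f = g} (e .at 0) ≋-refl) (zero-* (twist g) (∷≋[]⇒tail e)))
    (≋-trans (+-identityʳ _) (scale-0 g))

  *-congʳ : ∀ {f f′} g → f ≋ f′ → f * g ≋ f′ * g
  *-congʳ {[]}    {f′}     g e = ≋-sym (zero-* g (≋-sym e))
  *-congʳ {a ∷ f} {[]}     g e = zero-* g e
  *-congʳ {a ∷ f} {b ∷ f′} g e = +-cong (scale-cong {f = g} (e .at 0) ≋-refl) (*-congʳ {f} {f′} (twist g) (coeffwise (e .at ∘ suc)))

  *-cong : ∀ {f f′ g g′} → f ≋ f′ → g ≋ g′ → f * g ≋ f′ * g′
  *-cong {f′ = f′} {g = g} e e′ = ≋-trans (*-congʳ g e) (*-congˡ f′ e′)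

  interchange : ∀ f g h k → (f + g) + (h + k) ≋ (f + h) + (g + k)
  interchange f g h k = begin
    (f + g) + (h + k) ≈⟨ +-assoc f g (h + k) ⟩
    f + (g + (h + k)) ≈⟨ +-congˡ f (+-assoc g h k) ⟨
    f + ((g + h) + k) ≈⟨ +-congˡ f (+-cong (+-comm g h) ≋-refl) ⟩
    f + ((h + g) + k) ≈⟨ +-congˡ f (+-assoc h g k) ⟩
    f + (h + (g + k)) ≈⟨ +-assoc f h (g + k) ⟨
    (f + h) + (g + k) ∎
    where open ≈-Reasoning ≋-setoid

  distribˡ : ∀ f g h → f * (g + h) ≋ f * g + f * h
  distribˡ []      g h = ≋-refl
  distribˡ (a ∷ f) g h = ≋-trans
    (+-cong (scale-+ a g h) (≋-trans (*-congˡ f (twist-+ g h)) (distribˡ f (twist g) (twist h))))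
    (interchange (List.map (a R.*_) g) (List.map (a R.*_) h) (f * twist g) (f * twist h))

  distribʳ : ∀ g f f′ → (f + f′) * g ≋ f * g + f′ * g
  distribʳ g []      f′       = ≋-refl
  distribʳ g (a ∷ f) []       = ≋-sym (+-identityʳ _)
  distribʳ g (a ∷ f) (b ∷ f′) = ≋-trans
    (+-cong (+-scale a b g) (distribʳ (twist g) f f′))
    (interchange (List.map (a R.*_) g) (List.map (b R.*_) g) (f * twist g) (f′ * twist g))

  scale-* : ∀ a f g → List.map (a R.*_) f * g ≋ List.map (a R.*_) (f * g)
  scale-* a []      g = ≋-refl
  scale-* a (b ∷ f) g = ≋-trans
    (+-cong (≋-sym (scale-scale a b g)) (scale-* a f (twist g)))
    (≋-sym (scale-+ a (List.map (b R.*_) g) (f * twist g)))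

  map-σ-* : ∀ f g → List.map σ (f * g) ≋ List.map σ f * List.map σ g
  map-σ-* []      g = ≋-refl
  map-σ-* (a ∷ f) g = ≋-trans
    (map-σ-+ (List.map (a R.*_) g) (f * twist g))
    (+-cong (map-σ-scale a g) (≋-trans (map-σ-* f (twist g)) (*-congˡ (List.map σ f) (∷-cong σ-0 ≋-refl))))

  *-shift : ∀ f g → f * shift g ≋ shift (f * g)
  *-shift []      g = ≋-sym shift-[]
  *-shift (a ∷ f) g = ≋-trans
    (+-cong (∷-cong (R.zeroʳ a) ≋-refl) (≋-trans (*-congˡ f (∷-cong R.refl (∷-cong σ-0 ≋-refl))) (*-shift f (twist g))))
    (∷-cong (R.+-identityʳ _) ≋-refl)

  shift-* : ∀ f g → shift f * g ≋ f * twist g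
  shift-* f g = +-cong (scale-0 g) ≋-refl

  -- Associativity with left factor X, the only nontrivial case of `*-assoc`; the multiplicativity
  -- of σ enters here.
  twist-* : ∀ g h → twist g * h ≋ twist (g * h)
  twist-* g h = ≋-trans (shift-* (List.map σ g) h) (≋-trans (*-shift (List.map σ g) (List.map σ h)) (shift-cong (≋-sym (map-σ-* g h))))

  *-assoc : ∀ f g h → (f * g) * h ≋ f * (g * h)
  *-assoc []      g h = ≋-refl
  *-assoc (a ∷ f) g h = ≋-trans (distribʳ h (List.map (a R.*_) g) (f * twist g))
    (+-cong (scale-* a g h) (≋-trans (*-assoc f (twist g) h) (*-congˡ f (twist-* g h))))

  *-identityˡ : ∀ f → const R.1# * f ≋ f
  *-identityˡ f = ≋-trans (+-identityʳ _) (scale-1 f)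

  *-identityʳ : ∀ f → f * const R.1# ≋ f
  *-identityʳ []      = ≋-refl
  *-identityʳ (a ∷ f) = ≋-trans
     (+-congˡ (const (a R.* R.1#)) (≋-trans (*-congˡ f (∷-cong R.refl (∷-cong σ-1 ≋-refl))) (*-shift f (const R.1#))))
     (∷-cong (R.trans (R.+-identityʳ _) (R.*-identityʳ a)) (*-identityʳ f))

  isRing : IsRing _≈_ _+_ _*_ -_ [] (const R.1#)
  isRing = record
    { +-isAbelianGroup = record
      { isGroup = record
        { isMonoid = record
          { isSemigroup = record
            { isMagma = record
              { isEquivalence = record { refl = λ n → R.refl ; sym = λ e n → R.sym (e n) ; trans = λ e e′ n → R.trans (e n) (e′ n) }
              ; ∙-cong = λ {f} {f′} {g} {g′} e e′ → +-cong {f} {f′} {g} {g′} (coeffwise e) (coeffwise e′) .at }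
            ; assoc = λ f g h → +-assoc f g h .at }
          ; identity = (λ f n → R.refl) , (λ f → +-identityʳ f .at) }
        ; inverse = (λ f → +-inverseˡ f .at) , (λ f → +-inverseʳ f .at)
        ; ⁻¹-cong = λ {f} {g} e → -‿cong {f} {g} (coeffwise e) .at }
      ; comm = λ f g → +-comm f g .at }
    ; *-cong = λ {f} {f′} {g} {g′} e e′ → *-cong {f} {f′} {g} {g′} (coeffwise e) (coeffwise e′) .at
    ; *-assoc = λ f g h → *-assoc f g h .at
    ; *-identity = (λ f → *-identityˡ f .at) , (λ f → *-identityʳ f .at)
    ; distrib = (λ f g h → distribˡ f g h .at) , (λ f g h → distribʳ f g h .at)
    }

  ring : Ring c ℓ
  ring = record { isRing = isRing }

  iter : ℕ → R.Carrier → R.Carrier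
  iter zero    x = x
  iter (suc n) x = iter n (σ x)

  iter-cong : ∀ n {x y} → x R.≈ y → iter n x R.≈ iter n y
  iter-cong zero    e = e
  iter-cong (suc n) e = iter-cong n (σ-cong e)

  -- The constant `a` passes to the left of `X ^ n`, and each X applies σ once.
  coeff-*-const : ∀ f a n → coeff (f * const a) n R.≈ coeff f n R.* iter n a
  coeff-*-const []      a n       = R.sym (R.zeroˡ _)
  coeff-*-const (b ∷ f) a zero    = R.trans (coeff-+ (const (b R.* a)) (f * twist (const a)) 0)
    (R.trans (R.+-congˡ (*-shift f (const (σ a)) .at 0)) (R.+-identityʳ _))
  coeff-*-const (b ∷ f) a (suc n) = R.trans (coeff-+ (const (b R.* a)) (f * twist (const a)) (suc n))
    (R.trans (R.+-identityˡ _) (R.trans (*-shift f (const (σ a)) .at (suc n)) (coeff-*-const f (σ a) n)))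

  -- The strict bound deg f < n: the case n = 0 singles out the zero polynomial, so descents on
  -- degrees need no separate convention for it.
  Below : Poly → ℕ → Set ℓ
  Below f n = ∀ m → n ℕ.≤ m → coeff f m R.≈ R.0#

  below-length : ∀ f → Below f (List.length f)
  below-length []      m       _           = R.refl
  below-length (a ∷ f) (suc m) (ℕ.s≤s n≤m) = below-length f m n≤m

  below-mono : ∀ f {m n} → m ℕ.≤ n → Below f m → Below f n
  below-mono f m≤n b k n≤k = b k (ℕₚ.≤-trans m≤n n≤k)

  below-zero : ∀ f → Below f 0 → f ≋ []
  below-zero f b .at n = b n ℕ.z≤n

  below-+ : ∀ f g {n} → Below f n → Below g n → Below (f + g) n
  below-+ f g bf bg m n≤m = R.trans (coeff-+ f g m) (R.trans (R.+-cong (bf m n≤m) (bg m n≤m)) (R.+-identityʳ _))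

  below-neg : ∀ f {n} → Below f n → Below (- f) n
  below-neg f b m n≤m = R.trans (coeff-neg f m) (R.trans (R.-‿cong (b m n≤m)) -0#≈0#)

  below-cong : ∀ {f g n} → f ≋ g → Below f n → Below g n
  below-cong e b m n≤m = R.trans (R.sym (e .at m)) (b m n≤m)

  below-tail : ∀ a f {n} → Below (a ∷ f) (suc n) → Below f n
  below-tail a f b m n≤m = b (suc m) (ℕ.s≤s n≤m)

  below-twist : ∀ f {n} → Below f n → Below (twist f) (suc n)
  below-twist f b (suc m) (ℕ.s≤s n≤m) = R.trans (coeff-σ f m) (R.trans (σ-cong (b m n≤m)) σ-0)

  below-scale : ∀ a f {n} → Below f n → Below (List.map (a R.*_) f) n
  below-scale a f b m n≤m = R.trans (coeff-scale a f m) (R.trans (R.*-congˡ (b m n≤m)) (R.zeroʳ a))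

  below-* : ∀ f g {m n} → Below f (suc m) → Below g n → Below (f * g) (m ℕ.+ n)
  below-* []      g bf bg k _ = R.refl
  below-* (a ∷ f) g {zero} {n} bf bg = below-+ (List.map (a R.*_) g) (f * twist g) (below-scale a g bg)
    λ k _ → zero-* (twist g) (below-zero f (below-tail a f bf)) .at k
  below-* (a ∷ f) g {suc m} {n} bf bg = below-+ (List.map (a R.*_) g) (f * twist g)
    (below-mono (List.map (a R.*_) g) (ℕₚ.m≤n+m n (suc m)) (below-scale a g bg))
    (≡.subst (Below (f * twist g)) (ℕₚ.+-suc m n) (below-* f (twist g) (below-tail a f bf) (below-twist g bg)))

  -- Here m and n are only upper bounds for the degrees, so either top coefficient may be zero. This
  -- is what allows a descent: when the product vanishes at m + n, one of the two bounds can be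
  -- lowered.
  top-* : ∀ f g m n → Below f (suc m) → Below g (suc n) → coeff (f * g) (m ℕ.+ n) R.≈ coeff f m R.* iter m (coeff g n)
  top-* []      g m       n bf bg = R.sym (R.zeroˡ _)
  top-* (a ∷ f) g zero    n bf bg = R.trans (coeff-+ (List.map (a R.*_) g) (f * twist g) n)
    (R.trans (R.+-cong (coeff-scale a g n) (zero-* (twist g) (below-zero f (below-tail a f bf)) .at n)) (R.+-identityʳ _))
  top-* (a ∷ f) g (suc m) n bf bg = R.trans (coeff-+ (List.map (a R.*_) g) (f * twist g) (suc m ℕ.+ n))
    (R.trans (R.+-cong
      (R.trans (coeff-scale a g (suc m ℕ.+ n)) (R.trans (R.*-congˡ (bg (suc (m ℕ.+ n)) (ℕ.s≤s (ℕₚ.m≤n+m n m)))) (R.zeroʳ a)))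
      (R.trans (R.reflexive (≡.cong (coeff (f * twist g)) (≡.sym (ℕₚ.+-suc m n))))
        (R.trans (top-* f (twist g) m (suc n) (below-tail a f bf) (below-twist g bg)) (R.*-congˡ (iter-cong m (coeff-σ g n))))))
      (R.+-identityˡ _))

  below-pred : ∀ f n → Below f (suc n) → coeff f n R.≈ R.0# → Below f n
  below-pred f n b e m n≤m with ℕₚ.m≤n⇒m<n∨m≡n n≤m
  ... | inj₁ n<m    = b m n<m
  ... | inj₂ ≡.refl = e

  module NoZeroDivisors (split : ∀ x n y → x R.* iter n y R.≈ R.0# → x R.≈ R.0# ⊎ y R.≈ R.0#) where

    -- Equality in R need not be decidable, so one cannot tell which factor vanishes.
    no-zero-divisors : ∀ f g → f * g ≈ [] → ¬ f ≈ [] → ¬ g ≈ [] → ⊥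
    no-zero-divisors f g fg≈0 f≉0 g≉0 = descend _ _ (below-length f) (below-length g)
      where
      descend : ∀ m n → Below f m → Below g n → ⊥
      descend zero    n       bf bg = f≉0 (below-zero f bf .at)
      descend (suc m) zero    bf bg = g≉0 (below-zero g bg .at)
      descend (suc m) (suc n) bf bg with split (coeff f m) m (coeff g n) (R.trans (R.sym (top-* f g m n bf bg)) (fg≈0 (m ℕ.+ n)))
      ... | inj₁ e = descend m (suc n) (below-pred f m bf e) bg
      ... | inj₂ e = descend (suc m) n bf (below-pred g n bg e)

    -- As long as the current bound m for deg f exceeds n, the coefficient of f² at 2 m vanishes; it
    -- is the product of the top coefficient of f with a twist of itself, so the bound drops. The
    -- descent starts from the length of the list.
    below-sqrt : ∀ f n → Below (f * f) (suc (n ℕ.+ n)) → Below f (suc n)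
    below-sqrt f n bff = descend (List.length f) (below-mono f (ℕₚ.m≤m+n _ _) (below-length f))
      where
      descend : ∀ k → Below f (k ℕ.+ suc n) → Below f (suc n)
      descend zero    b = b
      descend (suc k) b = descend k (below-pred f m b (reduce (split (coeff f m) m (coeff f m)
        (R.trans (R.sym (top-* f f m m b b)) (bff (m ℕ.+ m) (ℕₚ.+-mono-≤ (ℕₚ.m≤n+m (suc n) k) (ℕₚ.≤-trans (ℕₚ.n≤1+n n) (ℕₚ.m≤n+m (suc n) k))))))))
        where
        m = k ℕ.+ suc n
        reduce : ∀ {x} → x R.≈ R.0# ⊎ x R.≈ R.0# → x R.≈ R.0#
        reduce (inj₁ e) = e
        reduce (inj₂ e) = e

-- Coefficientwise homomorphisms and commutative polynomial rings.

module MapHomomorphism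
  {c ℓ c′ ℓ′} (R : CommutativeRing c ℓ) (S : CommutativeRing c′ ℓ′)
  {σ : CommutativeRing.Carrier R → CommutativeRing.Carrier R} {σ′ : CommutativeRing.Carrier S → CommutativeRing.Carrier S}
  (σ-hom : RingMorphisms.IsRingHomomorphism (CommutativeRing.rawRing R) (CommutativeRing.rawRing R) σ)
  (σ′-hom : RingMorphisms.IsRingHomomorphism (CommutativeRing.rawRing S) (CommutativeRing.rawRing S) σ′)
  {e : CommutativeRing.Carrier R → CommutativeRing.Carrier S}
  (e-hom : RingMorphisms.IsRingHomomorphism (CommutativeRing.rawRing R) (CommutativeRing.rawRing S) e)
  (e-σ : ∀ x → CommutativeRing._≈_ S (e (σ x)) (σ′ (e x)))
  where
  private
    module R = CommutativeRing R
    module S = CommutativeRing S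
    module Rτ = SkewRing R σ σ-hom
    module Sτ = SkewRing S σ′ σ′-hom
    module e = RingMorphisms.IsRingHomomorphism e-hom
  open Sτ using (at; ≋-refl; ≋-trans)

  coeff-map : ∀ f n → Sτ.coeff (List.map e f) n S.≈ e (Rτ.coeff f n)
  coeff-map []      n       = S.sym e.0#-homo
  coeff-map (a ∷ f) zero    = S.refl
  coeff-map (a ∷ f) (suc n) = coeff-map f n

  map-cong : ∀ {f g} → f Rτ.≈ g → List.map e f Sτ.≋ List.map e g
  map-cong {f} {g} f≈g .at n = S.trans (coeff-map f n) (S.trans (e.⟦⟧-cong (f≈g n)) (S.sym (coeff-map g n)))

  map-+ : ∀ f g → List.map e (f Rτ.+ g) Sτ.≋ List.map e f Sτ.+ List.map e g
  map-+ []      g       = ≋-refl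
  map-+ (a ∷ f) []      = ≋-refl
  map-+ (a ∷ f) (b ∷ g) = Sτ.∷-cong (e.+-homo a b) (map-+ f g)

  map-twist : ∀ g → List.map e (Rτ.twist g) Sτ.≋ Sτ.twist (List.map e g)
  map-twist g = Sτ.∷-cong e.0#-homo (go g)
    where
    go : ∀ g → List.map e (List.map σ g) Sτ.≋ List.map σ′ (List.map e g)
    go []      = ≋-refl
    go (a ∷ g) = Sτ.∷-cong (e-σ a) (go g)

  map-scale : ∀ a g → List.map e (List.map (a R.*_) g) Sτ.≋ List.map (e a S.*_) (List.map e g)
  map-scale a []      = ≋-refl
  map-scale a (b ∷ g) = Sτ.∷-cong (e.*-homo a b) (map-scale a g)

  map-* : ∀ f g → List.map e (f Rτ.* g) Sτ.≋ List.map e f Sτ.* List.map e g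
  map-* []      g = ≋-refl
  map-* (a ∷ f) g = ≋-trans (map-+ (List.map (a R.*_) g) (f Rτ.* Rτ.twist g))
    (Sτ.+-cong (map-scale a g) (≋-trans (map-* f (Rτ.twist g)) (Sτ.*-congˡ (List.map e f) (map-twist g))))

module PolynomialRing {c ℓ} (R : CommutativeRing c ℓ) where
  private module R = CommutativeRing R
  open SkewRing R id (Identity.isRingHomomorphism R.rawRing R.refl) public

  twist≡shift : ∀ f → twist f ≡ shift f
  twist≡shift f = ≡.cong (R.0# ∷_) (Listₚ.map-id f)

  iter-id : ∀ n x → iter n x ≡ x
  iter-id zero    x = ≡.refl
  iter-id (suc n) x = iter-id n x

  *-comm : ∀ f g → f * g ≋ g * f
  *-comm f []      = *-zeroʳ f
  *-comm f (b ∷ g) = begin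
    f * (b ∷ g)  ≈⟨ *-congˡ f (∷-cong (R.sym (R.+-identityʳ b)) ≋-refl) ⟩
    f * (const b + shift g)  ≈⟨ distribˡ f (const b) (shift g) ⟩
    f * const b + f * shift g  ≈⟨ +-cong right (≋-trans (*-shift f g) (shift-cong (*-comm f g))) ⟩
    List.map (b R.*_) f + shift (g * f)  ≈⟨ +-congˡ (List.map (b R.*_) f) (*-shift g f) ⟨
    List.map (b R.*_) f + g * shift f  ≡⟨ ≡.cong (λ h → List.map (b R.*_) f + g * h) (twist≡shift f) ⟨
    (b ∷ g) * f  ∎
    where
    open ≈-Reasoning ≋-setoid
    right : f * const b ≋ List.map (b R.*_) f
    right .at m = R.trans (coeff-*-const f b m) (R.trans (R.*-congˡ (R.reflexive (iter-id m b))) (R.trans (R.*-comm _ _) (R.sym (coeff-scale b f m))))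

  commutativeRing : CommutativeRing c ℓ
  commutativeRing = record { isCommutativeRing = record { isRing = isRing ; *-comm = λ f g → *-comm f g .at } }

-- The Frobenius endomorphism in prime characteristic.

prime∤! : ∀ {p} → ℕPrime.Prime p → ∀ k → k ℕ.< p → ¬ p ∣ⁿ k ℕ.!
prime∤! {p} pr zero    k<p p∣1 = ℕₚ.<⇒≱ (ℕ.nonTrivial⇒n>1 p {{prime⇒nonTrivial pr}}) (∣ⁿ.∣⇒≤ p∣1)
prime∤! {p} pr (suc k) k<p p∣k! with euclidsLemma (suc k) (k ℕ.!) pr p∣k!
... | inj₁ p∣k  = ℕₚ.<⇒≱ k<p (∣ⁿ.∣⇒≤ p∣k)
... | inj₂ p∣k! = prime∤! pr k (ℕₚ.<-trans (ℕₚ.n<1+n k) k<p) p∣k!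

-- The prime divides `p !`, which is this binomial coefficient times two factorials of numbers below
-- p, and it divides neither factorial.
prime∣C : ∀ {p} → ℕPrime.Prime p → ∀ k → suc k ℕ.< p → p ∣ⁿ p C suc k
prime∣C {zero}  pr k ()
prime∣C {p@(suc p-1)} pr k k<p with euclidsLemma (p C suc k) (suc k ℕ.! ℕ.* (p ℕ.∸ suc k) ℕ.!) pr (≡.subst (p ∣ⁿ_) (≡.sym C*≡!) (∣ⁿ.m∣m*n (p-1 ℕ.!)))
  where
  instance nz = (suc k) ℕₚ.!* (p ℕ.∸ suc k) !≢0
  C*≡! : (p C suc k) ℕ.* (suc k ℕ.! ℕ.* (p ℕ.∸ suc k) ℕ.!) ≡ p ℕ.!
  C*≡! = ≡.trans (≡.cong (ℕ._* (suc k ℕ.! ℕ.* (p ℕ.∸ suc k) ℕ.!)) (nCk≡n!/k![n-k]! (ℕₚ.<⇒≤ k<p))) (m/n*n≡m (k![n∸k]!∣n! (ℕₚ.<⇒≤ k<p)))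
... | inj₁ p∣C = p∣C
... | inj₂ p∣!! with euclidsLemma (suc k ℕ.!) ((p ℕ.∸ suc k) ℕ.!) pr p∣!!
...   | inj₁ p∣! = contradiction p∣! (prime∤! pr (suc k) k<p)
...   | inj₂ p∣! = contradiction p∣! (prime∤! pr (p ℕ.∸ suc k) (ℕ.s≤s (ℕₚ.m∸n≤m p-1 k)))

module _ {c ℓ} (R : CommutativeRing c ℓ) {p} (p-prime : ℕPrime.Prime p) where
  open CommutativeRing R hiding (zero)
  open Mult semiring renaming (_×_ to _·_)

  module Frobenius (p×1≈0 : p · 1# ≈ 0#) where
    open Exp commutativeSemiring public
    open Binomial commutativeSemiring using (binomialTerm; binomialExpansion; theorem)
    open Sum +-commutativeMonoid
    open ≈-Reasoning setoid

    multiple-vanishes : ∀ {n} → p ∣ⁿ n → ∀ x → n · x ≈ 0#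
    multiple-vanishes (divides k ≡.refl) x = begin
      (k ℕ.* p) · x  ≈⟨ ×-congʳ (k ℕ.* p) (*-identityˡ x) ⟨
      (k ℕ.* p) · (1# * x) ≈⟨ ×-assoc-* (k ℕ.* p) 1# x ⟨
      (k ℕ.* p) · 1# * x  ≈⟨ *-congʳ (×1-homo-* k p) ⟩
      (k · 1#) * (p · 1#) * x ≈⟨ *-congʳ (trans (*-congˡ p×1≈0) (zeroʳ _)) ⟩
      0# * x  ≈⟨ zeroˡ x ⟩
      0#  ∎

    ^p-+ : ∀ x y → (x + y) ^ p ≈ x ^ p + y ^ p
    ^p-+ x y = trans (theorem p x y) (expansion p ≡.refl)
      where
      -- The variable n stands for p: matching it as a successor exposes the two ends of the
      -- binomial sum, between which every term is a multiple of p.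
      expansion : ∀ n → p ≡ n → binomialExpansion x y n ≈ x ^ n + y ^ n
      expansion zero    e = ⊥-elim (ℕPrime.¬prime[0] (≡.subst ℕPrime.Prime e p-prime))
      expansion (suc m) e = begin
        t zero + sum (t ∘ suc)  ≈⟨ +-congˡ (sum-init-last (t ∘ suc)) ⟩
        t zero + (sum (t ∘ suc ∘ inject₁) + t (suc (Fin.fromℕ m)))  ≈⟨ +-cong first (+-cong (trans (sum-cong-≋ middle) (sum-replicate-zero m)) last) ⟩
        y ^ suc m + (0# + x ^ suc m)  ≈⟨ +-congˡ (+-identityˡ _) ⟩
        y ^ suc m + x ^ suc m  ≈⟨ +-comm _ _ ⟩
        x ^ suc m + y ^ suc m  ∎
        where
        t = binomialTerm x y (suc m)
        first : t zero ≈ y ^ suc m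
        first = trans (+-identityʳ _) (*-identityˡ _)
        middle : ∀ i → t (suc (inject₁ i)) ≈ 0#
        middle i = multiple-vanishes (≡.subst (_∣ⁿ (suc m C toℕ (suc (inject₁ i)))) (≡.sym e)
          (prime∣C (≡.subst ℕPrime.Prime e p-prime) (toℕ (inject₁ i)) (ℕ.s≤s (≡.subst (ℕ._< m) (≡.sym (Finₚ.toℕ-inject₁ i)) (Finₚ.toℕ<n i))))) _
        last : t (suc (Fin.fromℕ m)) ≈ x ^ suc m
        last rewrite Finₚ.toℕ-fromℕ m | nCn≡1 (suc m) | ℕₚ.n∸n≡0 m = trans (+-identityʳ _) (*-identityʳ _)

    ^-pow : ∀ x m → x ^ (p ℕ.^ suc m) ≈ (x ^ p) ^ (p ℕ.^ m)
    ^-pow x m = sym (^-assocʳ x p (p ℕ.^ m))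

    frobenius-+ : ∀ k x y → (x + y) ^ (p ℕ.^ k) ≈ x ^ (p ℕ.^ k) + y ^ (p ℕ.^ k)
    frobenius-+ zero    x y = trans (*-identityʳ _) (+-cong (sym (*-identityʳ x)) (sym (*-identityʳ y)))
    frobenius-+ (suc k) x y = begin
      (x + y) ^ (p ℕ.^ suc k)  ≈⟨ ^-pow (x + y) k ⟩
      ((x + y) ^ p) ^ (p ℕ.^ k)  ≈⟨ ^-congˡ (p ℕ.^ k) (^p-+ x y) ⟩
      (x ^ p + y ^ p) ^ (p ℕ.^ k)  ≈⟨ frobenius-+ k (x ^ p) (y ^ p) ⟩
      (x ^ p) ^ (p ℕ.^ k) + (y ^ p) ^ (p ℕ.^ k)  ≈⟨ +-cong (^-pow x k) (^-pow y k) ⟨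
      x ^ (p ℕ.^ suc k) + y ^ (p ℕ.^ suc k)  ∎

1^n≈1 : ∀ {c ℓ} (R : CommutativeRing c ℓ) → let open CommutativeRing R hiding (zero) in let open Exp commutativeSemiring in ∀ n → 1# ^ n ≈ 1#
1^n≈1 R zero    = CommutativeRing.refl R
1^n≈1 R (suc n) = CommutativeRing.trans R (CommutativeRing.*-identityˡ R _) (1^n≈1 R n)

module _ {c ℓ} (R : CommutativeRing c ℓ) {p} (p-prime : ℕPrime.Prime p) where
  open CommutativeRing R hiding (zero)
  open Mult semiring renaming (_×_ to _·_)

  module FrobeniusHomomorphism (p×1≈0 : p · 1# ≈ 0#) (k : ℕ) {q} (q≡p^k : q ≡ p ℕ.^ k) where
    open Frobenius R p-prime p×1≈0
    open GroupProperties +-group using (inverseˡ-unique; identityʳ-unique)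

    ^q-+ : ∀ x y → (x + y) ^ q ≈ x ^ q + y ^ q
    ^q-+ x y rewrite q≡p^k = frobenius-+ k x y

    ^q-0 : 0# ^ q ≈ 0#
    ^q-0 = identityʳ-unique (0# ^ q) (0# ^ q) (trans (sym (^q-+ 0# 0#)) (^-congˡ q (+-identityˡ 0#)))

    isRingHomomorphism : RingMorphisms.IsRingHomomorphism rawRing rawRing (_^ q)
    isRingHomomorphism = record
      { isSemiringHomomorphism = record
        { isNearSemiringHomomorphism = record
          { +-isMonoidHomomorphism = record
            { isMagmaHomomorphism = record { isRelHomomorphism = record { cong = ^-congˡ q } ; homo = ^q-+ }
            ; ε-homo = ^q-0 }
          ; *-homo = λ x y → ^-distrib-* x y q }
        ; 1#-homo = 1^n≈1 R q }
      ; -‿homo = λ x → inverseˡ-unique ((- x) ^ q) (x ^ q) (trans (sym (^q-+ (- x) x)) (trans (^-congˡ q (-‿inverseˡ x)) ^q-0)) }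

-- Fields and finite fields.

module FieldProperties {c ℓ} (K : Field c ℓ) where
  open Field K hiding (zero)
  open RingProperties ring using (x[y-z]≈xy-xz; x∙y⁻¹≈ε⇒x≈y; x≈y⇒x∙y⁻¹≈ε)
  open ≈-Reasoning setoid

  *-cancelˡ-0 : ∀ {x y} → x ≉ 0# → x * y ≈ 0# → y ≈ 0#
  *-cancelˡ-0 {x} {y} x≉0 xy≈0 = let z , xz≈1 = inverse x x≉0 in begin
    y  ≈⟨ *-identityˡ y ⟨
    1# * y  ≈⟨ *-congʳ (trans (*-comm z x) xz≈1) ⟨
    z * x * y  ≈⟨ *-assoc z x y ⟩
    z * (x * y) ≈⟨ *-congˡ xy≈0 ⟩
    z * 0#  ≈⟨ zeroʳ z ⟩
    0#  ∎

  *-cancelˡ-≈ : ∀ {x y z} → x ≉ 0# → x * y ≈ x * z → y ≈ z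
  *-cancelˡ-≈ {x} {y} {z} x≉0 e = x∙y⁻¹≈ε⇒x≈y y z (*-cancelˡ-0 x≉0 (trans (x[y-z]≈xy-xz x y z) (x≈y⇒x∙y⁻¹≈ε e)))

  *-≉0 : ∀ {x y} → x ≉ 0# → y ≉ 0# → x * y ≉ 0#
  *-≉0 x≉0 y≉0 e = y≉0 (*-cancelˡ-0 x≉0 e)

-- Both facts come from reindexing Fin q by a permutation of 𝔽: translation by 1 in
-- Σ x, multiplication by c in ∏_{x ≠ 0} x.
module FiniteFieldProperties {c ℓ q} (𝔽 : FiniteField c ℓ q) where
  open FiniteField 𝔽 hiding (zero)
  open FieldProperties base public
  open Bijection enumeration using (to; injective; surjective) renaming (cong to to-cong)
  open Mult semiring renaming (_×_ to _·_)
  open Exp commutativeSemiring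
  open GroupProperties +-group using (identityʳ-unique)
  open ≈-Reasoning setoid
  private
    module ∑ = Sum +-commutativeMonoid
    module ∏ = Sum *-commutativeMonoid

  from : Fin q → Carrier
  from i = proj₁ (surjective i)

  to-from : ∀ i → to (from i) ≡ i
  to-from i = proj₂ (surjective i) refl

  from-to : ∀ x → from (to x) ≈ x
  from-to x = injective (to-from (to x))

  bijection⇒permutation : (f g : Carrier → Carrier) → (∀ {x y} → x ≈ y → f x ≈ f y) → (∀ {x y} → x ≈ y → g x ≈ g y) →
    (∀ x → f (g x) ≈ x) → (∀ x → g (f x) ≈ x) → Permutation q q
  bijection⇒permutation f g f-cong g-cong fg gf = permutation (to ∘ f ∘ from) (to ∘ g ∘ from)
    (λ i → ≡.trans (to-cong (trans (f-cong (from-to (g (from i)))) (fg (from i)))) (to-from i))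
    (λ i → ≡.trans (to-cong (trans (g-cong (from-to (f (from i)))) (gf (from i)))) (to-from i))

  x*y≈0⇒x≈0∨y≈0 : ∀ x y → x * y ≈ 0# → x ≈ 0# ⊎ y ≈ 0#
  x*y≈0⇒x≈0∨y≈0 x y xy≈0 with x ≟ 0#
  ... | yes x≈0 = inj₁ x≈0
  ... | no  x≉0 = inj₂ (*-cancelˡ-0 x≉0 xy≈0)

  q×1≈0 : q · 1# ≈ 0#
  q×1≈0 = identityʳ-unique (∑.sum from) (q · 1#) (begin
    ∑.sum from + q · 1#  ≈⟨ +-congˡ (∑.sum-replicate q) ⟨
    ∑.sum from + ∑.sum {q} (λ _ → 1#)  ≈⟨ ∑.∑-distrib-+ from (λ _ → 1#) ⟨
    ∑.sum (λ i → from i + 1#)  ≈⟨ ∑.sum-cong-≋ (λ i → from-to (from i + 1#)) ⟨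
    ∑.sum (λ i → from (to (from i + 1#)))  ≈⟨ ∑.sum-permute from π ⟨
    ∑.sum from  ∎)
    where
    π = bijection⇒permutation (_+ 1#) (_+ - 1#) +-congʳ +-congʳ
      (λ x → trans (+-assoc x _ _) (trans (+-congˡ (-‿inverseˡ 1#)) (+-identityʳ x)))
      (λ x → trans (+-assoc x _ _) (trans (+-congˡ (-‿inverseʳ 1#)) (+-identityʳ x)))

  product-single : ∀ {n} (i : Fin n) (e : Vector Carrier n) {c} → e i ≈ c → (∀ j → j ≢ i → e j ≈ 1#) → ∏.sum e ≈ c
  product-single {suc n} zero e ei ej = trans (*-cong ei (trans (∏.sum-cong-≋ λ j → ej (suc j) λ ()) (∏.sum-replicate-zero n))) (*-identityʳ _)
  product-single {suc n} (suc i) e ei ej = trans (*-cong (ej zero λ ()) (product-single i (e ∘ suc) ei λ j j≢i → ej (suc j) (j≢i ∘ Finₚ.suc-injective))) (*-identityˡ _)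

  ∏≉0 : ∀ {n} (e : Vector Carrier n) → (∀ i → e i ≉ 0#) → ∏.sum e ≉ 0#
  ∏≉0 {zero}  e e≉0 = 1≉0
  ∏≉0 {suc n} e e≉0 = *-≉0 (e≉0 zero) (∏≉0 (e ∘ suc) (e≉0 ∘ suc))

  nonzeroOr : Carrier → Carrier → Carrier → Carrier
  nonzeroOr a b x with x ≟ 0#
  ... | yes _ = a
  ... | no  _ = b

  nonzeroOr-0 : ∀ {a b x} → x ≈ 0# → nonzeroOr a b x ≈ a
  nonzeroOr-0 {x = x} x≈0 with x ≟ 0#
  ... | yes _   = refl
  ... | no  x≉0 = contradiction x≈0 x≉0

  nonzeroOr-≉0 : ∀ {a b x} → x ≉ 0# → nonzeroOr a b x ≈ b
  nonzeroOr-≉0 {x = x} x≉0 with x ≟ 0#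
  ... | yes x≈0 = contradiction x≈0 x≉0
  ... | no  _   = refl

  fermat : ∀ c → c ^ q ≈ c
  fermat c with c ≟ 0#
  ... | yes c≈0 = trans (^-congˡ q c≈0) (trans (0^q q (to 0#)) (sym c≈0))
    where
    -- The element `to 0#` of `Fin q` shows that q is positive, without which this power would be 1.
    0^q : ∀ q → Fin q → 0# ^ q ≈ 0#
    0^q (suc q) _ = zeroˡ _
  ... | no c≉0 = *-cancelˡ-≈ (∏≉0 (g ∘ from) (g≉0 ∘ from)) (begin
    P * c ^ q  ≈⟨ *-comm P (c ^ q) ⟩
    c ^ q * P  ≈⟨ *-congʳ (∏.sum-replicate q) ⟨
    ∏.sum {q} (λ _ → c) * P  ≈⟨ ∏.∑-distrib-+ (λ _ → c) (g ∘ from) ⟨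
    ∏.sum (λ i → c * g (from i))  ≈⟨ ∏.sum-cong-≋ (λ i → step (from i)) ⟩
    ∏.sum (λ i → e (from i) * g (c * from i))  ≈⟨ ∏.∑-distrib-+ (e ∘ from) (λ i → g (c * from i)) ⟩
    ∏.sum (e ∘ from) * ∏.sum (λ i → g (c * from i))  ≈⟨ *-cong ∏e≈c (∏.sum-cong-≋ λ i → g-cong (sym (from-to (c * from i)))) ⟩
    c * ∏.sum (λ i → g (from (to (c * from i))))  ≈⟨ *-congˡ (∏.sum-permute (g ∘ from) π) ⟨
    c * P  ≈⟨ *-comm c P ⟩
    P * c  ∎)
    where
    d = proj₁ (inverse c c≉0)
    -- The product of `g` over all of 𝔽 is that of the nonzero elements, with 1 in the place of 0.
    -- Multiplication by c permutes the nonzero elements but leaves a surplus factor c at 0, which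
    -- `e` records; hence the comparison yields c^q = c directly instead of c^(q-1) = 1.
    g e : Carrier → Carrier
    g x = nonzeroOr 1# x x
    e x = nonzeroOr c 1# x
    P = ∏.sum (g ∘ from)
    g≉0 : ∀ x → g x ≉ 0#
    g≉0 x gx≈0 with x ≟ 0#
    ... | yes _   = 1≉0 gx≈0
    ... | no  x≉0 = x≉0 gx≈0
    g-cong : ∀ {x y} → x ≈ y → g x ≈ g y
    g-cong {x} {y} x≈y with x ≟ 0#
    ... | yes x≈0 = sym (nonzeroOr-0 (trans (sym x≈y) x≈0))
    ... | no  x≉0 = trans x≈y (sym (nonzeroOr-≉0 (x≉0 ∘ trans x≈y)))
    step : ∀ x → c * g x ≈ e x * g (c * x)
    step x with x ≟ 0#
    ... | yes x≈0 = *-congˡ (sym (nonzeroOr-0 (trans (*-congˡ x≈0) (zeroʳ c))))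
    ... | no  x≉0 = sym (trans (*-identityˡ _) (nonzeroOr-≉0 (*-≉0 c≉0 x≉0)))
    ∏e≈c : ∏.sum (e ∘ from) ≈ c
    ∏e≈c = product-single (to 0#) (e ∘ from) (nonzeroOr-0 (from-to 0#))
      λ j j≢ → nonzeroOr-≉0 λ fj≈0 → j≢ (≡.trans (≡.sym (to-from j)) (to-cong fj≈0))
    π = bijection⇒permutation (c *_) (d *_) *-congˡ *-congˡ
      (λ x → trans (sym (*-assoc c d x)) (trans (*-congʳ (proj₂ (inverse c c≉0))) (*-identityˡ x)))
      (λ x → trans (sym (*-assoc d c x)) (trans (*-congʳ (trans (*-comm d c) (proj₂ (inverse c c≉0)))) (*-identityˡ x)))

  -- The image of q is a power of the image of p and equals 0; a field has no zero divisors, and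
  -- exponent 0 would give 1 = 0.
  characteristic : ∀ {p k} → q ≡ p ℕ.^ k → p · 1# ≈ 0#
  characteristic {p} {k} q≡ = go k (≡.subst (λ n → n · 1# ≈ 0#) q≡ q×1≈0)
    where
    go : ∀ k → (p ℕ.^ k) · 1# ≈ 0# → p · 1# ≈ 0#
    go zero    e = contradiction (trans (sym (+-identityʳ 1#)) e) 1≉0
    go (suc k) e with x*y≈0⇒x≈0∨y≈0 (p · 1#) ((p ℕ.^ k) · 1#) (trans (sym (×1-homo-* p (p ℕ.^ k))) e)
    ... | inj₁ e′ = e′
    ... | inj₂ e′ = go k e′

-- The library's ring solver, with the integers as coefficients: (m , n) stands for m - n.
module Solver {c ℓ} (R : CommutativeRing c ℓ) where
  private
    open CommutativeRing R hiding (zero)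
    open Mult semiring renaming (_×_ to _·_)
    open RingProperties ring using (x[y-z]≈xy-xz; -‿distribˡ-*; -0#≈0#)
    open AbelianGroupProperties +-abelianGroup using (⁻¹-∙-comm; ⁻¹-anti-homo‿-)
    open ≈-Reasoning setoid

    -- Cancelling common successors gives each integer a unique pair, so that `decide` may compare
    -- pairs syntactically.
    reduce : ℕ → ℕ → ℕ × ℕ
    reduce (suc m) (suc n) = reduce m n
    reduce m       n       = m , n

    -- The pair (1 , 0) is sent to `1#` itself and not to a sum equal to it, so that an identity
    -- solved with `:1` has literally `1#` in its statement.
    value : ℕ × ℕ → Carrier
    value (1 , 0) = 1#
    value (m , n) = m · 1# - n · 1#

    difference : ℕ × ℕ → Carrier
    difference (m , n) = m · 1# - n · 1#

    value≈difference : ∀ m n → value (m , n) ≈ difference (m , n)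
    value≈difference 0             n       = refl
    value≈difference 1             0       = sym (trans (+-cong (+-identityʳ 1#) -0#≈0#) (+-identityʳ 1#))
    value≈difference 1             (suc n) = refl
    value≈difference (suc (suc m)) n       = refl

    coefficients : RawRing _ _
    coefficients = record
      { Carrier = ℕ × ℕ
      ; _≈_ = _≡_
      ; _+_ = λ (m , n) (m′ , n′) → reduce (m ℕ.+ m′) (n ℕ.+ n′)
      ; _*_ = λ (m , n) (m′ , n′) → reduce (m ℕ.* m′ ℕ.+ n ℕ.* n′) (m ℕ.* n′ ℕ.+ n ℕ.* m′)
      ; -_ = λ (m , n) → n , m
      ; 0# = 0 , 0
      ; 1# = 1 , 0 }

    +-interchange : ∀ a b c d → (a + b) + (c + d) ≈ (a + c) + (b + d)
    +-interchange a b c d = trans (+-assoc a b _) (trans (+-congˡ (trans (sym (+-assoc b c d)) (trans (+-congʳ (+-comm b c)) (+-assoc c b d)))) (sym (+-assoc a c _)))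

    difference-+ : ∀ a b c d → (a + c) - (b + d) ≈ (a - b) + (c - d)
    difference-+ a b c d = trans (+-congˡ (sym (⁻¹-∙-comm b d))) (+-interchange a c (- b) (- d))

    value-reduce : ∀ m n → difference (reduce m n) ≈ difference (m , n)
    value-reduce zero    n       = refl
    value-reduce (suc m) zero    = refl
    value-reduce (suc m) (suc n) = begin
      difference (reduce m n)  ≈⟨ value-reduce m n ⟩
      difference (m , n)  ≈⟨ +-identityˡ _ ⟨
      0# + difference (m , n)  ≈⟨ +-congʳ (-‿inverseʳ 1#) ⟨
      (1# - 1#) + difference (m , n)  ≈⟨ difference-+ 1# 1# (m · 1#) (n · 1#) ⟨
      difference (suc m , suc n)  ∎

    product : ∀ a b c d → (a * c + b * d) - (a * d + b * c) ≈ (a - b) * (c - d)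
    product a b c d = begin
      (a * c + b * d) - (a * d + b * c)  ≈⟨ difference-+ (a * c) (a * d) (b * d) (b * c) ⟩
      (a * c - a * d) + (b * d - b * c)  ≈⟨ +-cong (x[y-z]≈xy-xz a c d) (⁻¹-anti-homo‿- (b * c) (b * d)) ⟨
      a * (c - d) + - (b * c - b * d)  ≈⟨ +-congˡ (-‿cong (x[y-z]≈xy-xz b c d)) ⟨
      a * (c - d) + - (b * (c - d))  ≈⟨ +-congˡ (-‿distribˡ-* b (c - d)) ⟩
      a * (c - d) + - b * (c - d)  ≈⟨ distribʳ (c - d) a (- b) ⟨
      (a - b) * (c - d)  ∎

    normalise : ∀ m n → value (reduce m n) ≈ difference (m , n)
    normalise m n = trans (value≈difference (proj₁ (reduce m n)) _) (value-reduce m n)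

    morphism : coefficients -Raw-AlmostCommutative⟶ fromCommutativeRing R
    morphism = record
      { ⟦_⟧    = value
      ; +-homo = λ (m , n) (m′ , n′) → trans (normalise (m ℕ.+ m′) _)
          (trans (+-cong (×-homo-+ 1# m m′) (-‿cong (×-homo-+ 1# n n′))) (trans (difference-+ (m · 1#) (n · 1#) (m′ · 1#) (n′ · 1#)) (sym (+-cong (value≈difference m n) (value≈difference m′ n′)))))
      ; *-homo = λ (m , n) (m′ , n′) → trans (normalise (m ℕ.* m′ ℕ.+ _) _)
          (trans (+-cong (trans (×-homo-+ 1# (m ℕ.* m′) _) (+-cong (×1-homo-* m m′) (×1-homo-* n n′)))
                         (-‿cong (trans (×-homo-+ 1# (m ℕ.* n′) _) (+-cong (×1-homo-* m n′) (×1-homo-* n m′)))))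
                 (trans (product (m · 1#) (n · 1#) (m′ · 1#) (n′ · 1#)) (sym (*-cong (value≈difference m n) (value≈difference m′ n′)))))
      ; -‿homo = λ (m , n) → trans (value≈difference n m) (trans (sym (⁻¹-anti-homo‿- (m · 1#) (n · 1#))) (-‿cong (sym (value≈difference m n))))
      ; 0-homo = -‿inverseʳ 0#
      ; 1-homo = refl }

    decide : ∀ a b → Maybe (value a ≈ value b)
    decide (m , n) (m′ , n′) with m ℕₚ.≟ m′ | n ℕₚ.≟ n′
    ... | yes ≡.refl | yes ≡.refl = just refl
    ... | _          | _          = nothing

  open RingSolver coefficients (fromCommutativeRing R) morphism decide public

  :1 : ∀ {n} → Polynomial n
  :1 = con (1 , 0)

-- Traces and discriminants in an order of rank two.

module TraceIdentities {o ℓ} (A : CommutativeRing o ℓ) where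
  open CommutativeRing A
  open Solver A using (solve; _:=_; _:+_; _:*_; _:-_; :-_; :1)

  -- The passage between the bases α₀, α₁ and 1, u has the rows (x , y) and (- c , a), of
  -- determinant x a + y c. The four identities `basis-inverse` say that the adjugate matrix inverts
  -- it, on either side, up to this determinant.
  basis-inverse₁ : ∀ p r a c x y → (p * a + r * c) * x - (r * x - p * y) * c ≈ p * (x * a + y * c)
  basis-inverse₁ = solve 6 (λ p r a c x y → (p :* a :+ r :* c) :* x :- (r :* x :- p :* y) :* c := p :* (x :* a :+ y :* c)) refl

  basis-inverse₂ : ∀ p r a c x y → (p * a + r * c) * y + (r * x - p * y) * a ≈ r * (x * a + y * c)
  basis-inverse₂ = solve 6 (λ p r a c x y → (p :* a :+ r :* c) :* y :+ (r :* x :- p :* y) :* a := r :* (x :* a :+ y :* c)) refl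

  basis-inverse₃ : ∀ m k a c x y → m * (x * a + y * c) ≈ a * (m * x - k * c) + c * (m * y + k * a)
  basis-inverse₃ = solve 6 (λ m k a c x y → m :* (x :* a :+ y :* c) := a :* (m :* x :- k :* c) :+ c :* (m :* y :+ k :* a)) refl

  basis-inverse₄ : ∀ m k a c x y → k * (x * a + y * c) ≈ x * (m * y + k * a) - y * (m * x - k * c)
  basis-inverse₄ = solve 6 (λ m k a c x y → k :* (x :* a :+ y :* c) := x :* (m :* y :+ k :* a) :- y :* (m :* x :- k :* c)) refl

  product-coordinate : ∀ m k m′ k′ t → m * k′ + k * (m′ + k′ * t) ≈ m * k′ + k * m′ + k * k′ * t
  product-coordinate = solve 5 (λ m k m′ k′ t → m :* k′ :+ k :* (m′ :+ k′ :* t) := m :* k′ :+ k :* m′ :+ k :* k′ :* t) refl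

  -- The coordinates of (2 u - t)² with respect to 1, u when u² = n + t u; the coefficient of u
  -- cancels, which is the purpose of subtracting t.
  square-coordinate₀ : ∀ t n → - t * - t + (1# + 1#) * (1# + 1#) * n ≈ t * t + (1# + 1#) * (1# + 1#) * n
  square-coordinate₀ = solve 2 (λ t n → :- t :* :- t :+ (:1 :+ :1) :* (:1 :+ :1) :* n := t :* t :+ (:1 :+ :1) :* (:1 :+ :1) :* n) refl

  square-coordinate₁ : ∀ t → - t * (1# + 1#) + (1# + 1#) * - t + (1# + 1#) * (1# + 1#) * t ≈ 0#
  square-coordinate₁ t = trans (solve 1 (λ t → :- t :* (:1 :+ :1) :+ (:1 :+ :1) :* (:- t) :+ (:1 :+ :1) :* (:1 :+ :1) :* t := t :- t) refl t) (-‿inverseʳ t)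

  -- Used with κ π = f + g u. Multiplication by κ g makes it possible to compare the trace
  -- `n₀₀ + n₁₁` of a matrix in the basis 1, π with 2 m + k t, the trace of m + k u in the basis 1,
  -- u.
  trace-matrix₁ : ∀ κ g f n₀₀ n₁₀ n₁₁ → κ * g * (n₀₀ + n₁₁) ≈ g * (κ * n₀₀ + n₁₀ * f) - f * (n₁₀ * g) + κ * (n₁₁ * g)
  trace-matrix₁ = solve 6 (λ κ g f n₀₀ n₁₀ n₁₁ → κ :* g :* (n₀₀ :+ n₁₁) := g :* (κ :* n₀₀ :+ n₁₀ :* f) :- f :* (n₁₀ :* g) :+ κ :* (n₁₁ :* g)) refl

  trace-matrix₂ : ∀ κ g f s m k t → g * (κ * (s * m)) - f * (κ * (s * k)) + κ * (s * (m * g + k * f + k * g * t)) ≈ κ * g * (s * ((1# + 1#) * m + k * t))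
  trace-matrix₂ = solve 7 (λ κ g f s m k t → g :* (κ :* (s :* m)) :- f :* (κ :* (s :* k)) :+ κ :* (s :* (m :* g :+ k :* f :+ k :* g :* t))
                              := κ :* g :* (s :* ((:1 :+ :1) :* m :+ k :* t))) refl

  minor : ∀ a c x y → a * x - c * (- y) ≈ x * a + y * c
  minor = solve 4 (λ a c x y → a :* x :- c :* (:- y) := x :* a :+ y :* c) refl

  module _ (n t : Carrier) where
    -- When u² = n + t u, the product (p + q u)(p′ + q′ u) has the coordinates `m*` and `k*` with
    -- respect to 1, u, and `T*` is its trace.
    m* k* T* : Carrier → Carrier → Carrier → Carrier → Carrier
    m* p q p′ q′ = p * p′ + q * q′ * n
    k* p q p′ q′ = p * q′ + q * p′ + q * q′ * t
    T* p q p′ q′ = (1# + 1#) * m* p q p′ q′ + k* p q p′ q′ * t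

    k*-determinant : ∀ a₀ b₀ a₁ b₁ → (a₀ * b₁ - a₁ * b₀) * (a₀ * b₁ - a₁ * b₀) ≈ k* a₀ b₀ a₁ b₁ * k* a₀ b₀ a₁ b₁ - k* a₀ b₀ a₀ b₀ * k* a₁ b₁ a₁ b₁
    k*-determinant a₀ b₀ a₁ b₁ = solve 5 (λ a₀ b₀ a₁ b₁ t →
                      let k* p q p′ q′ = p :* q′ :+ q :* p′ :+ q :* q′ :* t in
                      (a₀ :* b₁ :- a₁ :* b₀) :* (a₀ :* b₁ :- a₁ :* b₀)
                      := k* a₀ b₀ a₁ b₁ :* k* a₀ b₀ a₁ b₁ :- k* a₀ b₀ a₀ b₀ :* k* a₁ b₁ a₁ b₁) refl a₀ b₀ a₁ b₁ t

    -- The base change formula for discriminants: t² + 4 n belongs to the basis 1, u, and the square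
    -- is that of the determinant of the elements aᵢ + bᵢ u.
    T*-determinant : ∀ a₀ b₀ a₁ b₁ → T* a₀ b₀ a₀ b₀ * T* a₁ b₁ a₁ b₁ - T* a₀ b₀ a₁ b₁ * T* a₁ b₁ a₀ b₀
                     ≈ (t * t + (1# + 1#) * (1# + 1#) * n) * ((a₀ * b₁ - a₁ * b₀) * (a₀ * b₁ - a₁ * b₀))
    T*-determinant a₀ b₀ a₁ b₁ = solve 6 (λ a₀ b₀ a₁ b₁ n t →
                   let m* p q p′ q′ = p :* p′ :+ q :* q′ :* n
                       k* p q p′ q′ = p :* q′ :+ q :* p′ :+ q :* q′ :* t
                       T* p q p′ q′ = (:1 :+ :1) :* m* p q p′ q′ :+ k* p q p′ q′ :* t in
                   T* a₀ b₀ a₀ b₀ :* T* a₁ b₁ a₁ b₁ :- T* a₀ b₀ a₁ b₁ :* T* a₁ b₁ a₀ b₀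
                   := (t :* t :+ (:1 :+ :1) :* (:1 :+ :1) :* n) :* ((a₀ :* b₁ :- a₁ :* b₀) :* (a₀ :* b₁ :- a₁ :* b₀))) refl a₀ b₀ a₁ b₁ n t

module _ {o ℓ o′ ℓ′ o″ ℓ″} (A : CommutativeRing o ℓ) (𝓡 : Ring o′ ℓ′) (K : Field o″ ℓ″) where
  private module A = CommutativeRing A
  private module 𝓡 = Ring 𝓡
  private module K = Field K

  module TraceZeroElement (split : ∀ x y → x A.* y A.≈ A.0# → x A.≈ A.0# ⊎ y A.≈ A.0#) (zero? : ∀ x → Dec (x A.≈ A.0#)) (1≉0 : A.1# A.≉ A.0#)
    (φ : A.Carrier → 𝓡.Carrier) (φ-hom : RingMorphisms.IsRingHomomorphism A.rawRing 𝓡.rawRing φ) (ι : A.Carrier → K.Carrier)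
    (ι-mono : RingMorphisms.IsRingMonomorphism A.rawRing K.rawRing ι) where
    open 𝓡 using (_≈_; _+_; _*_)
    private
      module φ = RingMorphisms.IsRingHomomorphism φ-hom
      module ι = RingMorphisms.IsRingMonomorphism ι-mono
      module Aₚ = RingProperties A.ring
    open TraceIdentities A

    IsCentralizing : 𝓡.Carrier → Set _
    IsCentralizing u = ∀ a → u * φ a ≈ φ a * u

    *-split-≉ : ∀ {x y} → x A.≉ A.0# → y A.≉ A.0# → x A.* y A.≉ A.0#
    *-split-≉ x≉0 y≉0 xy≈0 with split _ _ xy≈0
    ... | inj₁ x≈0 = x≉0 x≈0
    ... | inj₂ y≈0 = y≉0 y≈0

    cancel : ∀ {x y z} → x A.≉ A.0# → x A.* y A.≈ x A.* z → y A.≈ z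
    cancel {x} {y} {z} x≉0 e with split x (y A.- z) (A.trans (Aₚ.x[y-z]≈xy-xz x y z) (Aₚ.x≈y⇒x∙y⁻¹≈ε e))
    ... | inj₁ x≈0   = contradiction x≈0 x≉0
    ... | inj₂ y-z≈0 = Aₚ.x∙y⁻¹≈ε⇒x≈y y z y-z≈0

    +-interchange : ∀ a b c d → (a + b) + (c + d) ≈ (a + c) + (b + d)
    +-interchange a b c d = 𝓡.trans (𝓡.+-assoc a b _) (𝓡.trans (𝓡.+-congˡ (𝓡.trans (𝓡.sym (𝓡.+-assoc b c d))
      (𝓡.trans (𝓡.+-congʳ (𝓡.+-comm b c)) (𝓡.+-assoc c b d)))) (𝓡.sym (𝓡.+-assoc a c _)))

    module Combinations (β₀ β₁ : 𝓡.Carrier) where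
      ⟦_,_⟧ : A.Carrier → A.Carrier → 𝓡.Carrier
      ⟦ x , y ⟧ = φ x * β₀ + φ y * β₁

      ⟦⟧-cong : ∀ {x x′ y y′} → x A.≈ x′ → y A.≈ y′ → ⟦ x , y ⟧ ≈ ⟦ x′ , y′ ⟧
      ⟦⟧-cong e e′ = 𝓡.+-cong (𝓡.*-congʳ (φ.⟦⟧-cong e)) (𝓡.*-congʳ (φ.⟦⟧-cong e′))

      ⟦⟧-+ : ∀ x y x′ y′ → ⟦ x , y ⟧ + ⟦ x′ , y′ ⟧ ≈ ⟦ x A.+ x′ , y A.+ y′ ⟧
      ⟦⟧-+ x y x′ y′ = 𝓡.trans (+-interchange _ _ _ _) (𝓡.sym (𝓡.+-cong
        (𝓡.trans (𝓡.*-congʳ (φ.+-homo x x′)) (𝓡.distribʳ _ _ _)) (𝓡.trans (𝓡.*-congʳ (φ.+-homo y y′)) (𝓡.distribʳ _ _ _))))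

      ⟦⟧-scale : ∀ z x y → φ z * ⟦ x , y ⟧ ≈ ⟦ z A.* x , z A.* y ⟧
      ⟦⟧-scale z x y = 𝓡.trans (𝓡.distribˡ _ _ _) (𝓡.+-cong (assoc x β₀) (assoc y β₁))
        where
        assoc : ∀ x β → φ z * (φ x * β) ≈ φ (z A.* x) * β
        assoc x β = 𝓡.trans (𝓡.sym (𝓡.*-assoc _ _ _)) (𝓡.*-congʳ (𝓡.sym (φ.*-homo z x)))

      ⟦1,0⟧ : β₀ ≈ ⟦ A.1# , A.0# ⟧
      ⟦1,0⟧ = 𝓡.sym (𝓡.trans (𝓡.+-cong (𝓡.trans (𝓡.*-congʳ φ.1#-homo) (𝓡.*-identityˡ _)) (𝓡.trans (𝓡.*-congʳ φ.0#-homo) (𝓡.zeroˡ _))) (𝓡.+-identityʳ _))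

      ⟦0,1⟧ : β₁ ≈ ⟦ A.0# , A.1# ⟧
      ⟦0,1⟧ = 𝓡.sym (𝓡.trans (𝓡.+-cong (𝓡.trans (𝓡.*-congʳ φ.0#-homo) (𝓡.zeroˡ _)) (𝓡.trans (𝓡.*-congʳ φ.1#-homo) (𝓡.*-identityˡ _))) (𝓡.+-identityˡ _))

      module Independent (independent : ∀ x y → ⟦ x , y ⟧ ≈ 𝓡.0# → x A.≈ A.0# × y A.≈ A.0#) where
        ⟦⟧-injective : ∀ {x y x′ y′} → ⟦ x , y ⟧ ≈ ⟦ x′ , y′ ⟧ → x A.≈ x′ × y A.≈ y′
        ⟦⟧-injective {x} {y} {x′} {y′} e = let e₀ , e₁ = independent (x A.- x′) (y A.- y′) difference in
          Aₚ.x∙y⁻¹≈ε⇒x≈y x x′ e₀ , Aₚ.x∙y⁻¹≈ε⇒x≈y y y′ e₁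
          where
          open ≈-Reasoning 𝓡.setoid
          difference : ⟦ x A.- x′ , y A.- y′ ⟧ ≈ 𝓡.0#
          difference = begin
            ⟦ x A.- x′ , y A.- y′ ⟧  ≈⟨ ⟦⟧-+ x y (A.- x′) (A.- y′) ⟨
            ⟦ x , y ⟧ + ⟦ A.- x′ , A.- y′ ⟧  ≈⟨ 𝓡.+-congʳ e ⟩
            ⟦ x′ , y′ ⟧ + ⟦ A.- x′ , A.- y′ ⟧  ≈⟨ ⟦⟧-+ x′ y′ (A.- x′) (A.- y′) ⟩
            ⟦ x′ A.- x′ , y′ A.- y′ ⟧  ≈⟨ ⟦⟧-cong (A.-‿inverseʳ x′) (A.-‿inverseʳ y′) ⟩
            ⟦ A.0# , A.0# ⟧  ≈⟨ 𝓡.+-cong (𝓡.trans (𝓡.*-congʳ φ.0#-homo) (𝓡.zeroˡ _)) (𝓡.trans (𝓡.*-congʳ φ.0#-homo) (𝓡.zeroˡ _)) ⟩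
            𝓡.0# + 𝓡.0#  ≈⟨ 𝓡.+-identityʳ _ ⟩
            𝓡.0#  ∎

    *-centralizing : ∀ {u w} → IsCentralizing u → IsCentralizing w → IsCentralizing (u * w)
    *-centralizing {u} {w} cu cw a = begin
      u * w * φ a  ≈⟨ 𝓡.*-assoc _ _ _ ⟩
      u * (w * φ a)  ≈⟨ 𝓡.*-congˡ (cw a) ⟩
      u * (φ a * w)  ≈⟨ 𝓡.*-assoc _ _ _ ⟨
      u * φ a * w  ≈⟨ 𝓡.*-congʳ (cu a) ⟩
      φ a * u * w  ≈⟨ 𝓡.*-assoc _ _ _ ⟩
      φ a * (u * w)  ∎
      where open ≈-Reasoning 𝓡.setoid

    +-centralizing : ∀ {u w} → IsCentralizing u → IsCentralizing w → IsCentralizing (u + w)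
    +-centralizing cu cw a = 𝓡.trans (𝓡.distribʳ _ _ _) (𝓡.trans (𝓡.+-cong (cu a) (cw a)) (𝓡.sym (𝓡.distribˡ _ _ _)))

    φ-centralizing : ∀ b → IsCentralizing (φ b)
    φ-centralizing b a = 𝓡.trans (𝓡.sym (φ.*-homo b a)) (𝓡.trans (φ.⟦⟧-cong (A.*-comm b a)) (φ.*-homo a b))

    1-centralizing : IsCentralizing 𝓡.1#
    1-centralizing a = 𝓡.trans (𝓡.*-identityˡ _) (𝓡.sym (𝓡.*-identityʳ _))

    IsTrace : 𝓡.Carrier → 𝓡.Carrier → K.Carrier → Set _
    IsTrace π w τ = ∃ λ s → ∃₂ λ n₀₀ n₁₀ → ∃₂ λ n₀₁ n₁₁ → s A.≉ A.0#
        × φ s * w ≈ φ n₀₀ + φ n₁₀ * π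
        × φ s * (w * π) ≈ φ n₀₁ + φ n₁₁ * π
        × τ K.* ι s K.≈ ι (n₀₀ A.+ n₁₁)

    module _ (u : 𝓡.Carrier) where
      open Combinations 𝓡.1# u

      module UnitBasis (u-centralizing : IsCentralizing u) (1,u-independent : ∀ m k → ⟦ m , k ⟧ ≈ 𝓡.0# → m A.≈ A.0# × k A.≈ A.0#) (n t : A.Carrier)
        (u²≈ : u * u ≈ ⟦ n , t ⟧) where
        open Independent 1,u-independent renaming (⟦⟧-injective to 1,u-injective)

        φ≈⟦⟧ : ∀ m → φ m ≈ ⟦ m , A.0# ⟧
        φ≈⟦⟧ m = 𝓡.sym (𝓡.trans (𝓡.+-cong (𝓡.*-identityʳ _) (𝓡.trans (𝓡.*-congʳ φ.0#-homo) (𝓡.zeroˡ _))) (𝓡.+-identityʳ _))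

        ⟦⟧-* : ∀ m k m′ k′ → ⟦ m , k ⟧ * ⟦ m′ , k′ ⟧ ≈ ⟦ m A.* m′ A.+ k A.* k′ A.* n , m A.* k′ A.+ k A.* m′ A.+ k A.* k′ A.* t ⟧
        ⟦⟧-* m k m′ k′ = begin
          (φ m * 𝓡.1# + φ k * u) * ⟦ m′ , k′ ⟧  ≈⟨ 𝓡.distribʳ _ _ _ ⟩
          φ m * 𝓡.1# * ⟦ m′ , k′ ⟧ + φ k * u * ⟦ m′ , k′ ⟧  ≈⟨ 𝓡.+-cong (𝓡.*-congʳ (𝓡.*-identityʳ _)) (𝓡.trans (𝓡.*-assoc _ _ _) (𝓡.*-congˡ u-*)) ⟩
          φ m * ⟦ m′ , k′ ⟧ + φ k * ⟦ k′ A.* n , m′ A.+ k′ A.* t ⟧  ≈⟨ 𝓡.+-cong (⟦⟧-scale m m′ k′) (⟦⟧-scale k _ _) ⟩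
          ⟦ m A.* m′ , m A.* k′ ⟧ + ⟦ k A.* (k′ A.* n) , k A.* (m′ A.+ k′ A.* t) ⟧ ≈⟨ ⟦⟧-+ _ _ _ _ ⟩
          ⟦ m A.* m′ A.+ k A.* (k′ A.* n) , m A.* k′ A.+ k A.* (m′ A.+ k′ A.* t) ⟧ ≈⟨ ⟦⟧-cong (A.+-congˡ (A.sym (A.*-assoc k k′ n)))
             (product-coordinate m k m′ k′ t) ⟩
          ⟦ m A.* m′ A.+ k A.* k′ A.* n , m A.* k′ A.+ k A.* m′ A.+ k A.* k′ A.* t ⟧ ∎
          where
          open ≈-Reasoning 𝓡.setoid
          u-* : u * ⟦ m′ , k′ ⟧ ≈ ⟦ k′ A.* n , m′ A.+ k′ A.* t ⟧
          u-* = begin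
            u * (φ m′ * 𝓡.1# + φ k′ * u)  ≈⟨ 𝓡.distribˡ _ _ _ ⟩
            u * (φ m′ * 𝓡.1#) + u * (φ k′ * u)  ≈⟨ 𝓡.+-cong (𝓡.*-congˡ (𝓡.*-identityʳ _)) (𝓡.sym (𝓡.*-assoc _ _ _)) ⟩
            u * φ m′ + u * φ k′ * u  ≈⟨ 𝓡.+-cong (u-centralizing m′) (𝓡.*-congʳ (u-centralizing k′)) ⟩
            φ m′ * u + φ k′ * u * u  ≈⟨ 𝓡.+-cong (𝓡.trans (𝓡.*-congˡ ⟦0,1⟧) (⟦⟧-scale m′ _ _)) (𝓡.trans (𝓡.*-assoc _ _ _) (𝓡.trans (𝓡.*-congˡ u²≈) (⟦⟧-scale k′ n t))) ⟩
            ⟦ m′ A.* A.0# , m′ A.* A.1# ⟧ + ⟦ k′ A.* n , k′ A.* t ⟧ ≈⟨ ⟦⟧-+ _ _ _ _ ⟩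
            ⟦ m′ A.* A.0# A.+ k′ A.* n , m′ A.* A.1# A.+ k′ A.* t ⟧ ≈⟨ ⟦⟧-cong (A.trans (A.+-congʳ (A.zeroʳ m′)) (A.+-identityˡ _)) (A.+-congʳ (A.*-identityʳ m′)) ⟩
            ⟦ k′ A.* n , m′ A.+ k′ A.* t ⟧  ∎

        2# : A.Carrier
        2# = A.1# A.+ A.1#

        trace : A.Carrier → A.Carrier → A.Carrier
        trace m k = 2# A.* m A.+ k A.* t

        v : 𝓡.Carrier
        v = ⟦ A.- t , 2# ⟧

        v-centralizing : IsCentralizing v
        v-centralizing = +-centralizing (*-centralizing (φ-centralizing _) 1-centralizing) (*-centralizing (φ-centralizing _) u-centralizing)

        v²≈ : v * v ≈ φ (t A.* t A.+ 2# A.* 2# A.* n)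
        v²≈ = 𝓡.trans (⟦⟧-* _ _ _ _) (𝓡.trans (⟦⟧-cong
            (square-coordinate₀ t n) (square-coordinate₁ t))
          (𝓡.sym (φ≈⟦⟧ _)))

        -- Odd characteristic enters here: the u-coordinate of `v` is 2, that of a scalar is 0.
        v≉φ : 2# A.≉ A.0# → ∀ e → ¬ v ≈ φ e
        v≉φ 2≉0 e v≈φe = 2≉0 (proj₂ (1,u-injective (𝓡.trans v≈φe (φ≈⟦⟧ e))))

        module _ (π : 𝓡.Carrier) where
          -- κ π lies in the endomorphism ring but is not a scalar.
          record Witness : Set (o ⊔ ℓ ⊔ ℓ′) where
            field
              κ f g : A.Carrier
              κ≉0   : κ A.≉ A.0#
              g≉0   : g A.≉ A.0#
              κπ    : φ κ * π ≈ ⟦ f , g ⟧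

          -- The first column of the trace matrix of m + k u solves for `φ n₁₀ * π`, whose
          -- u-coordinate is s k. If n₁₀ were 0, then s k would be 0 too.
          witness : ∀ m k τ → k A.≉ A.0# → IsTrace π ⟦ m , k ⟧ τ → Witness
          witness m k τ k≉0 (s , n₀₀ , n₁₀ , _ , _ , s≉0 , e , _) = record
            { κ = n₁₀ ; κ≉0 = n₁₀≉0 ; g≉0 = *-split-≉ s≉0 k≉0
            ; κπ = begin
                φ n₁₀ * π  ≈⟨ 𝓡.+-identityˡ _ ⟨
                𝓡.0# + φ n₁₀ * π  ≈⟨ 𝓡.+-congʳ (𝓡.trans (𝓡.sym (φ.+-homo _ _)) (𝓡.trans (φ.⟦⟧-cong (A.-‿inverseˡ n₀₀)) φ.0#-homo)) ⟨
                (φ (A.- n₀₀) + φ n₀₀) + φ n₁₀ * π  ≈⟨ 𝓡.+-assoc _ _ _ ⟩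
                φ (A.- n₀₀) + (φ n₀₀ + φ n₁₀ * π)  ≈⟨ 𝓡.+-cong (φ≈⟦⟧ _) (𝓡.trans (𝓡.sym e) (⟦⟧-scale s m k)) ⟩
                ⟦ A.- n₀₀ , A.0# ⟧ + ⟦ s A.* m , s A.* k ⟧  ≈⟨ ⟦⟧-+ _ _ _ _ ⟩
                ⟦ A.- n₀₀ A.+ s A.* m , A.0# A.+ s A.* k ⟧  ≈⟨ ⟦⟧-cong A.refl (A.+-identityˡ _) ⟩
                ⟦ A.- n₀₀ A.+ s A.* m , s A.* k ⟧  ∎ }
            where
            open ≈-Reasoning 𝓡.setoid
            n₁₀≉0 : n₁₀ A.≉ A.0#
            n₁₀≉0 n₁₀≈0 = *-split-≉ s≉0 k≉0 (proj₂ (1,u-injective (begin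
              ⟦ s A.* m , s A.* k ⟧  ≈⟨ ⟦⟧-scale s m k ⟨
              φ s * ⟦ m , k ⟧  ≈⟨ e ⟩
              φ n₀₀ + φ n₁₀ * π  ≈⟨ 𝓡.+-congˡ (𝓡.trans (𝓡.*-congʳ (𝓡.trans (φ.⟦⟧-cong n₁₀≈0) φ.0#-homo)) (𝓡.zeroˡ π)) ⟩
              φ n₀₀ + 𝓡.0#  ≈⟨ 𝓡.+-identityʳ _ ⟩
              φ n₀₀  ≈⟨ φ≈⟦⟧ n₀₀ ⟩
              ⟦ n₀₀ , A.0# ⟧  ∎)))

          -- The matrix in `IsTrace` refers to the basis 1, π of the field, which need not be a
          -- basis of the endomorphism ring. After multiplication by κ both columns are written in
          -- terms of 1, u; the first column and the u-coordinate of the second already determine κ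
          -- g (n₀₀ + n₁₁).
          isTrace⇒ : Witness → ∀ {w} m k τ → w ≈ ⟦ m , k ⟧ → IsTrace π w τ → τ K.≈ ι (trace m k)
          isTrace⇒ W {w} m k τ w≈ (s , n₀₀ , n₁₀ , n₀₁ , n₁₁ , s≉0 , e , e′ , eτ) = FieldProperties.*-cancelˡ-≈ K ιs≉0 (begin
            ι s K.* τ  ≈⟨ K.*-comm _ _ ⟩
            τ K.* ι s  ≈⟨ eτ ⟩
            ι (n₀₀ A.+ n₁₁)  ≈⟨ ι.⟦⟧-cong n₀₀+n₁₁≈ ⟩
            ι (s A.* trace m k)  ≈⟨ ι.*-homo _ _ ⟩
            ι s K.* ι (trace m k) ∎)
            where
            open Witness W
            open ≈-Reasoning K.setoid
            ιs≉0 : ι s K.≉ K.0#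
            ιs≉0 ιs≈0 = s≉0 (ι.injective (K.trans ιs≈0 (K.sym ι.0#-homo)))

            φκ*[φp+φrπ] : ∀ p r → φ κ * (φ p + φ r * π) ≈ ⟦ κ A.* p A.+ r A.* f , r A.* g ⟧
            φκ*[φp+φrπ] p r = ≈R.begin
              φ κ * (φ p + φ r * π)                       ≈R.≈⟨ 𝓡.distribˡ _ _ _ ⟩
              φ κ * φ p + φ κ * (φ r * π)                 ≈R.≈⟨ 𝓡.+-cong (𝓡.sym (φ.*-homo κ p)) (𝓡.trans (𝓡.sym (𝓡.*-assoc _ _ _)) (𝓡.trans (𝓡.*-congʳ (φ-centralizing κ r)) (𝓡.trans (𝓡.*-assoc _ _ _) (𝓡.*-congˡ κπ)))) ⟩
              φ (κ A.* p) + φ r * ⟦ f , g ⟧               ≈R.≈⟨ 𝓡.+-cong (φ≈⟦⟧ _) (⟦⟧-scale r f g) ⟩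
              ⟦ κ A.* p , A.0# ⟧ + ⟦ r A.* f , r A.* g ⟧  ≈R.≈⟨ ⟦⟧-+ _ _ _ _ ⟩
              ⟦ κ A.* p A.+ r A.* f , A.0# A.+ r A.* g ⟧  ≈R.≈⟨ ⟦⟧-cong A.refl (A.+-identityˡ _) ⟩
              ⟦ κ A.* p A.+ r A.* f , r A.* g ⟧  ≈R.∎
              where module ≈R = ≈-Reasoning 𝓡.setoid

            first : κ A.* (s A.* m) A.≈ κ A.* n₀₀ A.+ n₁₀ A.* f × κ A.* (s A.* k) A.≈ n₁₀ A.* g
            first = 1,u-injective (≈R.begin
              ⟦ κ A.* (s A.* m) , κ A.* (s A.* k) ⟧       ≈R.≈⟨ ⟦⟧-scale κ _ _ ⟨
              φ κ * ⟦ s A.* m , s A.* k ⟧                 ≈R.≈⟨ 𝓡.*-congˡ (⟦⟧-scale s m k) ⟨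
              φ κ * (φ s * ⟦ m , k ⟧)                     ≈R.≈⟨ 𝓡.*-congˡ (𝓡.*-congˡ w≈) ⟨
              φ κ * (φ s * w)                             ≈R.≈⟨ 𝓡.*-congˡ e ⟩
              φ κ * (φ n₀₀ + φ n₁₀ * π)                   ≈R.≈⟨ φκ*[φp+φrπ] n₀₀ n₁₀ ⟩
              ⟦ κ A.* n₀₀ A.+ n₁₀ A.* f , n₁₀ A.* g ⟧  ≈R.∎)
              where module ≈R = ≈-Reasoning 𝓡.setoid

            w-centralizing : IsCentralizing w
            w-centralizing a = 𝓡.trans (𝓡.*-congʳ w≈) (𝓡.trans
              (+-centralizing (*-centralizing (φ-centralizing m) 1-centralizing) (*-centralizing (φ-centralizing k) u-centralizing) a) (𝓡.*-congˡ (𝓡.sym w≈)))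

            second : s A.* (m A.* g A.+ k A.* f A.+ k A.* g A.* t) A.≈ n₁₁ A.* g
            second = proj₂ (1,u-injective (≈R.begin
              ⟦ _ , s A.* (m A.* g A.+ k A.* f A.+ k A.* g A.* t) ⟧ ≈R.≈⟨ ⟦⟧-scale s _ _ ⟨
              φ s * ⟦ m A.* f A.+ k A.* g A.* n , _ ⟧     ≈R.≈⟨ 𝓡.*-congˡ (⟦⟧-* m k f g) ⟨
              φ s * (⟦ m , k ⟧ * ⟦ f , g ⟧)               ≈R.≈⟨ 𝓡.*-congˡ (𝓡.*-cong w≈ κπ) ⟨
              φ s * (w * (φ κ * π))                       ≈R.≈⟨ 𝓡.*-congˡ (𝓡.*-assoc _ _ _) ⟨
              φ s * (w * φ κ * π)                         ≈R.≈⟨ 𝓡.*-congˡ (𝓡.*-congʳ (w-centralizing κ)) ⟩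
              φ s * (φ κ * w * π)                         ≈R.≈⟨ 𝓡.*-congˡ (𝓡.*-assoc _ _ _) ⟩
              φ s * (φ κ * (w * π))                       ≈R.≈⟨ 𝓡.*-assoc _ _ _ ⟨
              φ s * φ κ * (w * π)                         ≈R.≈⟨ 𝓡.*-congʳ (φ-centralizing s κ) ⟩
              φ κ * φ s * (w * π)                         ≈R.≈⟨ 𝓡.*-assoc _ _ _ ⟩
              φ κ * (φ s * (w * π))                       ≈R.≈⟨ 𝓡.*-congˡ e′ ⟩
              φ κ * (φ n₀₁ + φ n₁₁ * π)                   ≈R.≈⟨ φκ*[φp+φrπ] n₀₁ n₁₁ ⟩
              ⟦ κ A.* n₀₁ A.+ n₁₁ A.* f , n₁₁ A.* g ⟧  ≈R.∎))
              where module ≈R = ≈-Reasoning 𝓡.setoid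

            n₀₀+n₁₁≈ : n₀₀ A.+ n₁₁ A.≈ s A.* trace m k
            n₀₀+n₁₁≈ = cancel (*-split-≉ κ≉0 g≉0) (≈A.begin
              κ A.* g A.* (n₀₀ A.+ n₁₁)
                ≈A.≈⟨ trace-matrix₁ κ g f n₀₀ n₁₀ n₁₁ ⟩
              g A.* (κ A.* n₀₀ A.+ n₁₀ A.* f) A.- f A.* (n₁₀ A.* g) A.+ κ A.* (n₁₁ A.* g)
                ≈A.≈⟨ A.+-cong (A.+-cong (A.*-congˡ (proj₁ first)) (A.-‿cong (A.*-congˡ (proj₂ first)))) (A.*-congˡ second) ⟨
              g A.* (κ A.* (s A.* m)) A.- f A.* (κ A.* (s A.* k)) A.+ κ A.* (s A.* (m A.* g A.+ k A.* f A.+ k A.* g A.* t))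
                ≈A.≈⟨ trace-matrix₂ κ g f s m k t ⟩
              κ A.* g A.* (s A.* trace m k) ≈A.∎)
              where module ≈A = ≈-Reasoning A.setoid

          module _
            {α₀ α₁ : 𝓡.Carrier} {a₀ b₀ a₁ b₁ : A.Carrier}
            (α₀≈ : α₀ ≈ ⟦ a₀ , b₀ ⟧) (α₁≈ : α₁ ≈ ⟦ a₁ , b₁ ⟧) (δ≈1 : a₀ A.* b₁ A.- a₁ A.* b₀ A.≈ A.1#)
            {τ₀₀ τ₀₁ τ₁₀ τ₁₁ : K.Carrier}
            (isTrace₀₀ : IsTrace π (α₀ * α₀) τ₀₀) (isTrace₀₁ : IsTrace π (α₀ * α₁) τ₀₁)
            (isTrace₁₀ : IsTrace π (α₁ * α₀) τ₁₀) (isTrace₁₁ : IsTrace π (α₁ * α₁) τ₁₁)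
            (Δ : A.Carrier) (Δ-det : ι Δ K.≈ τ₀₀ K.* τ₁₁ K.- τ₀₁ K.* τ₁₀)
            where
            product≈ : ∀ {w w′ p q p′ q′} → w ≈ ⟦ p , q ⟧ → w′ ≈ ⟦ p′ , q′ ⟧ → w * w′ ≈ ⟦ m* n t p q p′ q′ , k* n t p q p′ q′ ⟧
            product≈ e e′ = 𝓡.trans (𝓡.*-cong e e′) (⟦⟧-* _ _ _ _)

            isTrace-cong : ∀ {w w′ τ} → w ≈ w′ → IsTrace π w τ → IsTrace π w′ τ
            isTrace-cong e (s , n₀₀ , n₁₀ , n₀₁ , n₁₁ , s≉0 , e₁ , e₂ , e₃) =
              s , n₀₀ , n₁₀ , n₀₁ , n₁₁ , s≉0 , 𝓡.trans (𝓡.*-congˡ (𝓡.sym e)) e₁ , 𝓡.trans (𝓡.*-congˡ (𝓡.*-congʳ (𝓡.sym e))) e₂ , e₃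

            δ²≈1 : ∀ z → z A.* ((a₀ A.* b₁ A.- a₁ A.* b₀) A.* (a₀ A.* b₁ A.- a₁ A.* b₀)) A.≈ z
            δ²≈1 z = A.trans (A.*-congˡ (A.trans (A.*-cong δ≈1 δ≈1) (A.*-identityˡ _))) (A.*-identityʳ z)

            -- k₀₁² - k₀₀ k₁₁ = (a₀ b₁ - a₁ b₀)² = 1, so some product αᵢ αⱼ is not a scalar.
            W : Witness
            W with zero? (k* n t a₀ b₀ a₀ b₀) | zero? (k* n t a₀ b₀ a₁ b₁)
            ... | no k≉0    | _         = witness _ _ _ k≉0 (isTrace-cong (product≈ α₀≈ α₀≈) isTrace₀₀)
            ... | yes _     | no k≉0    = witness _ _ _ k≉0 (isTrace-cong (product≈ α₀≈ α₁≈) isTrace₀₁)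
            ... | yes k₀₀≈0 | yes k₀₁≈0 = contradiction (≈A.begin
                A.1#                                                                                  ≈A.≈⟨ δ²≈1 A.1# ⟨
                A.1# A.* ((a₀ A.* b₁ A.- a₁ A.* b₀) A.* (a₀ A.* b₁ A.- a₁ A.* b₀))                    ≈A.≈⟨ A.*-identityˡ _ ⟩
                (a₀ A.* b₁ A.- a₁ A.* b₀) A.* (a₀ A.* b₁ A.- a₁ A.* b₀)
                  ≈A.≈⟨ k*-determinant n t a₀ b₀ a₁ b₁ ⟩
                k* n t a₀ b₀ a₁ b₁ A.* k* n t a₀ b₀ a₁ b₁ A.- k* n t a₀ b₀ a₀ b₀ A.* k* n t a₁ b₁ a₁ b₁               ≈A.≈⟨ A.+-cong (A.*-congʳ k₀₁≈0) (A.-‿cong (A.*-congʳ k₀₀≈0)) ⟩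
                A.0# A.* k* n t a₀ b₀ a₁ b₁ A.- A.0# A.* k* n t a₁ b₁ a₁ b₁                                   ≈A.≈⟨ A.+-cong (A.zeroˡ _) (A.-‿cong (A.zeroˡ _)) ⟩
                A.0# A.- A.0#                                                                         ≈A.≈⟨ A.-‿inverseʳ A.0# ⟩
                A.0#  ≈A.∎) 1≉0
              where module ≈A = ≈-Reasoning A.setoid

            Δ≈ : Δ A.≈ t A.* t A.+ 2# A.* 2# A.* n
            Δ≈ = ι.injective (begin
              ι Δ  ≈⟨ Δ-det ⟩
              τ₀₀ K.* τ₁₁ K.- τ₀₁ K.* τ₁₀  ≈⟨ K.+-cong (K.*-cong (isTrace⇒ W _ _ _ (product≈ α₀≈ α₀≈) isTrace₀₀) (isTrace⇒ W _ _ _ (product≈ α₁≈ α₁≈) isTrace₁₁))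
                                                                   (K.-‿cong (K.*-cong (isTrace⇒ W _ _ _ (product≈ α₀≈ α₁≈) isTrace₀₁) (isTrace⇒ W _ _ _ (product≈ α₁≈ α₀≈) isTrace₁₀))) ⟩
              ι (T* n t a₀ b₀ a₀ b₀) K.* ι (T* n t a₁ b₁ a₁ b₁) K.- ι (T* n t a₀ b₀ a₁ b₁) K.* ι (T* n t a₁ b₁ a₀ b₀)
                ≈⟨ K.+-cong (ι.*-homo _ _) (K.trans (ι.-‿homo _) (K.-‿cong (ι.*-homo _ _))) ⟨
              ι (T* n t a₀ b₀ a₀ b₀ A.* T* n t a₁ b₁ a₁ b₁) K.+ ι (A.- (T* n t a₀ b₀ a₁ b₁ A.* T* n t a₁ b₁ a₀ b₀)) ≈⟨ ι.+-homo _ _ ⟨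
              ι (T* n t a₀ b₀ a₀ b₀ A.* T* n t a₁ b₁ a₁ b₁ A.- T* n t a₀ b₀ a₁ b₁ A.* T* n t a₁ b₁ a₀ b₀)
                ≈⟨ ι.⟦⟧-cong (A.trans (T*-determinant n t a₀ b₀ a₁ b₁) (δ²≈1 _)) ⟩
              ι (t A.* t A.+ 2# A.* 2# A.* n) ∎)
              where open ≈-Reasoning K.setoid

            v²≈φΔ : v * v ≈ φ Δ
            v²≈φΔ = 𝓡.trans v²≈ (φ.⟦⟧-cong (A.sym Δ≈))

    module _ (α₀ α₁ : 𝓡.Carrier) where
      private module α = Combinations α₀ α₁

      module Basis (α₀-centralizing : IsCentralizing α₀) (α₁-centralizing : IsCentralizing α₁)
        (independent : ∀ x y → α.⟦ x , y ⟧ ≈ 𝓡.0# → x A.≈ A.0# × y A.≈ A.0#) (x y a b c d : A.Carrier) (1≈ : 𝓡.1# ≈ α.⟦ x , y ⟧)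
        (α₀²≈ : α₀ * α₀ ≈ α.⟦ a , b ⟧) (α₁α₀≈ : α₁ * α₀ ≈ α.⟦ c , d ⟧) where
        open α.Independent independent

        -- The α₀-coordinate of 1 · α₀ = α₀: it completes 1 = x α₀ + y α₁ to a basis.
        unimodular : x A.* a A.+ y A.* c A.≈ A.1#
        unimodular = proj₁ (⟦⟧-injective (begin
          α.⟦ x A.* a A.+ y A.* c , x A.* b A.+ y A.* d ⟧  ≈⟨ α.⟦⟧-+ _ _ _ _ ⟨
          α.⟦ x A.* a , x A.* b ⟧ + α.⟦ y A.* c , y A.* d ⟧  ≈⟨ 𝓡.+-cong (α.⟦⟧-scale x a b) (α.⟦⟧-scale y c d) ⟨
          φ x * α.⟦ a , b ⟧ + φ y * α.⟦ c , d ⟧  ≈⟨ 𝓡.+-cong (𝓡.*-congˡ α₀²≈) (𝓡.*-congˡ α₁α₀≈) ⟨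
          φ x * (α₀ * α₀) + φ y * (α₁ * α₀)  ≈⟨ 𝓡.+-cong (𝓡.*-assoc _ _ _) (𝓡.*-assoc _ _ _) ⟨
          φ x * α₀ * α₀ + φ y * α₁ * α₀  ≈⟨ 𝓡.distribʳ _ _ _ ⟨
          α.⟦ x , y ⟧ * α₀  ≈⟨ 𝓡.*-congʳ 1≈ ⟨
          𝓡.1# * α₀  ≈⟨ 𝓡.*-identityˡ _ ⟩
          α₀  ≈⟨ α.⟦1,0⟧ ⟩
          α.⟦ A.1# , A.0# ⟧  ∎))
          where open ≈-Reasoning 𝓡.setoid

        -- The given basis need not contain 1. The coordinates (- c , a) are chosen so that,
        -- together with the coordinates (x , y) of 1, they have determinant x a + y c, which is 1
        -- by `unimodular`.
        u : 𝓡.Carrier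
        u = α.⟦ A.- c , a ⟧

        open Combinations 𝓡.1# u

        u-to-α : ∀ m k → ⟦ m , k ⟧ ≈ α.⟦ m A.* x A.- k A.* c , m A.* y A.+ k A.* a ⟧
        u-to-α m k = begin
          φ m * 𝓡.1# + φ k * u  ≈⟨ 𝓡.+-cong (𝓡.trans (𝓡.*-congˡ 1≈) (α.⟦⟧-scale m x y)) (α.⟦⟧-scale k (A.- c) a) ⟩
          α.⟦ m A.* x , m A.* y ⟧ + α.⟦ k A.* A.- c , k A.* a ⟧  ≈⟨ α.⟦⟧-+ _ _ _ _ ⟩
          α.⟦ m A.* x A.+ k A.* A.- c , m A.* y A.+ k A.* a ⟧  ≈⟨ α.⟦⟧-cong (A.+-congˡ (A.sym (Aₚ.-‿distribʳ-* k c))) A.refl ⟩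
          α.⟦ m A.* x A.- k A.* c , m A.* y A.+ k A.* a ⟧  ∎
          where open ≈-Reasoning 𝓡.setoid

        α-to-u : ∀ p r → α.⟦ p , r ⟧ ≈ ⟦ p A.* a A.+ r A.* c , r A.* x A.- p A.* y ⟧
        α-to-u p r = 𝓡.sym (𝓡.trans (u-to-α _ _) (α.⟦⟧-cong
          (begin
            (p A.* a A.+ r A.* c) A.* x A.- (r A.* x A.- p A.* y) A.* c
              ≈⟨ basis-inverse₁ p r a c x y ⟩
            p A.* (x A.* a A.+ y A.* c) ≈⟨ A.*-congˡ unimodular ⟩
            p A.* A.1#  ≈⟨ A.*-identityʳ p ⟩
            p  ∎)
          (begin
            (p A.* a A.+ r A.* c) A.* y A.+ (r A.* x A.- p A.* y) A.* a
              ≈⟨ basis-inverse₂ p r a c x y ⟩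
            r A.* (x A.* a A.+ y A.* c) ≈⟨ A.*-congˡ unimodular ⟩
            r A.* A.1#  ≈⟨ A.*-identityʳ r ⟩
            r  ∎)))
          where open ≈-Reasoning A.setoid

        1,u-independent : ∀ m k → ⟦ m , k ⟧ ≈ 𝓡.0# → m A.≈ A.0# × k A.≈ A.0#
        1,u-independent m k e = let e₀ , e₁ = independent _ _ (𝓡.trans (𝓡.sym (u-to-α m k)) e) in
          (begin
            m  ≈⟨ A.*-identityʳ m ⟨
            m A.* A.1#  ≈⟨ A.*-congˡ unimodular ⟨
            m A.* (x A.* a A.+ y A.* c)  ≈⟨ basis-inverse₃ m k a c x y ⟩
            a A.* (m A.* x A.- k A.* c) A.+ c A.* (m A.* y A.+ k A.* a) ≈⟨ A.+-cong (A.*-congˡ e₀) (A.*-congˡ e₁) ⟩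
            a A.* A.0# A.+ c A.* A.0#  ≈⟨ A.+-cong (A.zeroʳ a) (A.zeroʳ c) ⟩
            A.0# A.+ A.0#  ≈⟨ A.+-identityʳ A.0# ⟩
            A.0#  ∎) ,
          (begin
            k  ≈⟨ A.*-identityʳ k ⟨
            k A.* A.1#  ≈⟨ A.*-congˡ unimodular ⟨
            k A.* (x A.* a A.+ y A.* c)  ≈⟨ basis-inverse₄ m k a c x y ⟩
            x A.* (m A.* y A.+ k A.* a) A.- y A.* (m A.* x A.- k A.* c) ≈⟨ A.+-cong (A.*-congˡ e₁) (A.-‿cong (A.*-congˡ e₀)) ⟩
            x A.* A.0# A.- y A.* A.0#  ≈⟨ A.+-cong (A.zeroʳ x) (A.-‿cong (A.zeroʳ y)) ⟩
            A.0# A.- A.0#  ≈⟨ A.-‿inverseʳ A.0# ⟩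
            A.0#  ∎)
          where open ≈-Reasoning A.setoid

        u-centralizing : IsCentralizing u
        u-centralizing = +-centralizing (*-centralizing (φ-centralizing (A.- c)) α₀-centralizing) (*-centralizing (φ-centralizing a) α₁-centralizing)

        α₀≈ : α₀ ≈ ⟦ a , A.- y ⟧
        α₀≈ = 𝓡.trans (𝓡.trans α.⟦1,0⟧ (α-to-u A.1# A.0#)) (⟦⟧-cong
          (A.trans (A.+-cong (A.*-identityˡ a) (A.zeroˡ c)) (A.+-identityʳ a))
          (A.trans (A.+-cong (A.zeroˡ x) (A.-‿cong (A.*-identityˡ y))) (A.+-identityˡ _)))

        α₁≈ : α₁ ≈ ⟦ c , x ⟧
        α₁≈ = 𝓡.trans (𝓡.trans α.⟦0,1⟧ (α-to-u A.0# A.1#)) (⟦⟧-cong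
          (A.trans (A.+-cong (A.zeroˡ a) (A.*-identityˡ c)) (A.+-identityˡ c))
          (A.trans (A.+-cong (A.*-identityˡ x) (A.trans (A.-‿cong (A.zeroˡ y)) Aₚ.-0#≈0#)) (A.+-identityʳ x)))

        δ≈1 : a A.* x A.- c A.* (A.- y) A.≈ A.1#
        δ≈1 = A.trans (minor a c x y) unimodular

    -- With 1 and u an A-basis of the endomorphism ring and u² = n + t u, the trace of
    -- m + k u is 2 m + k t, and v = 2 u - t satisfies v² = t² + 4 n = Δ.
    traceZeroElement : ∀ π α₀ α₁ (let open Combinations α₀ α₁) → A.1# A.+ A.1# A.≉ A.0# →
      IsCentralizing α₀ → IsCentralizing α₁ →
      (∀ w → IsCentralizing w → ∃₂ λ x y → w ≈ ⟦ x , y ⟧) →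
      (∀ x y → ⟦ x , y ⟧ ≈ 𝓡.0# → x A.≈ A.0# × y A.≈ A.0#) →
      ∀ {τ₀₀ τ₀₁ τ₁₀ τ₁₁} → IsTrace π (α₀ * α₀) τ₀₀ → IsTrace π (α₀ * α₁) τ₀₁ → IsTrace π (α₁ * α₀) τ₁₀ → IsTrace π (α₁ * α₁) τ₁₁ →
      ∀ Δ → ι Δ K.≈ τ₀₀ K.* τ₁₁ K.- τ₀₁ K.* τ₁₀ →
      ∃ λ v → IsCentralizing v × v * v ≈ φ Δ × (∀ e → ¬ v ≈ φ e)
    traceZeroElement π α₀ α₁ 2≉0 cα₀ cα₁ spanning independent tr₀₀ tr₀₁ tr₁₀ tr₁₁ Δ Δ-det =
      let x , y , 1≈    = spanning 𝓡.1# 1-centralizing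
          a , b , α₀²≈  = spanning (α₀ * α₀) (*-centralizing cα₀ cα₀)
          c , d , α₁α₀≈ = spanning (α₁ * α₀) (*-centralizing cα₁ cα₀)
          module B = Basis α₀ α₁ cα₀ cα₁ independent x y a b c d 1≈ α₀²≈ α₁α₀≈
          p , r , u²≈   = spanning (B.u * B.u) (*-centralizing B.u-centralizing B.u-centralizing)
          module U = UnitBasis B.u B.u-centralizing B.1,u-independent _ _ (𝓡.trans u²≈ (B.α-to-u p r))
      in U.v , U.v-centralizing , U.v²≈φΔ π B.α₀≈ B.α₁≈ B.δ≈1 tr₀₀ tr₀₁ tr₁₀ tr₁₁ Δ Δ-det , U.v≉φ 2≉0

-- Residue rings and transfer along homomorphisms.

module Quotient {c ℓ} (R : CommutativeRing c ℓ) (p : CommutativeRing.Carrier R) where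
  open CommutativeRing R hiding (zero)
  open SemiringNotions (RawRing.rawSemiring rawRing) using (_∣_)
  open Divisibility (RawRing.*-rawMagma rawRing) using (_,_)
  open RingProperties ring using (-‿distribˡ-*)
  open Solver R using (solve; _:=_; _:+_; _:*_; _:-_; :-_; :1)
  open ≈-Reasoning setoid

  infix 4 _≡ₚ_
  _≡ₚ_ : Carrier → Carrier → Set (c ⊔ ℓ)
  a ≡ₚ b = p ∣ (a + - b)

  ∣-cong : ∀ {a b} → a ≈ b → p ∣ a → p ∣ b
  ∣-cong a≈b (h , e) = h , trans e a≈b

  ∣-+ : ∀ {a b} → p ∣ a → p ∣ b → p ∣ a + b
  ∣-+ (h , e) (h′ , e′) = h + h′ , trans (distribʳ p h h′) (+-cong e e′)

  ∣-neg : ∀ {a} → p ∣ a → p ∣ - a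
  ∣-neg (h , e) = - h , trans (sym (-‿distribˡ-* h p)) (-‿cong e)

  ∣-* : ∀ {a} b → p ∣ a → p ∣ b * a
  ∣-* b (h , e) = b * h , trans (*-assoc b h p) (*-congˡ e)

  ≈⇒≡ₚ : ∀ {a b} → a ≈ b → a ≡ₚ b
  ≈⇒≡ₚ {a} {b} e = 0# , trans (zeroˡ p) (trans (sym (-‿inverseʳ b)) (+-congʳ (sym e)))

  private
    identity₁ : ∀ a b → - (a + - b) ≈ b + - a
    identity₁ = solve 2 (λ a b → :- (a :+ :- b) := b :+ :- a) refl
    identity₂ : ∀ a b c → (a + - b) + (b + - c) ≈ a + - c
    identity₂ = solve 3 (λ a b c → (a :+ :- b) :+ (b :+ :- c) := a :+ :- c) refl
    identity₃ : ∀ a b c d → (a + - b) + (c + - d) ≈ (a + c) + - (b + d)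
    identity₃ = solve 4 (λ a b c d → (a :+ :- b) :+ (c :+ :- d) := (a :+ c) :+ :- (b :+ d)) refl
    identity₄ : ∀ a b c d → c * (a + - b) + b * (c + - d) ≈ a * c + - (b * d)
    identity₄ = solve 4 (λ a b c d → c :* (a :+ :- b) :+ b :* (c :+ :- d) := a :* c :+ :- (b :* d)) refl
    identity₅ : ∀ a b → - (a + - b) ≈ - a + - - b
    identity₅ = solve 2 (λ a b → :- (a :+ :- b) := :- a :+ :- (:- b)) refl

  quotient : CommutativeRing c (c ⊔ ℓ)
  quotient = record
    { Carrier = Carrier ; _≈_ = _≡ₚ_ ; _+_ = _+_ ; _*_ = _*_ ; -_ = -_ ; 0# = 0# ; 1# = 1#
    ; isCommutativeRing = record
      { isRing = record
        { +-isAbelianGroup = record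
          { isGroup = record
            { isMonoid = record
              { isSemigroup = record
                { isMagma = record
                  { isEquivalence = record
                    { refl  = ≈⇒≡ₚ refl
                    ; sym   = λ {a} {b} e → ∣-cong (identity₁ a b) (∣-neg e)
                    ; trans = λ {a} {b} {c} e e′ → ∣-cong (identity₂ a b c) (∣-+ e e′) }
                  ; ∙-cong = λ {a} {b} {c} {d} e e′ → ∣-cong (identity₃ a b c d) (∣-+ e e′) }
                ; assoc = λ a b c → ≈⇒≡ₚ (+-assoc a b c) }
              ; identity = (λ a → ≈⇒≡ₚ (+-identityˡ a)) , (λ a → ≈⇒≡ₚ (+-identityʳ a)) }
            ; inverse = (λ a → ≈⇒≡ₚ (-‿inverseˡ a)) , (λ a → ≈⇒≡ₚ (-‿inverseʳ a))
            ; ⁻¹-cong = λ {a} {b} e → ∣-cong (identity₅ a b) (∣-neg e) }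
          ; comm = λ a b → ≈⇒≡ₚ (+-comm a b) }
        ; *-cong = λ {a} {b} {c} {d} e e′ → ∣-cong (identity₄ a b c d) (∣-+ (∣-* c e) (∣-* b e′))
        ; *-assoc = λ a b c → ≈⇒≡ₚ (*-assoc a b c)
        ; *-identity = (λ a → ≈⇒≡ₚ (*-identityˡ a)) , (λ a → ≈⇒≡ₚ (*-identityʳ a))
        ; distrib = (λ a b c → ≈⇒≡ₚ (distribˡ a b c)) , (λ a b c → ≈⇒≡ₚ (distribʳ a b c)) }
      ; *-comm = λ a b → ≈⇒≡ₚ (*-comm a b) } }

  residue-hom : RingMorphisms.IsRingHomomorphism rawRing (CommutativeRing.rawRing quotient) id
  residue-hom = record
    { isSemiringHomomorphism = record
      { isNearSemiringHomomorphism = record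
        { +-isMonoidHomomorphism = record
          { isMagmaHomomorphism = record { isRelHomomorphism = record { cong = ≈⇒≡ₚ } ; homo = λ a b → ≈⇒≡ₚ refl }
          ; ε-homo = ≈⇒≡ₚ refl }
        ; *-homo = λ a b → ≈⇒≡ₚ refl }
      ; 1#-homo = ≈⇒≡ₚ refl }
    ; -‿homo = λ a → ≈⇒≡ₚ refl }

  ∣⇒≡ₚ0 : ∀ {a} → p ∣ a → a ≡ₚ 0#
  ∣⇒≡ₚ0 {a} = ∣-cong (sym (trans (+-congˡ (RingProperties.-0#≈0# ring)) (+-identityʳ a)))

  ≡ₚ0⇒∣ : ∀ {a} → a ≡ₚ 0# → p ∣ a
  ≡ₚ0⇒∣ {a} = ∣-cong (trans (+-congˡ (RingProperties.-0#≈0# ring)) (+-identityʳ a))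

module _ {c ℓ c′ ℓ′} (R : CommutativeRing c ℓ) (S : CommutativeRing c′ ℓ′) {e : CommutativeRing.Carrier R → CommutativeRing.Carrier S}
         (e-hom : RingMorphisms.IsRingHomomorphism (CommutativeRing.rawRing R) (CommutativeRing.rawRing S) e) where
  private
    module R = CommutativeRing R
    module S = CommutativeRing S
    module R× = Mult R.semiring
    module S× = Mult S.semiring
    module R^ = SemiringExp R.semiring
    module S^ = SemiringExp S.semiring
    module e = RingMorphisms.IsRingHomomorphism e-hom

  hom-multiple : ∀ n x → e (n R×.× x) S.≈ n S×.× e x
  hom-multiple zero    x = e.0#-homo
  hom-multiple (suc n) x = S.trans (e.+-homo x (n R×.× x)) (S.+-congˡ (hom-multiple n x))

  hom-^ : ∀ x n → e (x R^.^ n) S.≈ e x S^.^ n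
  hom-^ x zero    = e.1#-homo
  hom-^ x (suc n) = S.trans (e.*-homo x (x R^.^ n)) (S.*-congˡ (hom-^ x n))

  characteristic-transfer : ∀ {p} → p R×.× R.1# R.≈ R.0# → p S×.× S.1# S.≈ S.0#
  characteristic-transfer {p} e₀ = S.trans (S.sym (S.trans (hom-multiple p R.1#) (S×.×-congʳ p e.1#-homo))) (S.trans (e.⟦⟧-cong e₀) e.0#-homo)

-- Degrees and divisibility in 𝔽[T].

2∤⇒odd : ∀ q → ¬ 2 ∣ⁿ q → ∃ λ h → q ≡ suc (h ℕ.+ h)
2∤⇒odd zero    2∤q = contradiction (divides 0 ≡.refl) 2∤q
2∤⇒odd 1       2∤q = 0 , ≡.refl
2∤⇒odd (suc (suc q)) 2∤q = let h , e = 2∤⇒odd q (λ 2∣q → 2∤q (∣ⁿ.∣m∣n⇒∣m+n (divides 1 ≡.refl) 2∣q)) in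
  suc h , ≡.trans (≡.cong (2 ℕ.+_) e) (≡.cong (2 ℕ.+_) (≡.sym (ℕₚ.+-suc h h)))

module PolynomialsOverFiniteField {c ℓ q} (𝔽 : FiniteField c ℓ q) (q-odd : OddPrimePower q) where
  open FunctionField 𝔽 using (T; deg; deg-nothing; MonicPrime; module 𝔽)
  open FiniteFieldProperties 𝔽 using (x*y≈0⇒x≈0∨y≈0; characteristic; fermat) public
  open PolynomialRing 𝔽.commutativeRing public
  private module 𝔽ₚ = RingProperties 𝔽.ring
  module A = CommutativeRing commutativeRing
  open SemiringNotions (RawRing.rawSemiring A.rawRing) using (_∣_)
  open Divisibility (RawRing.*-rawMagma A.rawRing) using (_,_)

  h : ℕ
  h = proj₁ (2∤⇒odd q (proj₁ q-odd))

  q≡1+2h : q ≡ suc (h ℕ.+ h)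
  q≡1+2h = proj₂ (2∤⇒odd q (proj₁ q-odd))

  -- The sum of q = 2 h + 1 ones is 0; if 2 were 0, it would also be 1.
  2≉0 : 𝔽.1# 𝔽.+ 𝔽.1# 𝔽.≉ 𝔽.0#
  2≉0 2≈0 = 𝔽.1≉0 (begin
    𝔽.1#  ≈⟨ 𝔽.+-identityʳ 𝔽.1# ⟨
    𝔽.1# 𝔽.+ 𝔽.0#  ≈⟨ 𝔽.+-congˡ (even h) ⟨
    suc (h ℕ.+ h) ×.× 𝔽.1#  ≡⟨ ≡.cong (×._× 𝔽.1#) q≡1+2h ⟨
    q ×.× 𝔽.1#  ≈⟨ FiniteFieldProperties.q×1≈0 𝔽 ⟩
    𝔽.0#  ∎)
    where
    module × = Mult 𝔽.semiring
    open ≈-Reasoning 𝔽.setoid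
    even : ∀ h → (h ℕ.+ h) ×.× 𝔽.1# 𝔽.≈ 𝔽.0#
    even zero    = 𝔽.refl
    even (suc h) rewrite ℕₚ.+-suc h h = 𝔽.trans (𝔽.sym (𝔽.+-assoc _ _ _)) (𝔽.trans (𝔽.+-cong 2≈0 (even h)) (𝔽.+-identityˡ _))

  2≉0′ : A.1# A.+ A.1# A.≉ A.0#
  2≉0′ e = 2≉0 (e 0)

  1≉0′ : A.1# A.≉ A.0#
  1≉0′ e = 𝔽.1≉0 (e 0)

  deg-just : ∀ f {n} → deg f ≡ just n → coeff f n 𝔽.≉ 𝔽.0# × Below f (suc n)
  deg-just (a ∷ f) e with deg f in eq
  deg-just (a ∷ f) {.(suc m)} ≡.refl | just m = let f≉0 , b = deg-just f eq in f≉0 , λ { (suc k) (ℕ.s≤s m<k) → b k m<k }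
  ... | nothing with a 𝔽.≟ 𝔽.0#
  deg-just (a ∷ f) () | nothing | yes _
  deg-just (a ∷ f) {.0} ≡.refl | nothing | no a≉0 = a≉0 , λ { (suc k) _ → deg-nothing f eq k }

  degree : ∀ f → f ≈ [] ⊎ ∃ λ n → deg f ≡ just n
  degree f with deg f in eq
  ... | nothing = inj₁ (deg-nothing f eq)
  ... | just n  = inj₂ (n , ≡.refl)

  zero? : ∀ f → Dec (f ≈ [])
  zero? f with degree f
  ... | inj₁ f≈0       = yes f≈0
  ... | inj₂ (n , deg≡n) = no λ f≈0 → proj₁ (deg-just f deg≡n) (f≈0 n)

  private
    split-𝔽 : ∀ x n y → x 𝔽.* iter n y 𝔽.≈ 𝔽.0# → x 𝔽.≈ 𝔽.0# ⊎ y 𝔽.≈ 𝔽.0#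
    split-𝔽 x n y e = x*y≈0⇒x≈0∨y≈0 x y (𝔽.trans (𝔽.*-congˡ (𝔽.reflexive (≡.sym (iter-id n y)))) e)
  open NoZeroDivisors split-𝔽 using (no-zero-divisors)

  *-split : ∀ f g → f * g ≈ [] → f ≈ [] ⊎ g ≈ []
  *-split f g fg≈0 with zero? f | zero? g
  ... | yes f≈0 | _       = inj₁ f≈0
  ... | no  _   | yes g≈0 = inj₂ g≈0
  ... | no  f≉0 | no  g≉0 = ⊥-elim (no-zero-divisors f g fg≈0 f≉0 g≉0)

  *-≉0′ : ∀ f g → ¬ f ≈ [] → ¬ g ≈ [] → ¬ f * g ≈ []
  *-≉0′ f g f≉0 g≉0 fg≈0 = no-zero-divisors f g fg≈0 f≉0 g≉0

  ^-≉0 : ∀ f n → ¬ f ≈ [] → ¬ f ^ n ≈ []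
  ^-≉0 f zero    f≉0 = 1≉0′
  ^-≉0 f (suc n) f≉0 = *-≉0′ f (f ^ n) f≉0 (^-≉0 f n f≉0)

  -- If N = g p is nonzero, its coefficient at deg g + d is a product of two leading coefficients
  -- and so does not vanish; e < d would place that index beyond the degree bound e.
  divisor-degree : ∀ p {d} → deg p ≡ just d → ∀ {N e} → p ∣ N → Below N (suc e) → ¬ N ≈ [] → d ℕ.≤ e
  divisor-degree p {d} deg-p {N} {e} (g , gp≈N) bN N≉0 with degree g
  ... | inj₁ g≈0       = contradiction (λ n → 𝔽.trans (𝔽.sym (gp≈N n)) (zero-* {g} p (coeffwise g≈0) .at n)) N≉0
  ... | inj₂ (m , deg-g) = ℕₚ.≮⇒≥ λ e<d → top≉0 (𝔽.trans (gp≈N (m ℕ.+ d)) (bN (m ℕ.+ d) (ℕₚ.≤-trans e<d (ℕₚ.m≤n+m d m))))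
    where
    top≉0 : coeff (g * p) (m ℕ.+ d) 𝔽.≉ 𝔽.0#
    top≉0 e with split-𝔽 (coeff g m) m (coeff p d) (𝔽.trans (𝔽.sym (top-* g p m d (proj₂ (deg-just g deg-g)) (proj₂ (deg-just p deg-p)))) e)
    ... | inj₁ gₘ≈0 = proj₁ (deg-just g deg-g) gₘ≈0
    ... | inj₂ p_d≈0 = proj₁ (deg-just p deg-p) p_d≈0

  const-hom : RingMorphisms.IsRingHomomorphism 𝔽.rawRing A.rawRing const
  const-hom = record
    { isSemiringHomomorphism = record
      { isNearSemiringHomomorphism = record
        { +-isMonoidHomomorphism = record
          { isMagmaHomomorphism = record { isRelHomomorphism = record { cong = λ e → ∷-cong e (≋-refl {[]}) .at } ; homo = λ a b → A.refl {const (a 𝔽.+ b)} }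
          ; ε-homo = shift-[] .at }
        ; *-homo = λ a b → A.refl {const (a 𝔽.* b)} }
      ; 1#-homo = A.refl {const 𝔽.1#} }
    ; -‿homo = λ a → A.refl {const (𝔽.- a)} }

  T*≋shift : ∀ f → T * f ≋ shift f
  T*≋shift f = ≋-trans (shift-* (const 𝔽.1#) f) (≋-trans (*-identityˡ (twist f)) (≋-reflexive (twist≡shift f)))

  ∷≋const+T* : ∀ a f → a ∷ f ≋ const a + T * f
  ∷≋const+T* a f = ≋-trans (∷-cong (𝔽.sym (𝔽.+-identityʳ a)) ≋-refl) (≋-sym (+-congˡ (const a) (T*≋shift f)))

  -- The exponent is at least 2, so only `- T` contributes to the coefficient at index 1, which is
  -- -1.
  T^m-T≉0 : ∀ m → ¬ T ^ suc (suc m) + - T ≈ []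
  T^m-T≉0 m e = 𝔽.1≉0 (begin
    𝔽.1#  ≈⟨ 𝔽ₚ.-‿involutive 𝔽.1# ⟨
    𝔽.- 𝔽.- 𝔽.1#  ≈⟨ 𝔽.-‿cong (𝔽.+-identityˡ _) ⟨
    𝔽.- (𝔽.0# 𝔽.+ 𝔽.- 𝔽.1#)  ≈⟨ 𝔽.-‿cong (𝔽.+-congʳ (𝔽.trans (T*≋shift (T * T ^ m) .at 1) (T*≋shift (T ^ m) .at 0))) ⟨
    𝔽.- (coeff (T ^ suc (suc m)) 1 𝔽.+ 𝔽.- 𝔽.1#)  ≈⟨ 𝔽.-‿cong (𝔽.trans (𝔽.sym (coeff-+ (T ^ suc (suc m)) (- T) 1)) (e 1)) ⟩
    𝔽.- 𝔽.0#  ≈⟨ 𝔽ₚ.-0#≈0# ⟩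
    𝔽.0#  ∎)
    where open ≈-Reasoning 𝔽.setoid

  Degree≤ : Poly → ℕ → Set ℓ
  Degree≤ f n = Below f (suc n)

  degree≤-mono : ∀ f {m n} → m ℕ.≤ n → Degree≤ f m → Degree≤ f n
  degree≤-mono f m≤n = below-mono f (ℕ.s≤s m≤n)

  degree≤-* : ∀ f g {m n} → Degree≤ f m → Degree≤ g n → Degree≤ (f * g) (m ℕ.+ n)
  degree≤-* f g {m} {n} bf bg = ≡.subst (Below (f * g)) (ℕₚ.+-suc m n) (below-* f g bf bg)

  degree≤-^ : ∀ f k {m} → Degree≤ f m → Degree≤ (f ^ k) (k ℕ.* m)
  degree≤-^ f zero    b (suc k) _ = 𝔽.refl
  degree≤-^ f (suc k) b = degree≤-* f (f ^ k) b (degree≤-^ f k b)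

  degree≤-T : Degree≤ T 1
  degree≤-T (suc zero)    (ℕ.s≤s ())
  degree≤-T (suc (suc k)) _ = 𝔽.refl

  some-degree : ∀ f → ∃ λ n → Degree≤ f n
  some-degree f = List.length f , below-mono f (ℕₚ.n≤1+n _) (below-length f)

  prime-power : ∃₂ λ p k → ℕPrime.Prime p × q ≡ p ℕ.^ suc k
  prime-power = proj₂ q-odd

  2≤q : 2 ℕ.≤ q
  2≤q = let p , k , p-prime , q≡ = prime-power in ≡.subst (2 ℕ.≤_) (≡.sym q≡)
    (ℕₚ.≤-trans (ℕ.nonTrivial⇒n>1 p {{prime⇒nonTrivial p-prime}}) (ℕₚ.m≤m*n p (p ℕ.^ k) {{ℕₚ.m^n≢0 p k {{prime⇒nonZero p-prime}}}}))

  -- A commutative ring under A inherits the characteristic of 𝔽.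
  module Under {c′ ℓ′} (R : CommutativeRing c′ ℓ′) {γ : Poly → CommutativeRing.Carrier R}
               (γ-hom : RingMorphisms.IsRingHomomorphism A.rawRing (CommutativeRing.rawRing R) γ) where
    ^q-hom : RingMorphisms.IsRingHomomorphism (CommutativeRing.rawRing R) (CommutativeRing.rawRing R)
               (λ x → SemiringNotions._^_ (RawRing.rawSemiring (CommutativeRing.rawRing R)) x q)
    ^q-hom = let p , k , p-prime , q≡ = prime-power in
      FrobeniusHomomorphism.isRingHomomorphism R p-prime
        (characteristic-transfer commutativeRing R γ-hom {p} (characteristic-transfer 𝔽.commutativeRing commutativeRing const-hom {p} (characteristic {p} {suc k} q≡)))
        (suc k) q≡

  module Residue (P : MonicPrime) where
    open MonicPrime P
    open Quotient commutativeRing p public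

    split-∣ : ∀ {f g} → p ∣ f * g → p ∣ f ⊎ p ∣ g
    split-∣ = SemiringNotions.Prime.split-∣ isPrime

    1≢ₚ0 : ¬ A.1# ≡ₚ []
    1≢ₚ0 e = SemiringNotions.Prime.p∤1 isPrime (≡ₚ0⇒∣ {A.1#} e)

    quotient-split : ∀ f g → CommutativeRing._*_ quotient f g ≡ₚ [] → f ≡ₚ [] ⊎ g ≡ₚ []
    quotient-split f g e with split-∣ {f} {g} (≡ₚ0⇒∣ {f * g} e)
    ... | inj₁ p∣f = inj₁ (∣⇒≡ₚ0 {f} p∣f)
    ... | inj₂ p∣g = inj₂ (∣⇒≡ₚ0 {g} p∣g)

-- The recursion for numerators and denominators.

-- If u = Σ uₖ τᵏ commutes with T + γ₁ τ + γ₂ τ², then comparing coefficients gives, for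
-- w₀ = 0 and wₖ₊₁ = uₖ,
--   (T^(q^(k+1)) - T) wₖ₊₂ = γ₁ wₖ₊₁^q + γ₂ wₖ^(q²) - wₖ₊₁ γ₁^(q^k) - wₖ γ₂^(q^(k-1)).
-- When γᵢ = Gᵢ/B and u₀² = D, all wₖ are rational multiples (Nₖ / Mₖ) u₀ of u₀: the
-- exponents q^i are odd, so u₀^(q^i) is u₀ times a power of D.  For k = 0 the exponent
-- q^(k-1) is truncated, which is harmless as w₀ = 0.
module _ {c ℓ} (R : CommutativeRing c ℓ) (q h : ℕ) where
  open CommutativeRing R hiding (zero)

  module Recursion (T B G₁ G₂ D : Carrier) where
    open Exp commutativeSemiring using (_^_)

    -- The product `β k` clears the denominators of the γ's: B those of γ₁ and γ₂, `C k` that of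
    -- γ₁^(q^k), `C′ k` that of γ₂^(q^(k-1)). The factor `M (suc k) ^ q` clears those of the w's: it
    -- is itself the denominator of w (suc k)^q, and it is a multiple of `M (suc k)`, of `M k` and
    -- of the q²-th power of `M k`. The four terms of `N` are the four terms of the recurrence
    -- multiplied by both factors, each with its cofactor; the powers of D come from s^q = D^h s.
    C C′ β bracket W M N : ℕ → Carrier
    C  k = B ^ (q ℕ.^ k)
    C′ k = B ^ (q ℕ.^ ℕ.pred k)
    β k = B * (C k * C′ k)
    bracket k = T ^ (q ℕ.^ suc k) - T
    W zero    = 1#
    W (suc k) = bracket k * β k
    M zero    = 1#
    M (suc k) = W k * M k ^ q
    N zero          = 0#
    N (suc zero)    = 1#
    N (suc (suc k)) = G₁ * (C k * C′ k) * N (suc k) ^ q * D ^ h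
                    + G₂ * (C k * C′ k) * W k ^ q * (N k ^ q) ^ q * (D ^ h * (D ^ h) ^ q)
                    - B * C′ k * G₁ ^ (q ℕ.^ k) * M (suc k) ^ (h ℕ.+ h) * N (suc k)
                    - B * C k * G₂ ^ (q ℕ.^ ℕ.pred k) * M (suc k) ^ (h ℕ.+ h) * (W k * M k ^ (h ℕ.+ h)) * N k

module RecursionIdentities {c ℓ} (R : CommutativeRing c ℓ) where
  open CommutativeRing R hiding (zero)
  open Solver R using (solve; _:=_; _:+_; _:*_; _:-_)

  rearrange₁ : ∀ B E P γ Q → B * E * P * (γ * Q) ≈ (γ * B) * E * (P * Q)
  rearrange₁ = solve 5 (λ B E P γ Q → B :* E :* P :* (γ :* Q) := (γ :* B) :* E :* (P :* Q)) refl

  rearrange₁′ : ∀ G E N D s → G * E * (N * (D * s)) ≈ G * E * N * D * s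
  rearrange₁′ = solve 5 (λ G E N D s → G :* E :* (N :* (D :* s)) := G :* E :* N :* D :* s) refl

  rearrange₂ : ∀ B E V P γ Q → B * E * (V * P) * (γ * Q) ≈ (γ * B) * E * V * (P * Q)
  rearrange₂ = solve 6 (λ B E V P γ Q → B :* E :* (V :* P) :* (γ :* Q) := (γ :* B) :* E :* V :* (P :* Q)) refl

  rearrange₂′ : ∀ G E V N D D′ s → G * E * V * (N * (D′ * (D * s))) ≈ G * E * V * N * (D * D′) * s
  rearrange₂′ = solve 7 (λ G E V N D D′ s → G :* E :* V :* (N :* (D′ :* (D :* s))) := G :* E :* V :* N :* (D :* D′) :* s) refl

  rearrange₃ : ∀ B C C′ M H w g → B * (C * C′) * (M * H) * (w * g) ≈ B * C′ * (g * C) * H * (M * w)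
  rearrange₃ = solve 7 (λ B C C′ M H w g → B :* (C :* C′) :* (M :* H) :* (w :* g) := B :* C′ :* (g :* C) :* H :* (M :* w)) refl

  rearrange₄ : ∀ B C C′ W M H H′ w g → B * (C * C′) * (W * (M * H′) * H) * (w * g) ≈ B * C * (g * C′) * H * (W * H′) * (M * w)
  rearrange₄ = solve 9 (λ B C C′ W M H H′ w g → B :* (C :* C′) :* (W :* (M :* H′) :* H) :* (w :* g) := B :* C :* (g :* C′) :* H :* (W :* H′) :* (M :* w)) refl

  distribute : ∀ P a b c d → P * (a + b - c - d) ≈ P * a + P * b - P * c - P * d
  distribute = solve 5 (λ P a b c d → P :* (a :+ b :- c :- d) := P :* a :+ P :* b :- P :* c :- P :* d) refl

  collect : ∀ a b c d s → a * s + b * s - c * s - d * s ≈ (a + b - c - d) * s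
  collect = solve 5 (λ a b c d s → a :* s :+ b :* s :- c :* s :- d :* s := (a :+ b :- c :- d) :* s) refl

module _ {c ℓ} (R : CommutativeRing c ℓ) {q h : ℕ} (q≡ : q ≡ suc (h ℕ.+ h)) where
  open CommutativeRing R hiding (zero)

  module RecursionSolution (T B G₁ G₂ D : Carrier) {γ₁ γ₂ s : Carrier} (γ₁B≈G₁ : γ₁ * B ≈ G₁) (γ₂B≈G₂ : γ₂ * B ≈ G₂) (s²≈D : s * s ≈ D) (w : ℕ → Carrier) where
    open Exp commutativeSemiring
    open Recursion R q h T B G₁ G₂ D
    open RecursionIdentities R
    open ≈-Reasoning setoid

    step : ℕ → Carrier
    step k = γ₁ * w (suc k) ^ q + γ₂ * (w k ^ q) ^ q - w (suc k) * γ₁ ^ (q ℕ.^ k) - w k * γ₂ ^ (q ℕ.^ ℕ.pred k)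

    ^q≈ : ∀ x → x ^ q ≈ x * x ^ (h ℕ.+ h)
    ^q≈ x = ^-congʳ x q≡

    s^q≈ : s ^ q ≈ D ^ h * s
    s^q≈ = begin
      s ^ q  ≈⟨ ^q≈ s ⟩
      s * s ^ (h ℕ.+ h)  ≈⟨ *-comm _ _ ⟩
      s ^ (h ℕ.+ h) * s  ≈⟨ *-congʳ (^-homo-* s h h) ⟩
      s ^ h * s ^ h * s  ≈⟨ *-congʳ (^-distrib-* s s h) ⟨
      (s * s) ^ h * s  ≈⟨ *-congʳ (^-congˡ h s²≈D) ⟩
      D ^ h * s  ∎

    module _ (k : ℕ) (e₀ : M k * w k ≈ N k * s) (e₁ : M (suc k) * w (suc k) ≈ N (suc k) * s) where
      private
        E = C k * C′ k

      powers₁ : M (suc k) ^ q * w (suc k) ^ q ≈ N (suc k) ^ q * (D ^ h * s)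
      powers₁ = begin
        M (suc k) ^ q * w (suc k) ^ q  ≈⟨ ^-distrib-* _ _ q ⟨
        (M (suc k) * w (suc k)) ^ q  ≈⟨ ^-congˡ q e₁ ⟩
        (N (suc k) * s) ^ q  ≈⟨ ^-distrib-* _ _ q ⟩
        N (suc k) ^ q * s ^ q  ≈⟨ *-congˡ s^q≈ ⟩
        N (suc k) ^ q * (D ^ h * s)  ∎

      powers₂ : (M k ^ q) ^ q * (w k ^ q) ^ q ≈ (N k ^ q) ^ q * ((D ^ h) ^ q * (D ^ h * s))
      powers₂ = begin
        (M k ^ q) ^ q * (w k ^ q) ^ q  ≈⟨ ^-distrib-* _ _ q ⟨
        (M k ^ q * w k ^ q) ^ q  ≈⟨ ^-congˡ q (^-distrib-* _ _ q) ⟨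
        ((M k * w k) ^ q) ^ q  ≈⟨ ^-congˡ q (^-congˡ q e₀) ⟩
        ((N k * s) ^ q) ^ q  ≈⟨ ^-congˡ q (^-distrib-* _ _ q) ⟩
        (N k ^ q * s ^ q) ^ q  ≈⟨ ^-congˡ q (*-congˡ s^q≈) ⟩
        (N k ^ q * (D ^ h * s)) ^ q  ≈⟨ ^-distrib-* _ _ q ⟩
        (N k ^ q) ^ q * (D ^ h * s) ^ q  ≈⟨ *-congˡ (^-distrib-* _ _ q) ⟩
        (N k ^ q) ^ q * ((D ^ h) ^ q * s ^ q)  ≈⟨ *-congˡ (*-congˡ s^q≈) ⟩
        (N k ^ q) ^ q * ((D ^ h) ^ q * (D ^ h * s))  ∎

      term₁ : β k * M (suc k) ^ q * (γ₁ * w (suc k) ^ q) ≈ G₁ * E * N (suc k) ^ q * D ^ h * s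
      term₁ = begin
        β k * M (suc k) ^ q * (γ₁ * w (suc k) ^ q)  ≈⟨ rearrange₁ _ _ _ _ _ ⟩
        γ₁ * B * E * (M (suc k) ^ q * w (suc k) ^ q)  ≈⟨ *-cong (*-congʳ γ₁B≈G₁) powers₁ ⟩
        G₁ * E * (N (suc k) ^ q * (D ^ h * s))  ≈⟨ rearrange₁′ _ _ _ _ _ ⟩
        G₁ * E * N (suc k) ^ q * D ^ h * s  ∎

      term₂ : β k * M (suc k) ^ q * (γ₂ * (w k ^ q) ^ q) ≈ G₂ * E * W k ^ q * (N k ^ q) ^ q * (D ^ h * (D ^ h) ^ q) * s
      term₂ = begin
        β k * M (suc k) ^ q * (γ₂ * (w k ^ q) ^ q)  ≈⟨ *-congʳ (*-congˡ (^-distrib-* (W k) (M k ^ q) q)) ⟩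
        β k * (W k ^ q * (M k ^ q) ^ q) * (γ₂ * (w k ^ q) ^ q)  ≈⟨ rearrange₂ _ _ _ _ _ _ ⟩
        γ₂ * B * E * W k ^ q * ((M k ^ q) ^ q * (w k ^ q) ^ q)  ≈⟨ *-cong (*-congʳ (*-congʳ γ₂B≈G₂)) powers₂ ⟩
        G₂ * E * W k ^ q * ((N k ^ q) ^ q * ((D ^ h) ^ q * (D ^ h * s)))  ≈⟨ rearrange₂′ _ _ _ _ _ _ _ ⟩
        G₂ * E * W k ^ q * (N k ^ q) ^ q * (D ^ h * (D ^ h) ^ q) * s  ∎

      term₃ : β k * M (suc k) ^ q * (w (suc k) * γ₁ ^ (q ℕ.^ k)) ≈ B * C′ k * G₁ ^ (q ℕ.^ k) * M (suc k) ^ (h ℕ.+ h) * N (suc k) * s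
      term₃ = begin
        β k * M (suc k) ^ q * (w (suc k) * γ₁ ^ (q ℕ.^ k))  ≈⟨ *-congʳ (*-congˡ (^q≈ (M (suc k)))) ⟩
        β k * (M (suc k) * M (suc k) ^ (h ℕ.+ h)) * (w (suc k) * γ₁ ^ (q ℕ.^ k))  ≈⟨ rearrange₃ _ _ _ _ _ _ _ ⟩
        B * C′ k * (γ₁ ^ (q ℕ.^ k) * C k) * M (suc k) ^ (h ℕ.+ h) * (M (suc k) * w (suc k))
          ≈⟨ *-cong (*-congʳ (*-congˡ (trans (sym (^-distrib-* γ₁ B (q ℕ.^ k))) (^-congˡ (q ℕ.^ k) γ₁B≈G₁)))) e₁ ⟩
        B * C′ k * G₁ ^ (q ℕ.^ k) * M (suc k) ^ (h ℕ.+ h) * (N (suc k) * s)  ≈⟨ *-assoc _ _ s ⟨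
        B * C′ k * G₁ ^ (q ℕ.^ k) * M (suc k) ^ (h ℕ.+ h) * N (suc k) * s  ∎

      term₄ : β k * M (suc k) ^ q * (w k * γ₂ ^ (q ℕ.^ ℕ.pred k)) ≈ B * C k * G₂ ^ (q ℕ.^ ℕ.pred k) * M (suc k) ^ (h ℕ.+ h) * (W k * M k ^ (h ℕ.+ h)) * N k * s
      term₄ = begin
        β k * M (suc k) ^ q * (w k * γ₂ ^ (q ℕ.^ ℕ.pred k))
          ≈⟨ *-congʳ (*-congˡ (trans (^q≈ (M (suc k))) (*-congʳ (*-congˡ (^q≈ (M k)))))) ⟩
        β k * (W k * (M k * M k ^ (h ℕ.+ h)) * M (suc k) ^ (h ℕ.+ h)) * (w k * γ₂ ^ (q ℕ.^ ℕ.pred k))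
          ≈⟨ rearrange₄ _ _ _ _ _ _ _ _ _ ⟩
        B * C k * (γ₂ ^ (q ℕ.^ ℕ.pred k) * C′ k) * M (suc k) ^ (h ℕ.+ h) * (W k * M k ^ (h ℕ.+ h)) * (M k * w k)
          ≈⟨ *-cong (*-congʳ (*-congʳ (*-congˡ (trans (sym (^-distrib-* γ₂ B (q ℕ.^ ℕ.pred k))) (^-congˡ (q ℕ.^ ℕ.pred k) γ₂B≈G₂))))) e₀ ⟩
        B * C k * G₂ ^ (q ℕ.^ ℕ.pred k) * M (suc k) ^ (h ℕ.+ h) * (W k * M k ^ (h ℕ.+ h)) * (N k * s)
          ≈⟨ *-assoc _ _ s ⟨
        B * C k * G₂ ^ (q ℕ.^ ℕ.pred k) * M (suc k) ^ (h ℕ.+ h) * (W k * M k ^ (h ℕ.+ h)) * N k * s ∎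

      clear-denominators : β k * M (suc k) ^ q * step k ≈ N (suc (suc k)) * s
      clear-denominators = trans (distribute _ _ _ _ _)
        (trans (+-cong (+-cong (+-cong term₁ term₂) (-‿cong term₃)) (-‿cong term₄)) (collect _ _ _ _ s))

    M*w≈N*s : (∀ k → bracket k * w (suc (suc k)) ≈ step k) → w 0 ≈ 0# → w 1 ≈ s → ∀ k → M k * w k ≈ N k * s
    M*w≈N*s rec w₀≈0 w₁≈s k = proj₁ (both k)
      where
      -- Two consecutive indices are carried along because the recurrence has order two.
      both : ∀ k → (M k * w k ≈ N k * s) × (M (suc k) * w (suc k) ≈ N (suc k) * s)
      both zero = trans (*-identityˡ _) (trans w₀≈0 (sym (zeroˡ s))) ,
                  trans (*-congʳ (trans (*-identityˡ _) (1^n≈1 R q))) (*-congˡ w₁≈s)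
      both (suc k) = let e₀ , e₁ = both k in e₁ , (begin
        bracket k * β k * M (suc k) ^ q * w (suc (suc k))  ≈⟨ solve 4 (λ b β m w → b :* β :* m :* w := β :* m :* (b :* w)) refl _ _ _ _ ⟩
        β k * M (suc k) ^ q * (bracket k * w (suc (suc k)))  ≈⟨ *-congˡ (rec k) ⟩
        β k * M (suc k) ^ q * step k  ≈⟨ clear-denominators k e₀ e₁ ⟩
        N (suc (suc k)) * s  ∎)
        where open Solver R using (solve; _:=_; _:*_)

module _ {c ℓ c′ ℓ′} (R : CommutativeRing c ℓ) (S : CommutativeRing c′ ℓ′) (q h : ℕ) where
  private module R = CommutativeRing R
  private module S = CommutativeRing S

  module RecursionHomomorphism {e : R.Carrier → S.Carrier} (e-hom : RingMorphisms.IsRingHomomorphism R.rawRing S.rawRing e) (T B G₁ G₂ D : R.Carrier) where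
    private
      module e = RingMorphisms.IsRingHomomorphism e-hom
      module Rec  = Recursion R q h T B G₁ G₂ D
      module Rec′ = Recursion S q h (e T) (e B) (e G₁) (e G₂) (e D)
      open Exp R.commutativeSemiring using () renaming (_^_ to _^ᴿ_)
      open Exp S.commutativeSemiring using (^-congˡ) renaming (_^_ to _^ˢ_)

      infixl 7 _⟨*⟩_
      _⟨*⟩_ : ∀ {x y x′ y′} → e x S.≈ x′ → e y S.≈ y′ → e (x R.* y) S.≈ x′ S.* y′
      p ⟨*⟩ p′ = S.trans (e.*-homo _ _) (S.*-cong p p′)
      infixl 6 _⟨+⟩_ _⟨-⟩_
      _⟨+⟩_ : ∀ {x y x′ y′} → e x S.≈ x′ → e y S.≈ y′ → e (x R.+ y) S.≈ x′ S.+ y′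
      p ⟨+⟩ p′ = S.trans (e.+-homo _ _) (S.+-cong p p′)
      _⟨-⟩_ : ∀ {x y x′ y′} → e x S.≈ x′ → e y S.≈ y′ → e (x R.- y) S.≈ x′ S.- y′
      p ⟨-⟩ p′ = S.trans (e.+-homo _ _) (S.+-cong p (S.trans (e.-‿homo _) (S.-‿cong p′)))
      infixl 8 _⟨^⟩_
      _⟨^⟩_ : ∀ {x x′} → e x S.≈ x′ → ∀ n → e (x ^ᴿ n) S.≈ x′ ^ˢ n
      p ⟨^⟩ n = S.trans (hom-^ R S e-hom _ n) (^-congˡ n p)

    bracket-homo : ∀ k → e (Rec.bracket k) S.≈ Rec′.bracket k
    bracket-homo k = S.refl ⟨^⟩ (q ℕ.^ suc k) ⟨-⟩ S.refl

    β-homo : ∀ k → e (Rec.β k) S.≈ Rec′.β k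
    β-homo k = S.refl ⟨*⟩ (S.refl ⟨^⟩ (q ℕ.^ k) ⟨*⟩ S.refl ⟨^⟩ (q ℕ.^ ℕ.pred k))

    W-homo : ∀ k → e (Rec.W k) S.≈ Rec′.W k
    W-homo zero    = e.1#-homo
    W-homo (suc k) = bracket-homo k ⟨*⟩ β-homo k

    M-homo : ∀ k → e (Rec.M k) S.≈ Rec′.M k
    M-homo zero    = e.1#-homo
    M-homo (suc k) = W-homo k ⟨*⟩ M-homo k ⟨^⟩ q

    -- Only ring operations occur in the recursion. Hence a single sequence of numerators in A
    -- serves both the residue field and the closure.
    N-homo : ∀ k → e (Rec.N k) S.≈ Rec′.N k
    N-homo zero          = e.0#-homo
    N-homo (suc zero)    = e.1#-homo
    N-homo (suc (suc k)) =
          S.refl ⟨*⟩ (C-homo ⟨*⟩ C′-homo) ⟨*⟩ N-homo (suc k) ⟨^⟩ q ⟨*⟩ S.refl ⟨^⟩ h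
      ⟨+⟩ S.refl ⟨*⟩ (C-homo ⟨*⟩ C′-homo) ⟨*⟩ W-homo k ⟨^⟩ q ⟨*⟩ N-homo k ⟨^⟩ q ⟨^⟩ q ⟨*⟩ (S.refl ⟨^⟩ h ⟨*⟩ S.refl ⟨^⟩ h ⟨^⟩ q)
      ⟨-⟩ S.refl ⟨*⟩ C′-homo ⟨*⟩ S.refl ⟨^⟩ (q ℕ.^ k) ⟨*⟩ M-homo (suc k) ⟨^⟩ (h ℕ.+ h) ⟨*⟩ N-homo (suc k)
      ⟨-⟩ S.refl ⟨*⟩ C-homo ⟨*⟩ S.refl ⟨^⟩ (q ℕ.^ ℕ.pred k) ⟨*⟩ M-homo (suc k) ⟨^⟩ (h ℕ.+ h) ⟨*⟩ (W-homo k ⟨*⟩ M-homo k ⟨^⟩ (h ℕ.+ h)) ⟨*⟩ N-homo k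
      where
      C-homo : e (Rec.C k) S.≈ Rec′.C k
      C-homo = S.refl ⟨^⟩ (q ℕ.^ k)
      C′-homo : e (Rec.C′ k) S.≈ Rec′.C′ k
      C′-homo = S.refl ⟨^⟩ (q ℕ.^ ℕ.pred k)

-- Degrees of the numerators and nonvanishing of the denominators.

module DegreeBounds (q h b n k X X′ : ℕ) (q≡ : q ≡ suc (h ℕ.+ h)) (1≤X : 1 ℕ.≤ X) (X′≤X : X′ ℕ.≤ X) where
  open import Data.Nat.Base using (_+_; _*_; _≤_)
  open ℕₚ.≤-Reasoning
  open ℕSolver.+-*-Solver using (solve; _:=_; _:+_; _:*_; con)

  -- In the application `X` is q^k, so `Y` and `U` are q^(k+1) and q^(k+2). The targets are c k q^k
  -- for deg `M k` and e k q^k for deg `N k`. In c, the 1 comes from the bracket and 3 b from the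
  -- three powers of B in `β`. The value e = 3 b + c + n is dictated by the second term of `N`: G₂
  -- with `C` and `C′` costs 3 b, `W` costs c, one power of D costs n. The other power of D fits
  -- into the spare index step, as that term contains `N k` and not `N (suc k)`.
  c e Y U : ℕ
  c = suc (3 * b)
  e = suc (6 * b) + n
  Y = q * X
  U = q * Y

  1≤q : 1 ≤ q
  1≤q = ≡.subst (1 ≤_) (≡.sym q≡) (ℕ.s≤s ℕ.z≤n)

  h≤q : h ≤ q
  h≤q = ≡.subst (h ≤_) (≡.sym q≡) (ℕₚ.m≤n⇒m≤1+n (ℕₚ.m≤m+n h h))

  x≤q*x : ∀ x → x ≤ q * x
  x≤q*x x = ℕₚ.m≤n*m x q {{ℕ.>-nonZero 1≤q}}

  Y≤U : Y ≤ U
  Y≤U = x≤q*x Y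

  X≤U : X ≤ U
  X≤U = ℕₚ.≤-trans (x≤q*x X) Y≤U

  1≤U : 1 ≤ U
  1≤U = ℕₚ.≤-trans 1≤X X≤U

  q≤U : q ≤ U
  q≤U = ≡.subst (_≤ U) (ℕₚ.*-identityʳ q) (ℕₚ.*-monoʳ-≤ q (ℕₚ.≤-trans 1≤X (x≤q*x X)))

  c≤e : c ≤ e
  c≤e = ℕₚ.≤-trans (ℕ.s≤s (ℕₚ.*-monoˡ-≤ b (ℕₚ.m≤m+n 3 3))) (ℕₚ.m≤m+n _ n)

  scaled : ∀ {x y} a → x ≤ y → x * a ≤ a * y
  scaled {x} {y} a x≤y = ℕₚ.≤-trans (ℕₚ.*-monoˡ-≤ a x≤y) (ℕₚ.≤-reflexive (ℕₚ.*-comm y a))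

  b≤bU : b ≤ b * U
  b≤bU = ℕₚ.≤-trans (ℕₚ.≤-reflexive (≡.sym (ℕₚ.*-identityʳ b))) (ℕₚ.*-monoʳ-≤ b 1≤U)

  Xb≤bU : X * b ≤ b * U
  Xb≤bU = scaled b X≤U

  X′b≤bU : X′ * b ≤ b * U
  X′b≤bU = scaled b (ℕₚ.≤-trans X′≤X X≤U)

  hn≤nU : h * n ≤ n * U
  hn≤nU = scaled n (ℕₚ.≤-trans h≤q q≤U)

  qhn≤nU : q * (h * n) ≤ n * U
  qhn≤nU = begin
    q * (h * n) ≤⟨ ℕₚ.*-monoʳ-≤ q (ℕₚ.*-monoˡ-≤ n (ℕₚ.≤-trans h≤q (ℕₚ.≤-trans (ℕₚ.≤-reflexive (≡.sym (ℕₚ.*-identityʳ q))) (ℕₚ.*-monoʳ-≤ q 1≤X)))) ⟩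
    q * (Y * n) ≡⟨ solve 3 (λ q Y n → q :* (Y :* n) := n :* (q :* Y)) ≡.refl q Y n ⟩
    n * U  ∎

  q*≡ : ∀ x → (h + h) * x + x ≡ q * x
  q*≡ x = ≡.trans (ℕₚ.+-comm ((h + h) * x) x) (≡.cong (_* x) (≡.sym q≡))

  -- Raising the index by one leaves room for e U, which absorbs any surplus m U with m at most e.
  last : ∀ m j → m ≤ e → e * (j * U) + m * U ≤ e * (suc j * U)
  last m j m≤e = begin
    e * (j * U) + m * U  ≤⟨ ℕₚ.+-monoʳ-≤ (e * (j * U)) (ℕₚ.*-monoˡ-≤ U m≤e) ⟩
    e * (j * U) + e * U  ≡⟨ solve 3 (λ e j U → e :* (j :* U) :+ e :* U := e :* (U :+ j :* U)) ≡.refl e j U ⟩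
    e * (suc j * U)  ∎

  β-bound : b + (X * b + X′ * b) ≤ 3 * b * U
  β-bound = begin
    b + (X * b + X′ * b)  ≤⟨ ℕₚ.+-mono-≤ b≤bU (ℕₚ.+-mono-≤ Xb≤bU X′b≤bU) ⟩
    b * U + (b * U + b * U)  ≡⟨ solve 2 (λ b U → b :* U :+ (b :* U :+ b :* U) := con 3 :* b :* U) ≡.refl b U ⟩
    3 * b * U  ∎

  W-bound : q * X * 1 + (b + (X * b + X′ * b)) ≤ c * Y
  W-bound = begin
    q * X * 1 + (b + (X * b + X′ * b))  ≤⟨ ℕₚ.+-mono-≤ (ℕₚ.≤-reflexive (ℕₚ.*-identityʳ (q * X))) (ℕₚ.+-mono-≤ b≤bY (ℕₚ.+-mono-≤ (scaled b (x≤q*x X)) (scaled b (ℕₚ.≤-trans X′≤X (x≤q*x X))))) ⟩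
    Y + (b * Y + (b * Y + b * Y))  ≡⟨ solve 2 (λ b Y → Y :+ (b :* Y :+ (b :* Y :+ b :* Y)) := Y :+ con 3 :* b :* Y) ≡.refl b Y ⟩
    c * Y  ∎
    where
    b≤bY : b ≤ b * Y
    b≤bY = ℕₚ.≤-trans (ℕₚ.≤-reflexive (≡.sym (ℕₚ.*-identityʳ b))) (ℕₚ.*-monoʳ-≤ b (ℕₚ.≤-trans 1≤X (x≤q*x X)))

  M-bound : c * X + q * (c * (k * X)) ≤ c * (suc k * Y)
  M-bound = begin
    c * X + q * (c * (k * X))  ≤⟨ ℕₚ.+-monoˡ-≤ _ (ℕₚ.*-monoʳ-≤ c (x≤q*x X)) ⟩
    c * Y + q * (c * (k * X))  ≡⟨ solve 4 (λ c q k X → c :* (q :* X) :+ q :* (c :* (k :* X)) := c :* (q :* X :+ k :* (q :* X))) ≡.refl c q k X ⟩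
    c * (suc k * Y)  ∎

  term₁-bound : b + (X * b + X′ * b) + q * (e * (suc k * Y)) + h * n ≤ e * (suc (suc k) * U)
  term₁-bound = begin
    b + (X * b + X′ * b) + q * (e * (suc k * Y)) + h * n  ≤⟨ ℕₚ.+-mono-≤ (ℕₚ.+-monoˡ-≤ _ β-bound) hn≤nU ⟩
    3 * b * U + q * (e * (suc k * Y)) + n * U  ≡⟨ solve 6 (λ b q e k Y n → con 3 :* b :* (q :* Y) :+ q :* (e :* (k :* Y)) :+ n :* (q :* Y) := e :* (k :* (q :* Y)) :+ (con 3 :* b :+ n) :* (q :* Y)) ≡.refl b q e (suc k) Y n ⟩
    e * (suc k * U) + (3 * b + n) * U  ≤⟨ last (3 * b + n) (suc k) (ℕₚ.+-monoˡ-≤ n (ℕₚ.≤-trans (ℕₚ.*-monoˡ-≤ b (ℕₚ.m≤m+n 3 3)) (ℕₚ.n≤1+n _))) ⟩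
    e * (suc (suc k) * U)  ∎

  term₂-bound : b + (X * b + X′ * b) + q * (c * X) + q * (q * (e * (k * X))) + (h * n + q * (h * n)) ≤ e * (suc (suc k) * U)
  term₂-bound = begin
    b + (X * b + X′ * b) + q * (c * X) + q * (q * (e * (k * X))) + (h * n + q * (h * n))
      ≤⟨ ℕₚ.+-mono-≤ (ℕₚ.+-monoˡ-≤ _ (ℕₚ.+-mono-≤ β-bound (ℕₚ.*-monoʳ-≤ q (ℕₚ.*-monoʳ-≤ c (x≤q*x X))))) (ℕₚ.+-mono-≤ hn≤nU qhn≤nU) ⟩
    3 * b * U + q * (c * Y) + q * (q * (e * (k * X))) + (n * U + n * U)
      ≡⟨ solve 7 (λ b q c X e k n → let Y = q :* X; U = q :* Y in
           con 3 :* b :* U :+ q :* (c :* Y) :+ q :* (q :* (e :* (k :* X))) :+ (n :* U :+ n :* U) := e :* (k :* U) :+ (con 3 :* b :+ c :+ n) :* U :+ n :* U) ≡.refl b q c X e k n ⟩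
    e * (k * U) + (3 * b + c + n) * U + n * U
      ≤⟨ ℕₚ.+-monoˡ-≤ (n * U) (last (3 * b + c + n) k (ℕₚ.≤-reflexive (solve 2 (λ b n → con 3 :* b :+ (con 1 :+ con 3 :* b) :+ n := con 1 :+ con 6 :* b :+ n) ≡.refl b n))) ⟩
    e * (suc k * U) + n * U
      ≤⟨ last n (suc k) (ℕₚ.m≤n+m n _) ⟩
    e * (suc (suc k) * U) ∎

  term₃-bound : b + X′ * b + X * b + (h + h) * (c * (suc k * Y)) + e * (suc k * Y) ≤ e * (suc (suc k) * U)
  term₃-bound = begin
    b + X′ * b + X * b + (h + h) * (c * (suc k * Y)) + e * (suc k * Y)
      ≤⟨ ℕₚ.+-monoˡ-≤ _ (ℕₚ.+-mono-≤ (ℕₚ.≤-trans (ℕₚ.≤-reflexive (solve 3 (λ b x y → b :+ x :+ y := b :+ (y :+ x)) ≡.refl b (X′ * b) (X * b))) β-bound) (ℕₚ.*-monoʳ-≤ (h + h) (ℕₚ.*-monoˡ-≤ (suc k * Y) c≤e))) ⟩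
    3 * b * U + (h + h) * (e * (suc k * Y)) + e * (suc k * Y)
      ≡⟨ ≡.trans (ℕₚ.+-assoc (3 * b * U) _ _) (≡.cong (λ z → 3 * b * U + z) (q*≡ (e * (suc k * Y)))) ⟩
    3 * b * U + q * (e * (suc k * Y))
      ≡⟨ solve 5 (λ b q e k Y → con 3 :* b :* (q :* Y) :+ q :* (e :* (k :* Y)) := e :* (k :* (q :* Y)) :+ (con 3 :* b) :* (q :* Y)) ≡.refl b q e (suc k) Y ⟩
    e * (suc k * U) + 3 * b * U
      ≤⟨ last (3 * b) (suc k) (ℕₚ.≤-trans (ℕₚ.n≤1+n _) c≤e) ⟩
    e * (suc (suc k) * U) ∎

  term₄-bound : b + X * b + X′ * b + (h + h) * (c * (suc k * Y)) + (c * X + (h + h) * (c * (k * X))) + e * (k * X) ≤ e * (suc (suc k) * U)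
  term₄-bound = begin
    b + X * b + X′ * b + (h + h) * (c * (suc k * Y)) + (c * X + (h + h) * (c * (k * X))) + e * (k * X)
      ≤⟨ ℕₚ.+-monoˡ-≤ _ (ℕₚ.+-mono-≤ (ℕₚ.+-mono-≤ (ℕₚ.≤-trans (ℕₚ.≤-reflexive (ℕₚ.+-assoc b _ _)) β-bound) (ℕₚ.*-monoʳ-≤ (h + h) (ℕₚ.*-monoˡ-≤ (suc k * Y) c≤e)))
           (ℕₚ.+-mono-≤ (ℕₚ.*-monoʳ-≤ c X≤U) (ℕₚ.*-monoʳ-≤ (h + h) (ℕₚ.*-monoˡ-≤ (k * X) c≤e)))) ⟩
    3 * b * U + (h + h) * (e * (suc k * Y)) + (c * U + (h + h) * (e * (k * X))) + e * (k * X)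
      ≡⟨ solve 5 (λ a p d r s → a :+ p :+ (d :+ r) :+ s := p :+ (r :+ s) :+ (a :+ d)) ≡.refl (3 * b * U) ((h + h) * (e * (suc k * Y))) (c * U) ((h + h) * (e * (k * X))) (e * (k * X)) ⟩
    (h + h) * (e * (suc k * Y)) + ((h + h) * (e * (k * X)) + e * (k * X)) + (3 * b * U + c * U)
      ≤⟨ ℕₚ.+-monoˡ-≤ (3 * b * U + c * U) (ℕₚ.+-monoʳ-≤ ((h + h) * (e * (suc k * Y))) (begin
           (h + h) * (e * (k * X)) + e * (k * X) ≡⟨ q*≡ (e * (k * X)) ⟩
           q * (e * (k * X))  ≡⟨ solve 4 (λ q e k X → q :* (e :* (k :* X)) := e :* (k :* (q :* X))) ≡.refl q e k X ⟩
           e * (k * Y)  ≤⟨ ℕₚ.*-monoʳ-≤ e (ℕₚ.*-monoˡ-≤ Y (ℕₚ.n≤1+n k)) ⟩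
           e * (suc k * Y)  ∎)) ⟩
    (h + h) * (e * (suc k * Y)) + e * (suc k * Y) + (3 * b * U + c * U)
      ≡⟨ ≡.cong₂ _+_ (≡.trans (q*≡ (e * (suc k * Y))) (solve 4 (λ q e k Y → q :* (e :* (k :* Y)) := e :* (k :* (q :* Y))) ≡.refl q e (suc k) Y)) (≡.sym (ℕₚ.*-distribʳ-+ U (3 * b) c)) ⟩
    e * (suc k * U) + (3 * b + c) * U
      ≤⟨ last (3 * b + c) (suc k) (ℕₚ.≤-trans (ℕₚ.≤-reflexive (solve 1 (λ b → con 3 :* b :+ (con 1 :+ con 3 :* b) := con 1 :+ con 6 :* b) ≡.refl b)) (ℕₚ.m≤m+n _ n)) ⟩
    e * (suc (suc k) * U) ∎

module _ {cℓ ℓ q} (𝔽 : FiniteField cℓ ℓ q) (q-odd : OddPrimePower q) where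
  open PolynomialsOverFiniteField 𝔽 q-odd

  module RecursionDegrees (B G₁ G₂ D : Poly) (b n : ℕ) (degB : Degree≤ B b) (degG₁ : Degree≤ G₁ b) (degG₂ : Degree≤ G₂ b) (degD : Degree≤ D n) where
    open Recursion commutativeRing q h X B G₁ G₂ D

    private
      1≤q^ : ∀ k → 1 ℕ.≤ q ℕ.^ k
      1≤q^ k = ℕₚ.m^n>0 q {{ℕ.>-nonZero (ℕₚ.≤-trans (ℕ.s≤s ℕ.z≤n) 2≤q)}} k
      module Bound k = DegreeBounds q h b n k (q ℕ.^ k) (q ℕ.^ ℕ.pred k) q≡1+2h (1≤q^ k)
        (ℕₚ.^-monoʳ-≤ q {{ℕ.>-nonZero (ℕₚ.≤-trans (ℕ.s≤s ℕ.z≤n) 2≤q)}} (ℕₚ.pred[n]≤n {k}))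

    c e : ℕ
    c = suc (3 ℕ.* b)
    e = suc (6 ℕ.* b) ℕ.+ n

    degree-C : ∀ k → Degree≤ (C k) (q ℕ.^ k ℕ.* b)
    degree-C k = degree≤-^ B (q ℕ.^ k) degB

    degree-C′ : ∀ k → Degree≤ (C′ k) (q ℕ.^ ℕ.pred k ℕ.* b)
    degree-C′ k = degree≤-^ B (q ℕ.^ ℕ.pred k) degB

    degree-E : ∀ k → Degree≤ (C k * C′ k) (q ℕ.^ k ℕ.* b ℕ.+ q ℕ.^ ℕ.pred k ℕ.* b)
    degree-E k = degree≤-* (C k) (C′ k) (degree-C k) (degree-C′ k)

    degree-bracket : ∀ k → Degree≤ (bracket k) (q ℕ.^ suc k ℕ.* 1)
    degree-bracket k = below-+ (X ^ (q ℕ.^ suc k)) (- X) (degree≤-^ X (q ℕ.^ suc k) degree≤-T)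
      (below-neg X (degree≤-mono X (ℕₚ.≤-trans (1≤q^ (suc k)) (ℕₚ.≤-reflexive (≡.sym (ℕₚ.*-identityʳ _)))) degree≤-T))

    degree-1 : Degree≤ (const (CommutativeRing.1# (FiniteField.commutativeRing 𝔽))) 0
    degree-1 (suc k) _ = CommutativeRing.refl (FiniteField.commutativeRing 𝔽)

    degree-W : ∀ k → Degree≤ (W k) (c ℕ.* q ℕ.^ k)
    degree-W zero    = degree≤-mono (W 0) ℕ.z≤n degree-1
    degree-W (suc k) = degree≤-mono (W (suc k)) (Bound.W-bound k)
      (degree≤-* (bracket k) (β k) (degree-bracket k) (degree≤-* B (C k * C′ k) degB (degree-E k)))

    degree-M : ∀ k → Degree≤ (M k) (c ℕ.* (k ℕ.* q ℕ.^ k))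
    degree-M zero    = degree≤-mono (M 0) ℕ.z≤n degree-1
    degree-M (suc k) = degree≤-mono (M (suc k)) (Bound.M-bound k) (degree≤-* (W k) (M k ^ q) (degree-W k) (degree≤-^ (M k) q (degree-M k)))

    -- Passing to the next index multiplies the degree by at most q and adds a multiple of the new
    -- power of q; after division by q^k the increment is bounded, whence the factor k.
    degree-N : ∀ k → Degree≤ (N k) (e ℕ.* (k ℕ.* q ℕ.^ k))
    degree-N zero       = λ k _ → CommutativeRing.refl (FiniteField.commutativeRing 𝔽)
    degree-N (suc zero) = degree≤-mono (N 1) ℕ.z≤n degree-1
    degree-N (suc (suc k)) =
      below-+ (t₁ + t₂ + - t₃) (- t₄)
        (below-+ (t₁ + t₂) (- t₃)
          (below-+ t₁ t₂
            (degree≤-mono t₁ (Bound.term₁-bound k)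
              (degree≤-* (G₁ * (C k * C′ k) * N (suc k) ^ q) (D ^ h)
                (degree≤-* (G₁ * (C k * C′ k)) (N (suc k) ^ q) (degree≤-* G₁ (C k * C′ k) degG₁ (degree-E k)) (degree≤-^ (N (suc k)) q (degree-N (suc k))))
                (degree≤-^ D h degD)))
            (degree≤-mono t₂ (Bound.term₂-bound k)
              (degree≤-* (G₂ * (C k * C′ k) * W k ^ q * (N k ^ q) ^ q) (D ^ h * (D ^ h) ^ q)
                (degree≤-* (G₂ * (C k * C′ k) * W k ^ q) ((N k ^ q) ^ q)
                  (degree≤-* (G₂ * (C k * C′ k)) (W k ^ q) (degree≤-* G₂ (C k * C′ k) degG₂ (degree-E k)) (degree≤-^ (W k) q (degree-W k)))
                  (degree≤-^ (N k ^ q) q (degree≤-^ (N k) q (degree-N k))))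
                (degree≤-* (D ^ h) ((D ^ h) ^ q) (degree≤-^ D h degD) (degree≤-^ (D ^ h) q (degree≤-^ D h degD))))))
          (below-neg t₃ (degree≤-mono t₃ (Bound.term₃-bound k)
            (degree≤-* (B * C′ k * G₁ ^ (q ℕ.^ k) * M (suc k) ^ (h ℕ.+ h)) (N (suc k))
              (degree≤-* (B * C′ k * G₁ ^ (q ℕ.^ k)) (M (suc k) ^ (h ℕ.+ h))
                (degree≤-* (B * C′ k) (G₁ ^ (q ℕ.^ k)) (degree≤-* B (C′ k) degB (degree-C′ k)) (degree≤-^ G₁ (q ℕ.^ k) degG₁))
                (degree≤-^ (M (suc k)) (h ℕ.+ h) (degree-M (suc k))))
              (degree-N (suc k))))))
        (below-neg t₄ (degree≤-mono t₄ (Bound.term₄-bound k)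
          (degree≤-* (B * C k * G₂ ^ (q ℕ.^ ℕ.pred k) * M (suc k) ^ (h ℕ.+ h) * (W k * M k ^ (h ℕ.+ h))) (N k)
            (degree≤-* (B * C k * G₂ ^ (q ℕ.^ ℕ.pred k) * M (suc k) ^ (h ℕ.+ h)) (W k * M k ^ (h ℕ.+ h))
              (degree≤-* (B * C k * G₂ ^ (q ℕ.^ ℕ.pred k)) (M (suc k) ^ (h ℕ.+ h))
                (degree≤-* (B * C k) (G₂ ^ (q ℕ.^ ℕ.pred k)) (degree≤-* B (C k) degB (degree-C k)) (degree≤-^ G₂ (q ℕ.^ ℕ.pred k) degG₂))
                (degree≤-^ (M (suc k)) (h ℕ.+ h) (degree-M (suc k))))
              (degree≤-* (W k) (M k ^ (h ℕ.+ h)) (degree-W k) (degree≤-^ (M k) (h ℕ.+ h) (degree-M k))))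
            (degree-N k))))
      where
      t₁ = G₁ * (C k * C′ k) * N (suc k) ^ q * D ^ h
      t₂ = G₂ * (C k * C′ k) * W k ^ q * (N k ^ q) ^ q * (D ^ h * (D ^ h) ^ q)
      t₃ = B * C′ k * G₁ ^ (q ℕ.^ k) * M (suc k) ^ (h ℕ.+ h) * N (suc k)
      t₄ = B * C k * G₂ ^ (q ℕ.^ ℕ.pred k) * M (suc k) ^ (h ℕ.+ h) * (W k * M k ^ (h ℕ.+ h)) * N k

module _ {cℓ ℓ q} (𝔽 : FiniteField cℓ ℓ q) (q-odd : OddPrimePower q) where
  open PolynomialsOverFiniteField 𝔽 q-odd

  module RecursionNonvanishing (B G₁ G₂ D : Poly) where
    open Recursion commutativeRing q h X B G₁ G₂ D

    bracket≉0 : ∀ k → ¬ bracket k ≈ []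
    bracket≉0 k = ≡.subst (λ m → ¬ X ^ m + - X ≈ []) m+2≡ (T^m-T≉0 m)
      where
      2≤q^ : 2 ℕ.≤ q ℕ.^ suc k
      2≤q^ = ℕₚ.≤-trans 2≤q (ℕₚ.m≤m*n q (q ℕ.^ k) {{ℕₚ.m^n≢0 q k {{ℕ.>-nonZero (ℕₚ.≤-trans (ℕ.s≤s ℕ.z≤n) 2≤q)}}}})
      m = q ℕ.^ suc k ℕ.∸ 2
      m+2≡ : suc (suc m) ≡ q ℕ.^ suc k
      m+2≡ = ℕₚ.m+[n∸m]≡n 2≤q^

    module _ (B≉0 : ¬ B ≈ []) where
      β≉0 : ∀ k → ¬ β k ≈ []
      β≉0 k = *-≉0′ B (C k * C′ k) B≉0 (*-≉0′ (C k) (C′ k) (^-≉0 B (q ℕ.^ k) B≉0) (^-≉0 B (q ℕ.^ ℕ.pred k) B≉0))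

      W≉0 : ∀ k → ¬ W k ≈ []
      W≉0 zero    = 1≉0′
      W≉0 (suc k) = *-≉0′ (bracket k) (β k) (bracket≉0 k) (β≉0 k)

      M≉0 : ∀ k → ¬ M k ≈ []
      M≉0 zero    = 1≉0′
      M≉0 (suc k) = *-≉0′ (W k) (M k ^ q) (W≉0 k) (^-≉0 (M k) q (M≉0 k))

-- Commutation with a Drinfeld module of rank two as a recurrence.

module _ {c ℓ} (R : CommutativeRing c ℓ) (q : ℕ) where
  private module R = CommutativeRing R
  open Exp R.commutativeSemiring using (_^_; ^-assocʳ)

  module Commutation (^q-hom : RingMorphisms.IsRingHomomorphism R.rawRing R.rawRing (_^ q)) where
    private module Rτ = SkewRing R (_^ q) ^q-hom
    open Rτ using (coeff; shift; twist; iter; _≋_; at; coeffwise; const; coeff-+; coeff-scale; coeff-σ; σ-0)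
    open Solver R using (solve; _:=_; _:+_; _:*_; _:-_)

    iter≈^ : ∀ k x → iter k x R.≈ x ^ (q ℕ.^ k)
    iter≈^ zero    x = R.sym (R.*-identityʳ x)
    iter≈^ (suc k) x = R.trans (iter≈^ k (x ^ q)) (^-assocʳ x q (q ℕ.^ k))

    module _ (split : ∀ x y → x R.* y R.≈ R.0# → x R.≈ R.0# ⊎ y R.≈ R.0#) (1≉0 : ¬ R.1# R.≈ R.0#) where
      ^≈0⇒≈0 : ∀ y k → y ^ k R.≈ R.0# → y R.≈ R.0#
      ^≈0⇒≈0 y zero    1≈0 = contradiction 1≈0 1≉0
      ^≈0⇒≈0 y (suc k) e with split y (y ^ k) e
      ... | inj₁ y≈0   = y≈0
      ... | inj₂ y^k≈0 = ^≈0⇒≈0 y k y^k≈0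

      split-iter : ∀ x k y → x R.* iter k y R.≈ R.0# → x R.≈ R.0# ⊎ y R.≈ R.0#
      split-iter x k y e with split x (y ^ (q ℕ.^ k)) (R.trans (R.*-congˡ (R.sym (iter≈^ k y))) e)
      ... | inj₁ x≈0 = inj₁ x≈0
      ... | inj₂ y^≈0 = inj₂ (^≈0⇒≈0 y (q ℕ.^ k) y^≈0)

    coeff-*-zero : ∀ f g → coeff (f Rτ.* g) 0 R.≈ coeff f 0 R.* coeff g 0
    coeff-*-zero []      g = R.sym (R.zeroˡ _)
    coeff-*-zero (a ∷ f) g = R.trans (coeff-+ (List.map (a R.*_) g) (f Rτ.* twist g) 0)
      (R.trans (R.+-cong (coeff-scale a g 0) (Rτ.*-shift f (List.map (_^ q) g) .at 0)) (R.+-identityʳ _))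

    coeff-twist : ∀ u k → coeff (twist u) k R.≈ coeff (shift u) k ^ q
    coeff-twist u zero    = R.sym σ-0
    coeff-twist u (suc k) = coeff-σ u k

    module _ (t g g′ : R.Carrier) (u : Rτ.Poly) where
      private
        w = coeff (shift u)

      coeff-*-left : ∀ k → coeff ((t ∷ g ∷ g′ ∷ []) Rτ.* u) (suc k) R.≈ t R.* w (suc (suc k)) R.+ (g R.* w (suc k) ^ q R.+ g′ R.* (w k ^ q) ^ q)
      coeff-*-left k = begin
        coeff (tu Rτ.+ (gu Rτ.+ (g′u Rτ.+ []))) (suc k)
          ≈⟨ Rτ.+-congˡ tu (Rτ.+-congˡ gu (Rτ.+-identityʳ g′u)) .at (suc k) ⟩
        coeff (tu Rτ.+ (gu Rτ.+ g′u)) (suc k)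
          ≈⟨ R.trans (coeff-+ tu _ (suc k)) (R.+-congˡ (coeff-+ gu g′u (suc k))) ⟩
        coeff tu (suc k) R.+ (coeff gu (suc k) R.+ coeff g′u (suc k))
          ≈⟨ R.+-cong (coeff-scale t u (suc k)) (R.+-cong (coeff-scale g (twist u) (suc k)) (coeff-scale g′ (twist (twist u)) (suc k))) ⟩
        t R.* coeff u (suc k) R.+ (g R.* coeff (twist u) (suc k) R.+ g′ R.* coeff (twist (twist u)) (suc k))
          ≈⟨ R.+-congˡ (R.+-cong (R.*-congˡ (coeff-σ u k)) (R.*-congˡ (R.trans (coeff-σ (twist u) k) (Rτ.σ-cong (coeff-twist u k))))) ⟩
        t R.* w (suc (suc k)) R.+ (g R.* w (suc k) ^ q R.+ g′ R.* (w k ^ q) ^ q) ∎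
        where
        open ≈-Reasoning R.setoid
        tu  = List.map (t R.*_) u
        gu  = List.map (g R.*_) (twist u)
        g′u = List.map (g′ R.*_) (twist (twist u))

      coeff-*-right : ∀ k → coeff (u Rτ.* (t ∷ g ∷ g′ ∷ [])) (suc k)
        R.≈ w (suc (suc k)) R.* t ^ (q ℕ.^ suc k) R.+ (w (suc k) R.* g ^ (q ℕ.^ k) R.+ w k R.* g′ ^ (q ℕ.^ ℕ.pred k))
      coeff-*-right k = begin
        coeff (u Rτ.* (t ∷ g ∷ g′ ∷ [])) (suc k)  ≈⟨ split .at (suc k) ⟩
        coeff (u Rτ.* const t Rτ.+ shift (u Rτ.* const g Rτ.+ shift (u Rτ.* const g′))) (suc k)
          ≈⟨ R.trans (coeff-+ (u Rτ.* const t) _ (suc k)) (R.+-congˡ (coeff-+ (u Rτ.* const g) _ k)) ⟩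
        coeff (u Rτ.* const t) (suc k) R.+ (coeff (u Rτ.* const g) k R.+ coeff (shift (u Rτ.* const g′)) k)
          ≈⟨ R.+-cong (scaled t (suc k)) (R.+-cong (scaled g k) (last k)) ⟩
        w (suc (suc k)) R.* t ^ (q ℕ.^ suc k) R.+ (w (suc k) R.* g ^ (q ℕ.^ k) R.+ w k R.* g′ ^ (q ℕ.^ ℕ.pred k)) ∎
        where
        open ≈-Reasoning R.setoid
        scaled : ∀ x j → coeff (u Rτ.* const x) j R.≈ coeff u j R.* x ^ (q ℕ.^ j)
        scaled x j = R.trans (Rτ.coeff-*-const u x j) (R.*-congˡ (iter≈^ j x))
        last : ∀ k → coeff (shift (u Rτ.* const g′)) k R.≈ w k R.* g′ ^ (q ℕ.^ ℕ.pred k)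
        last zero    = R.sym (R.zeroˡ _)
        last (suc k) = scaled g′ k
        cons : ∀ x f → x ∷ f ≋ const x Rτ.+ shift f
        cons x f = Rτ.∷-cong (R.sym (R.+-identityʳ x)) Rτ.≋-refl
        *-cons : ∀ x f → u Rτ.* (x ∷ f) ≋ u Rτ.* const x Rτ.+ shift (u Rτ.* f)
        *-cons x f = Rτ.≋-trans (Rτ.*-congˡ u (cons x f)) (Rτ.≋-trans (Rτ.distribˡ u (const x) (shift f)) (Rτ.+-congˡ (u Rτ.* const x) (Rτ.*-shift u f)))
        split : u Rτ.* (t ∷ g ∷ g′ ∷ []) ≋ u Rτ.* const t Rτ.+ shift (u Rτ.* const g Rτ.+ shift (u Rτ.* const g′))
        split = Rτ.≋-trans (*-cons t _) (Rτ.+-congˡ (u Rτ.* const t) (Rτ.shift-cong (*-cons g _)))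

      Recurrence : ℕ → Set ℓ
      Recurrence k = (t ^ (q ℕ.^ suc k) R.- t) R.* w (suc (suc k))
        R.≈ g R.* w (suc k) ^ q R.+ g′ R.* (w k ^ q) ^ q R.- w (suc k) R.* g ^ (q ℕ.^ k) R.- w k R.* g′ ^ (q ℕ.^ ℕ.pred k)

      private
        isolate : ∀ t′ t w a b c d → w R.* t′ R.+ (a R.+ b) R.≈ t R.* w R.+ (c R.+ d) → (t′ R.- t) R.* w R.≈ c R.+ d R.- a R.- b
        isolate t′ t w a b c d e = R.trans
          (solve 5 (λ t′ t w a b → (t′ :- t) :* w := (w :* t′ :+ (a :+ b)) :- t :* w :- (a :+ b)) R.refl t′ t w a b)
          (R.trans (R.+-congʳ (R.+-congʳ e)) (solve 6 (λ t w a b c d → (t :* w :+ (c :+ d)) :- t :* w :- (a :+ b) := c :+ d :- a :- b) R.refl t w a b c d))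

        unisolate : ∀ t′ t w a b c d → (t′ R.- t) R.* w R.≈ c R.+ d R.- a R.- b → w R.* t′ R.+ (a R.+ b) R.≈ t R.* w R.+ (c R.+ d)
        unisolate t′ t w a b c d e = R.trans
          (solve 5 (λ t′ t w a b → w :* t′ :+ (a :+ b) := (t′ :- t) :* w :+ t :* w :+ (a :+ b)) R.refl t′ t w a b)
          (R.trans (R.+-congʳ (R.+-congʳ e)) (solve 6 (λ t w a b c d → c :+ d :- a :- b :+ t :* w :+ (a :+ b) := t :* w :+ (c :+ d)) R.refl t w a b c d))

      commute⇒recurrence : u Rτ.* (t ∷ g ∷ g′ ∷ []) ≋ (t ∷ g ∷ g′ ∷ []) Rτ.* u → ∀ k → Recurrence k
      commute⇒recurrence e k = isolate _ _ _ _ _ _ _ (R.trans (R.sym (coeff-*-right k)) (R.trans (e .at (suc k)) (coeff-*-left k)))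

      -- The recurrences cover the coefficients from index 1 on; index 0 imposes no condition,
      -- because constant coefficients commute.
      recurrence⇒commute : (∀ k → Recurrence k) → u Rτ.* (t ∷ g ∷ g′ ∷ []) ≋ (t ∷ g ∷ g′ ∷ []) Rτ.* u
      recurrence⇒commute rec .at zero    = R.trans (coeff-*-zero u _) (R.trans (R.*-comm _ _) (R.sym (coeff-*-zero (t ∷ g ∷ g′ ∷ []) u)))
      recurrence⇒commute rec .at (suc k) = R.trans (coeff-*-right k) (R.trans (unisolate _ _ _ _ _ _ _ (rec k)) (R.sym (coeff-*-left k)))

module _ {cℓ ℓ q} (𝔽 : FiniteField cℓ ℓ q) (q-odd : OddPrimePower q) {c′ ℓ′} (L : CommutativeRing c′ ℓ′) where
  private module A = PolynomialsOverFiniteField 𝔽 q-odd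
  open FunctionField 𝔽 using (DrinfeldModule; T)
  private module L = CommutativeRing L

  module DrinfeldProperties {γ : A.Poly → L.Carrier} (γ-hom : RingMorphisms.IsRingHomomorphism A.A.rawRing L.rawRing γ) (Ψ : DrinfeldModule L.rawRing γ 2) where
    open DrinfeldModule Ψ using (ψ; isRingHomomorphism; 𝔽-linear; constant; degree; g)
    open A.Under L γ-hom using (^q-hom)
    module Lτ = SkewRing L _ ^q-hom
    open Commutation L q ^q-hom public
    open Lτ using (coeff; Below; _≋_; at; coeffwise; const; ≋-refl; ≋-trans; ≋-sym)
    private
      module ψ = RingMorphisms.IsRingHomomorphism isRingHomomorphism
      module γ = RingMorphisms.IsRingHomomorphism γ-hom

    ψ-cong : ∀ {a b} → a A.≋ b → ψ a ≋ ψ b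
    ψ-cong e = coeffwise (ψ.⟦⟧-cong (e .A.at))

    ψ-[] : ψ [] ≋ []
    ψ-[] = coeffwise ψ.0#-homo

    ψ-+ : ∀ a b → ψ (a A.+ b) ≋ ψ a Lτ.+ ψ b
    ψ-+ a b = coeffwise (ψ.+-homo a b)

    ψ-* : ∀ a b → ψ (a A.* b) ≋ ψ a Lτ.* ψ b
    ψ-* a b = coeffwise (ψ.*-homo a b)

    ψ-const : ∀ x → ψ (A.const x) ≋ const (γ (A.const x))
    ψ-const x = coeffwise (𝔽-linear x)

    ψ-∷ : ∀ x f → ψ (x ∷ f) ≋ const (γ (A.const x)) Lτ.+ ψ T Lτ.* ψ f
    ψ-∷ x f = ≋-trans (ψ-cong (A.∷≋const+T* x f)) (≋-trans (ψ-+ (A.const x) (T A.* f)) (Lτ.+-cong (ψ-const x) (ψ-* T f)))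

    γ-∷ : ∀ x f → γ (x ∷ f) L.≈ γ (A.const x) L.+ γ T L.* γ f
    γ-∷ x f = L.trans (γ.⟦⟧-cong (A.∷≋const+T* x f .A.at)) (L.trans (γ.+-homo (A.const x) (T A.* f)) (L.+-congˡ (γ.*-homo T f)))

    -- Both sides follow Horner's rule in T: taking the constant coefficient is additive and,
    -- although R{τ} is not commutative, also multiplicative.
    constant-coefficient : ∀ a → coeff (ψ a) 0 L.≈ γ a
    constant-coefficient []      = L.trans (ψ-[] .at 0) (L.sym γ.0#-homo)
    constant-coefficient (x ∷ f) = begin
      coeff (ψ (x ∷ f)) 0  ≈⟨ ψ-∷ x f .at 0 ⟩
      coeff (const (γ (A.const x)) Lτ.+ ψ T Lτ.* ψ f) 0  ≈⟨ Lτ.coeff-+ (const (γ (A.const x))) (ψ T Lτ.* ψ f) 0 ⟩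
      γ (A.const x) L.+ coeff (ψ T Lτ.* ψ f) 0  ≈⟨ L.+-congˡ (coeff-*-zero (ψ T) (ψ f)) ⟩
      γ (A.const x) L.+ coeff (ψ T) 0 L.* coeff (ψ f) 0  ≈⟨ L.+-congˡ (L.*-cong constant (constant-coefficient f)) ⟩
      γ (A.const x) L.+ γ T L.* γ f  ≈⟨ γ-∷ x f ⟨
      γ (x ∷ f)  ∎
      where open ≈-Reasoning L.setoid

    below-ψT : Below (ψ T) 3
    below-ψT m 3≤m = proj₂ degree m 3≤m

    below-const : ∀ x {n} → Below (const x) (suc n)
    below-const x (suc m) _ = L.refl

    -- Each Horner step multiplies by `ψ T`, of degree 2 in τ. Since `Below` is strict, degree 2 n
    -- appears as `suc (n + n)`.
    degree-ψ : ∀ a {n} → A.Degree≤ a n → Below (ψ a) (suc (n ℕ.+ n))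
    degree-ψ [] b = λ m _ → ψ-[] .at m
    degree-ψ (x ∷ f) {zero} b = Lτ.below-cong {const (γ (A.const x))} (≋-sym ψ≋const) (below-const _)
      where
      ψ≋const : ψ (x ∷ f) ≋ const (γ (A.const x))
      ψ≋const = ≋-trans (ψ-cong (A.∷-cong (CommutativeRing.refl (FiniteField.commutativeRing 𝔽)) (A.below-zero f (A.below-tail x f b)))) (ψ-const x)
    degree-ψ (x ∷ f) {suc n} b = Lτ.below-cong (≋-sym (ψ-∷ x f))
      (Lτ.below-+ (const (γ (A.const x))) (ψ T Lτ.* ψ f) (below-const _)
        (≡.subst (λ m → Below (ψ T Lτ.* ψ f) (suc (suc m))) (≡.sym (ℕₚ.+-suc n n)) (Lτ.below-* (ψ T) (ψ f) {2} below-ψT (degree-ψ f (A.below-tail x f b)))))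

    ψT≋ : ψ T ≋ γ T ∷ g 1 ∷ g 2 ∷ []
    ψT≋ .at 0 = constant
    ψT≋ .at 1 = L.refl
    ψT≋ .at 2 = L.refl
    ψT≋ .at (suc (suc (suc m))) = below-ψT (3 ℕ.+ m) (ℕ.s≤s (ℕ.s≤s (ℕ.s≤s ℕ.z≤n)))

-- The trace-zero endomorphism of the reduction and the bound for deg p.

module ReductionIdentities {c ℓ} (R : CommutativeRing c ℓ) where
  open CommutativeRing R
  open Solver R using (solve; _:=_; _:+_; _:*_; :-_)

  expand : ∀ B g b a → B * (g * b + - a) ≈ B * (g * b) + - (a * B)
  expand = solve 4 (λ B g b a → B :* (g :* b :+ :- a) := B :* (g :* b) :+ :- (a :* B)) refl

  contract : ∀ B g b G → B * (g * b) + - (b * G) ≈ b * (g * B + - G)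
  contract = solve 4 (λ B g b G → B :* (g :* b) :+ :- (b :* G) := b :* (g :* B :+ :- G)) refl

  eliminate : ∀ {N N′ M w s} → N ≈ N′ → M * w ≈ N′ * s → w ≈ 0# → N * s ≈ 0#
  eliminate {M = M} N≈N′ e w≈0 = trans (*-congʳ N≈N′) (trans (sym e) (trans (*-congˡ w≈0) (zeroʳ M)))

  trans₃ : ∀ x {y z w} → y ≈ x → y ≈ z → z ≈ w → x ≈ w
  trans₃ x e e′ e″ = trans (sym e) (trans e′ e″)

module _ {c ℓ} (R : Ring c ℓ) where
  open Ring R
  open RingProperties R using (-‿distribˡ-*)
  open ≈-Reasoning setoid

  difference-of-squares : ∀ v a → v * a ≈ a * v → v * v ≈ a * a → (v - a) * (v + a) ≈ 0#
  difference-of-squares v a va≈av v²≈a² = begin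
    (v - a) * (v + a)  ≈⟨ distribʳ (v + a) v (- a) ⟩
    v * (v + a) + - a * (v + a)  ≈⟨ +-cong (distribˡ v v a) (trans (sym (-‿distribˡ-* a (v + a))) (-‿cong (distribˡ a v a))) ⟩
    (v * v + v * a) - (a * v + a * a)  ≈⟨ +-congʳ (trans (+-cong v²≈a² va≈av) (+-comm _ _)) ⟩
    (a * v + a * a) - (a * v + a * a)  ≈⟨ -‿inverseʳ _ ⟩
    0#  ∎

module _ {cℓ ℓ q} (𝔽 : FiniteField cℓ ℓ q) (q-odd : OddPrimePower q) where
  private module A = PolynomialsOverFiniteField 𝔽 q-odd
  open FunctionField 𝔽 hiding (module A)

  module _ {c′ ℓ′} (F : FractionField c′ ℓ′) (Ψ : DrinfeldModule (FractionField.rawRing F) (FractionField.ι F) 2) (P : MonicPrime) where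
    private module F = FractionField F
    open Rank2 F Ψ
    open MonicPrime P
    open AtPrime P

    module TraceZeroEndomorphism (Φ : Reduction) (Δ : A.Poly) (disc : IsDiscriminant Φ Δ) where
      open Reduction Φ using (φ; module′)
      open A.Residue P using (quotient; residue-hom)
      private
        module 𝓡 = Ring (SkewRing.ring quotient _ (A.Under.^q-hom quotient residue-hom))
      private module Tr = TraceZeroElement A.commutativeRing (SkewRing.ring quotient _ (A.Under.^q-hom quotient residue-hom)) F.base A.*-split A.zero? A.1≉0′ φ (DrinfeldModule.isRingHomomorphism module′) F.ι F.isEmbedding

      isTrace⇒ : ∀ {w τ} → IsTrace Φ w τ → Tr.IsTrace (π Φ) w τ
      isTrace⇒ (s , n , s≉0 , e , e′ , eτ) =
        s , n zero zero , n (suc zero) zero , n zero (suc zero) , n (suc zero) (suc zero) , s≉0 , e , e′ , eτ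

      traceZero : ∃ λ v → (∀ a → (v 𝓡.* φ a) 𝓡.≈ (φ a 𝓡.* v)) × (v 𝓡.* v) 𝓡.≈ φ Δ × (∀ e → ¬ v 𝓡.≈ φ e)
      traceZero = let α , basis , t , traces , Δ-det = disc
                      open IsBasisOfEnd basis in
        Tr.traceZeroElement (π Φ) (α zero) (α (suc zero)) A.2≉0′ (member zero) (member (suc zero))
          (λ w cw → let a , e = spanning w cw in a zero , a (suc zero) , e)
          (λ x y e → let f = independent (λ { zero → x ; (suc zero) → y }) e in f zero , f (suc zero))
          (isTrace⇒ (traces zero zero)) (isTrace⇒ (traces zero (suc zero))) (isTrace⇒ (traces (suc zero) zero)) (isTrace⇒ (traces (suc zero) (suc zero)))
          Δ Δ-det

module _ {cℓ ℓ q} (𝔽 : FiniteField cℓ ℓ q) (q-odd : OddPrimePower q) where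
  private module A = PolynomialsOverFiniteField 𝔽 q-odd
  open FunctionField 𝔽 hiding (module A)

  module _ {c′ ℓ′} (F : FractionField c′ ℓ′) (Ψ : DrinfeldModule (FractionField.rawRing F) (FractionField.ι F) 2) (P : MonicPrime) where
    private module F = FractionField F
    open Rank2 F Ψ
    open MonicPrime P
    open AtPrime P
    private module 𝓡 = Ring (SkewRing.ring (A.Residue.quotient P) _ (A.Under.^q-hom (A.Residue.quotient P) (A.Residue.residue-hom P)))

    module ReductionSide (Φ : Reduction) (Δ : A.Poly) (v : 𝔽ₚ⟨τ⟩.Poly) (v*φ : ∀ a → v 𝓡.* Reduction.φ Φ a 𝓡.≈ Reduction.φ Φ a 𝓡.* v)
      (v²≈φΔ : v 𝓡.* v 𝓡.≈ Reduction.φ Φ Δ) (v≉φ : ∀ e → ¬ v 𝓡.≈ Reduction.φ Φ e) where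
      open Reduction Φ using (φ; ḡ; reduces; module′)
      open A.Residue P using (quotient; residue-hom; split-∣; quotient-split; 1≢ₚ0; ∣⇒≡ₚ0; ≡ₚ0⇒∣; ∣-cong; ∣-*)
      open SemiringNotions (RawRing.rawSemiring A.A.rawRing) using (_∣_; _∤_)

      open DrinfeldProperties 𝔽 q-odd quotient residue-hom module′
      open Lτ using (coeff; Below; _≋_; at; coeffwise; ≋-refl; ≋-trans; ≋-sym; iter; shift)
      private
        module Res = CommutativeRing quotient
        module φ = RingMorphisms.IsRingHomomorphism (DrinfeldModule.isRingHomomorphism module′)
        module ι = RingMorphisms.IsRingMonomorphism F.isEmbedding

      open Lτ.NoZeroDivisors (split-iter quotient-split 1≢ₚ0)

      -- If Δ = a², then (v - φ a)(v + φ a) = 0, because v commutes with φ a. The skew polynomial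
      -- ring over the residue field has no zero divisors, so v would be one of the scalars φ a and
      -- φ (- a).
      Δ-nonsquare : ∀ a → ¬ Δ A.≈ a A.* a
      Δ-nonsquare a Δ≈a² = no-zero-divisors (v 𝓡.- φ a) (v 𝓡.+ φ a) (difference-of-squares Lτ.ring v (φ a) (v*φ a) v²≈φa²)
        (λ e → v≉φ a (x∙y⁻¹≈ε⇒x≈y v (φ a) e))
        (λ e → v≉φ (A.- a) (𝓡.trans {v} {𝓡.- φ a} {φ (A.- a)} (+-inverseˡ-unique v (φ a) e) (𝓡.sym {φ (A.- a)} {𝓡.- φ a} (φ.-‿homo a))))
        where
        open RingProperties Lτ.ring using (x∙y⁻¹≈ε⇒x≈y; +-inverseˡ-unique)
        v²≈φa² : v 𝓡.* v 𝓡.≈ φ a 𝓡.* φ a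
        v²≈φa² = 𝓡.trans {v 𝓡.* v} {φ Δ} {φ a 𝓡.* φ a} v²≈φΔ
          (𝓡.trans {φ Δ} {φ (a A.* a)} {φ a 𝓡.* φ a} (φ.⟦⟧-cong {Δ} {a A.* a} Δ≈a²) (φ.*-homo a a))

      Δ≉0 : ¬ Δ A.≈ []
      -- Zero is the square of zero, and `[] * []` computes to `[]`.
      Δ≉0 = Δ-nonsquare []

      -- In rank two φ Δ has degree at most 2 n in τ, and it is the square of v.
      below-v : ∀ n → A.Degree≤ Δ n → Below v (suc n)
      below-v n b = below-sqrt v n (Lτ.below-cong {φ Δ} {v 𝔽ₚ⟨τ⟩.* v} (≋-sym (coeffwise v²≈φΔ)) (degree-ψ Δ b))

      v₀ : A.Poly
      v₀ = coeff v 0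

      v₀²≡Δ : v₀ Res.* v₀ Res.≈ Δ
      v₀²≡Δ = ReductionIdentities.trans₃ quotient (v₀ A.* v₀) {coeff (v 𝓡.* v) 0} {coeff (φ Δ) 0} {Δ} (coeff-*-zero v v) (v²≈φΔ 0) (constant-coefficient Δ)

      module _ (B G₁ G₂ : A.Poly) (g₁B≈G₁ : DrinfeldModule.g Ψ 1 F.* F.ι B F.≈ F.ι G₁) (g₂B≈G₂ : DrinfeldModule.g Ψ 2 F.* F.ι B F.≈ F.ι G₂) where
        open Recursion A.commutativeRing q A.h A.X B G₁ G₂ Δ

        reduction≡ : ∀ i {G} → DrinfeldModule.g Ψ i F.* F.ι B F.≈ F.ι G → ḡ i Res.* B Res.≈ G
        reduction≡ i {G} gB≈G = let a , b , gb≈a , p∤b , p∣ḡb-a = reduces i in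
          cancel b p∤b (∣-cong (A.A.trans {B A.* (ḡ i A.* b A.+ A.- a)} {B A.* (ḡ i A.* b) A.+ A.- (a A.* B)} {b A.* (ḡ i A.* B A.+ A.- G)}
            (expand B (ḡ i) b a)
            (A.A.trans {B A.* (ḡ i A.* b) A.+ A.- (a A.* B)} {B A.* (ḡ i A.* b) A.+ A.- (b A.* G)} {b A.* (ḡ i A.* B A.+ A.- G)}
               (A.A.+-congˡ {B A.* (ḡ i A.* b)} {A.- (a A.* B)} {A.- (b A.* G)} (A.A.-‿cong {a A.* B} {b A.* G} (aB≈bG a b gb≈a)))
               (contract B (ḡ i) b G)))
            (∣-* B p∣ḡb-a))
          where
          open ReductionIdentities A.commutativeRing
          cancel : ∀ b → p ∤ b → p ∣ b A.* (ḡ i A.* B A.+ A.- G) → ḡ i Res.* B Res.≈ G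
          cancel b p∤b p∣ with split-∣ {b} p∣
          ... | inj₁ p∣b = contradiction p∣b p∤b
          ... | inj₂ p∣′ = p∣′
          aB≈bG : ∀ a b → DrinfeldModule.g Ψ i F.* F.ι b F.≈ F.ι a → a A.* B A.≈ b A.* G
          aB≈bG a b gb≈a = ι.injective (begin
            F.ι (a A.* B)  ≈⟨ ι.*-homo a B ⟩
            F.ι a F.* F.ι B  ≈⟨ F.*-congʳ gb≈a ⟨
            DrinfeldModule.g Ψ i F.* F.ι b F.* F.ι B  ≈⟨ F.*-congʳ (F.*-comm _ _) ⟩
            F.ι b F.* DrinfeldModule.g Ψ i F.* F.ι B  ≈⟨ F.*-assoc _ _ _ ⟩
            F.ι b F.* (DrinfeldModule.g Ψ i F.* F.ι B)  ≈⟨ F.*-congˡ gB≈G ⟩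
            F.ι b F.* F.ι G  ≈⟨ ι.*-homo b G ⟨
            F.ι (b A.* G)  ∎)
            where open ≈-Reasoning F.setoid

        -- The sequence w is shifted by one, so `w (suc n)` is the coefficient of v at n, the first
        -- that `Below v n` annihilates. The left side `M * w` is then 0 whatever residue M has.
        N*v₀≡0 : ∀ n → Below v n → p ∣ N (suc n) A.* v₀
        N*v₀≡0 n b = ≡ₚ0⇒∣ (ReductionIdentities.eliminate quotient {N (suc n)} {Rec′.N (suc n)} {Rec′.M (suc n)} {w (suc n)} {v₀} (N-homo (suc n)) (solution (suc n)) (b n ℕₚ.≤-refl))
          where
          w = coeff (shift v)
          open RecursionHomomorphism A.commutativeRing quotient q A.h residue-hom T B G₁ G₂ Δ using (N-homo)
          module Rec′ = Recursion quotient q A.h A.X B G₁ G₂ Δ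
          commutes : v 𝔽ₚ⟨τ⟩.* (T ∷ ḡ 1 ∷ ḡ 2 ∷ []) ≋ (T ∷ ḡ 1 ∷ ḡ 2 ∷ []) 𝔽ₚ⟨τ⟩.* v
          commutes = ≋-trans (Lτ.*-congˡ v (≋-sym ψT≋)) (≋-trans (coeffwise (v*φ T)) (Lτ.*-congʳ v ψT≋))
          solution : ∀ k → Rec′.M k Res.* w k Res.≈ Rec′.N k Res.* v₀
          solution = RecursionSolution.M*w≈N*s quotient {q} {A.h} A.q≡1+2h A.X B G₁ G₂ Δ {ḡ 1} {ḡ 2} {v₀} (reduction≡ 1 g₁B≈G₁) (reduction≡ 2 g₂B≈G₂) v₀²≡Δ w
            (commute⇒recurrence T (ḡ 1) (ḡ 2) v commutes) (Res.refl {[]}) (Res.refl {v₀})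

        -- If p divides v₀, it divides v₀² ≡ Δ, which is not zero in A; this gives deg p ≤ n, and n
        -- is dominated by the bound for the degree of `N (suc k)`.
        prime-degree-bound : ∀ n b → A.Degree≤ Δ n → A.Degree≤ B b → A.Degree≤ G₁ b → A.Degree≤ G₂ b →
          ∀ k → n ℕ.< k → ¬ N (suc k) A.≈ [] → d ℕ.≤ (suc (6 ℕ.* b) ℕ.+ n) ℕ.* (suc k ℕ.* q ℕ.^ suc k)
        prime-degree-bound n b degΔ degB degG₁ degG₂ k n<k N≉0 = bound (split-∣ {N (suc k)} {v₀} (N*v₀≡0 k (Lτ.below-mono v n<k (below-v n degΔ))))
          where
          p∣v₀⇒p∣Δ : p ∣ v₀ → p ∣ Δ
          p∣v₀⇒p∣Δ p∣v₀ = ≡ₚ0⇒∣ {Δ} (Res.trans {Δ} {v₀ A.* v₀} {[]} (Res.sym {v₀ A.* v₀} {Δ} v₀²≡Δ) (∣⇒≡ₚ0 {v₀ A.* v₀} (∣-* {v₀} v₀ p∣v₀)))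
          1≤q^ : 1 ℕ.≤ q ℕ.^ suc k
          1≤q^ = ℕₚ.m^n>0 q {{ℕ.>-nonZero (ℕₚ.≤-trans (ℕ.s≤s ℕ.z≤n) A.2≤q)}} (suc k)
          n≤bound : n ℕ.≤ (suc (6 ℕ.* b) ℕ.+ n) ℕ.* (suc k ℕ.* q ℕ.^ suc k)
          n≤bound = ℕₚ.≤-trans (ℕₚ.m≤n+m n (suc (6 ℕ.* b)))
            (ℕₚ.m≤m*n (suc (6 ℕ.* b) ℕ.+ n) (suc k ℕ.* q ℕ.^ suc k) {{ℕ.>-nonZero (ℕₚ.*-mono-≤ {1} {suc k} (ℕ.s≤s ℕ.z≤n) 1≤q^)}})
          degN : A.Degree≤ (N (suc k)) ((suc (6 ℕ.* b) ℕ.+ n) ℕ.* (suc k ℕ.* q ℕ.^ suc k))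
          degN = RecursionDegrees.degree-N 𝔽 q-odd B G₁ G₂ Δ b n degB degG₁ degG₂ degΔ (suc k)
          bound : (p ∣ N (suc k)) ⊎ (p ∣ v₀) → d ℕ.≤ (suc (6 ℕ.* b) ℕ.+ n) ℕ.* (suc k ℕ.* q ℕ.^ suc k)
          bound (inj₁ p∣N)  = A.divisor-degree p deg≡d {N (suc k)} p∣N degN N≉0
          bound (inj₂ p∣v₀) = ℕₚ.≤-trans (A.divisor-degree p deg≡d {Δ} {n} (p∣v₀⇒p∣Δ p∣v₀) degΔ Δ≉0) n≤bound

-- The terminating recursion over the algebraic closure.

module _ {c ℓ} (K : Field c ℓ) where
  open Field K hiding (zero)

  module _ {q h : ℕ} (q≡ : q ≡ suc (h ℕ.+ h)) (T B G₁ G₂ D : Carrier) where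
    open Recursion commutativeRing q h T B G₁ G₂ D

    module RecursionOverField {γ₁ γ₂ s : Carrier} (γ₁B≈G₁ : γ₁ * B ≈ G₁) (γ₂B≈G₂ : γ₂ * B ≈ G₂) (s²≈D : s * s ≈ D) (M≉0 : ∀ k → M k ≉ 0#) where
      open Exp commutativeSemiring using (_^_)
      open FieldProperties K using (*-cancelˡ-≈)
      open ≈-Reasoning setoid

      -- The closed form (N / M) s is taken as the definition, so that a vanishing numerator
      -- immediately gives a vanishing term; the recurrence is then recovered from it.
      w : ℕ → Carrier
      w k = proj₁ (inverse (M k) (M≉0 k)) * (N k * s)

      open RecursionSolution commutativeRing {q} {h} q≡ T B G₁ G₂ D γ₁B≈G₁ γ₂B≈G₂ s²≈D w using (step; clear-denominators)

      M*w≈N*s : ∀ k → M k * w k ≈ N k * s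
      M*w≈N*s k = trans (sym (*-assoc _ _ _)) (trans (*-congʳ (proj₂ (inverse (M k) (M≉0 k)))) (*-identityˡ _))

      w≈0 : ∀ k → N k ≈ 0# → w k ≈ 0#
      w≈0 k N≈0 = trans (*-congˡ (trans (*-congʳ N≈0) (zeroˡ s))) (zeroʳ _)

      w₁≈s : w 1 ≈ s
      w₁≈s = *-cancelˡ-≈ (M≉0 1) (trans (M*w≈N*s 1) (*-congʳ (sym (trans (*-identityˡ _) (1^n≈1 commutativeRing q)))))

      -- `clear-denominators` is read backwards: the factor to be cancelled divides
      -- `M (suc (suc k))` and is therefore nonzero.
      recurrence : ∀ k → bracket k * w (suc (suc k)) ≈ step k
      recurrence k = *-cancelˡ-≈ Q≉0 (begin
        β k * M (suc k) ^ q * (bracket k * w (suc (suc k)))  ≈⟨ regroup _ _ _ _ ⟨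
        bracket k * β k * M (suc k) ^ q * w (suc (suc k))  ≈⟨ M*w≈N*s (suc (suc k)) ⟩
        N (suc (suc k)) * s  ≈⟨ clear-denominators k (M*w≈N*s k) (M*w≈N*s (suc k)) ⟨
        β k * M (suc k) ^ q * step k  ∎)
        where
        open Solver commutativeRing using (solve; _:=_; _:*_)
        regroup : ∀ b β m w → b * β * m * w ≈ β * m * (b * w)
        regroup = solve 4 (λ b β m w → b :* β :* m :* w := β :* m :* (b :* w)) refl
        Q≉0 : β k * M (suc k) ^ q ≉ 0#
        Q≉0 Q≈0 = M≉0 (suc (suc k)) (trans (*-assoc _ _ _) (trans (*-congˡ Q≈0) (zeroʳ _)))

module _ {c ℓ} (R : CommutativeRing c ℓ) (q : ℕ) (1≤q : 1 ℕ.≤ q) where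
  open CommutativeRing R hiding (zero)
  open Exp commutativeSemiring using (_^_; ^-congˡ)

  module Truncation (^q-hom : RingMorphisms.IsRingHomomorphism rawRing rawRing (_^ q)) (t g g′ : Carrier) (w : ℕ → Carrier) (n : ℕ) (w₀≈0 : w 0 ≈ 0#)
    (w[2+n]≈0 : w (2 ℕ.+ n) ≈ 0#) (w[3+n]≈0 : w (3 ℕ.+ n) ≈ 0#)
    (recurrence : ∀ k → (t ^ (q ℕ.^ suc k) - t) * w (suc (suc k)) ≈ g * w (suc k) ^ q + g′ * (w k ^ q) ^ q - w (suc k) * g ^ (q ℕ.^ k) - w k * g′ ^ (q ℕ.^ ℕ.pred k))
    where
    private module Rτ = SkewRing R (_^ q) ^q-hom
    open Rτ using (coeff; shift; σ-0)
    open Commutation R q ^q-hom using (Recurrence; recurrence⇒commute)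
    open RingProperties ring using (-0#≈0#)

    initial : (ℕ → Carrier) → ℕ → List Carrier
    initial f zero    = []
    initial f (suc m) = f 0 ∷ initial (f ∘ suc) m

    coeff-initial : ∀ f {m k} → k ℕ.< m → coeff (initial f m) k ≈ f k
    coeff-initial f {suc m} {zero}  _           = refl
    coeff-initial f {suc m} {suc k} (ℕ.s≤s k<m) = coeff-initial (f ∘ suc) k<m

    coeff-initial-0 : ∀ f {m k} → m ℕ.≤ k → coeff (initial f m) k ≈ 0#
    coeff-initial-0 f {zero}          _           = refl
    coeff-initial-0 f {suc m} {suc k} (ℕ.s≤s m≤k) = coeff-initial-0 (f ∘ suc) m≤k

    -- The terms w 1, ..., w (n + 1) are its coefficients at 0, ..., n; this undoes the shift by
    -- one.
    u : Rτ.Poly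
    u = initial (w ∘ suc) (suc n)

    w̃ : ℕ → Carrier
    w̃ = coeff (shift u)

    w̃≈0 : ∀ {k} → 2 ℕ.+ n ℕ.≤ k → w̃ k ≈ 0#
    w̃≈0 {suc k} (ℕ.s≤s 1+n≤k) = coeff-initial-0 (w ∘ suc) 1+n≤k

    w̃≈w : ∀ k → k ℕ.≤ 3 ℕ.+ n → w̃ k ≈ w k
    w̃≈w zero    _ = sym w₀≈0
    w̃≈w (suc k) (ℕ.s≤s k≤2+n) with k ℕₚ.<? suc n
    ... | yes k<1+n = coeff-initial (w ∘ suc) k<1+n
    ... | no  k≮1+n = trans (w̃≈0 (ℕ.s≤s (ℕₚ.≮⇒≥ k≮1+n))) (sym (w≈0 (ℕₚ.m≤n⇒m<n∨m≡n (ℕₚ.≮⇒≥ k≮1+n))))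
      where
      w≈0 : suc n ℕ.< k ⊎ suc n ≡ k → w (suc k) ≈ 0#
      w≈0 (inj₁ 1+n<k) = ≡.subst (λ k → w (suc k) ≈ 0#) (ℕₚ.≤-antisym 1+n<k k≤2+n) w[3+n]≈0
      w≈0 (inj₂ ≡.refl) = w[2+n]≈0

    0^q≈0 : ∀ {x} → x ≈ 0# → x ^ q ≈ 0#
    0^q≈0 x≈0 = trans (^-congˡ q x≈0) σ-0

    -- For k up to n + 1 only indices up to n + 3 occur, and there the truncation agrees with w
    -- because w (n + 2) and w (n + 3) are zero. For larger k every index is at least n + 2, so both
    -- sides vanish. The two zeros are exactly what joins the two ranges.
    truncated-recurrence : ∀ k → Recurrence t g g′ u k
    truncated-recurrence k with k ℕₚ.≤? suc n
    ... | yes k≤1+n = trans (*-congˡ e₂) (trans (recurrence k) (sym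
          (+-cong (+-cong (+-cong (*-congˡ (^-congˡ q e₁)) (*-congˡ (^-congˡ q (^-congˡ q e₀)))) (-‿cong (*-congʳ e₁))) (-‿cong (*-congʳ e₀)))))
      where
      e₀ = w̃≈w k (ℕₚ.m≤n⇒m≤1+n (ℕₚ.m≤n⇒m≤1+n k≤1+n))
      e₁ = w̃≈w (suc k) (ℕₚ.m≤n⇒m≤1+n (ℕ.s≤s k≤1+n))
      e₂ = w̃≈w (suc (suc k)) (ℕ.s≤s (ℕ.s≤s k≤1+n))
    ... | no  k≰1+n = trans (trans (*-congˡ (w̃≈0 (ℕₚ.m≤n⇒m≤1+n (ℕₚ.m≤n⇒m≤1+n 2+n≤k)))) (zeroʳ _)) (sym
          (trans (+-cong (trans (+-cong (trans (+-cong (vanish (0^q≈0 e₁)) (vanish (0^q≈0 (0^q≈0 e₀)))) (+-identityʳ 0#)) (neg e₁)) (+-identityʳ 0#)) (neg e₀)) (+-identityʳ 0#)))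
      where
      2+n≤k = ℕₚ.≰⇒> k≰1+n
      e₀ = w̃≈0 2+n≤k
      e₁ = w̃≈0 (ℕₚ.m≤n⇒m≤1+n 2+n≤k)
      vanish : ∀ {x y} → y ≈ 0# → x * y ≈ 0#
      vanish {x} y≈0 = trans (*-congˡ y≈0) (zeroʳ x)
      neg : ∀ {x y} → x ≈ 0# → - (x * y) ≈ 0#
      neg {x} {y} x≈0 = trans (-‿cong (trans (*-congʳ x≈0) (zeroˡ y))) -0#≈0#

    commutes : u Rτ.* (t ∷ g ∷ g′ ∷ []) Rτ.≋ (t ∷ g ∷ g′ ∷ []) Rτ.* u
    commutes = recurrence⇒commute t g g′ u truncated-recurrence

module _ {cℓ ℓ q} (𝔽 : FiniteField cℓ ℓ q) (q-odd : OddPrimePower q) where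
  private module A = PolynomialsOverFiniteField 𝔽 q-odd
  open FunctionField 𝔽 hiding (module A)

  module _ {c′ ℓ′} (F : FractionField c′ ℓ′) (Ψ : DrinfeldModule (FractionField.rawRing F) (FractionField.ι F) 2) where
    private module F = FractionField F
    open Rank2 F Ψ
    private module Ψ = DrinfeldModule Ψ

    module ClosureSide {c″ ℓ″} (Fᵃˡᵍ : AlgebraicClosure F.base c″ ℓ″) (onlyScalar : EndomorphismsOverClosureAreScalar Fᵃˡᵍ) (B G₁ G₂ : A.Poly)
      (B≉0 : ¬ B A.≈ []) (g₁B≈G₁ : Ψ.g 1 F.* F.ι B F.≈ F.ι G₁) (g₂B≈G₂ : Ψ.g 2 F.* F.ι B F.≈ F.ι G₂) (Δ : A.Poly)
      (Δ-nonsquare : ∀ a → ¬ Δ A.≈ a A.* a) where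
      open AlgebraicClosure Fᵃˡᵍ using (embed; closed; closure) renaming (isEmbedding to embed-mono)
      private
        module K = Field closure
        KR = K.commutativeRing
        module embed = RingMorphisms.IsRingMonomorphism embed-mono
        module ι = RingMorphisms.IsRingMonomorphism F.isEmbedding

      η : A.Poly → K.Carrier
      η a = embed (F.ι a)

      η-mono : RingMorphisms.IsRingMonomorphism A.A.rawRing K.rawRing η
      η-mono = Composition.isRingMonomorphism K.trans F.isEmbedding embed-mono

      private module η = RingMorphisms.IsRingMonomorphism η-mono

      ^q-homᶠ = A.Under.^q-hom F.commutativeRing ι.isRingHomomorphism
      ^q-homᵏ = A.Under.^q-hom KR η.isRingHomomorphism

      module Kτ = SkewRing KR _ ^q-homᵏ
      open Kτ using (_≋_; at; coeff; const; ≋-refl; ≋-trans; ≋-sym; iter)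
      open DrinfeldProperties 𝔽 q-odd F.commutativeRing ι.isRingHomomorphism Ψ using (ψ-∷; ψ-[]; ψT≋; constant-coefficient; module Lτ)
      open MapHomomorphism F.commutativeRing KR ^q-homᶠ ^q-homᵏ embed.isRingHomomorphism (λ x → hom-^ F.commutativeRing KR embed.isRingHomomorphism x q)
      open Ψ using (ψ)

      ψᵏ : A.Poly → Kτ.Poly
      ψᵏ a = List.map embed (ψ a)

      -- Elements of 𝔽 satisfy x^q = x, so τ commutes with them.
      iter-const : ∀ x k → iter k (η (A.const x)) K.≈ η (A.const x)
      iter-const x zero    = K.refl
      iter-const x (suc k) = K.trans (Kτ.iter-cong k (begin
        SemiringNotions._^_ (RawRing.rawSemiring K.rawRing) (η (A.const x)) q  ≈⟨ hom-^ A.commutativeRing KR η.isRingHomomorphism (A.const x) q ⟨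
        η (SemiringNotions._^_ (RawRing.rawSemiring A.A.rawRing) (A.const x) q)  ≈⟨ η.⟦⟧-cong (hom-^ (FiniteField.commutativeRing 𝔽) A.commutativeRing A.const-hom x q) ⟨
        η (A.const (SemiringNotions._^_ (RawRing.rawSemiring (FiniteField.rawRing 𝔽)) x q)) ≈⟨ η.⟦⟧-cong (A.∷-cong (A.fermat x) A.≋-refl .A.at) ⟩
        η (A.const x)  ∎)) (iter-const x k)
        where open ≈-Reasoning K.setoid

      const-central : ∀ u x → u Kτ.* const (η (A.const x)) ≋ const (η (A.const x)) Kτ.* u
      const-central u x .at k = begin
        coeff (u Kτ.* const c) k  ≈⟨ Kτ.coeff-*-const u c k ⟩
        coeff u k K.* iter k c  ≈⟨ K.*-congˡ (iter-const x k) ⟩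
        coeff u k K.* c  ≈⟨ K.*-comm _ _ ⟩
        c K.* coeff u k  ≈⟨ Kτ.coeff-scale c u k ⟨
        coeff (List.map (c K.*_) u) k  ≈⟨ Kτ.+-identityʳ (List.map (c K.*_) u) .at k ⟨
        coeff (const c Kτ.* u) k  ∎
        where
        open ≈-Reasoning K.setoid
        c = η (A.const x)

      ψᵏ-∷ : ∀ x f → ψᵏ (x ∷ f) ≋ const (η (A.const x)) Kτ.+ ψᵏ T Kτ.* ψᵏ f
      ψᵏ-∷ x f = ≋-trans (map-cong {ψ (x ∷ f)} {Lτ.const (F.ι (A.const x)) Lτ.+ ψ T Lτ.* ψ f} (ψ-∷ x f .Lτ.at))
        (≋-trans (map-+ (Lτ.const (F.ι (A.const x))) (ψ T Lτ.* ψ f)) (Kτ.+-congˡ (const (η (A.const x))) (map-* (ψ T) (ψ f))))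

      -- T generates A over 𝔽 and the constants from 𝔽 are central, so induction along Horner's rule
      -- extends the commutation from T to all of A.
      centralizes : ∀ u → u Kτ.* ψᵏ T ≋ ψᵏ T Kτ.* u → ∀ a → u Kτ.* ψᵏ a ≋ ψᵏ a Kτ.* u
      centralizes u uT [] = ≋-trans (Kτ.*-congˡ u (map-cong {ψ []} {[]} (ψ-[] .Lτ.at)))
        (≋-trans (Kτ.*-zeroʳ u) (≋-sym (Kτ.zero-* u (map-cong {ψ []} {[]} (ψ-[] .Lτ.at)))))
      centralizes u uT (x ∷ f) = begin
        u Kτ.* ψᵏ (x ∷ f)  ≈⟨ Kτ.*-congˡ u (ψᵏ-∷ x f) ⟩
        u Kτ.* (c Kτ.+ ψᵏ T Kτ.* ψᵏ f)  ≈⟨ Kτ.distribˡ u c (ψᵏ T Kτ.* ψᵏ f) ⟩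
        u Kτ.* c Kτ.+ u Kτ.* (ψᵏ T Kτ.* ψᵏ f)  ≈⟨ Kτ.+-cong (const-central u x) (≋-sym (Kτ.*-assoc u (ψᵏ T) (ψᵏ f))) ⟩
        c Kτ.* u Kτ.+ u Kτ.* ψᵏ T Kτ.* ψᵏ f  ≈⟨ Kτ.+-congˡ (c Kτ.* u) (Kτ.*-congʳ (ψᵏ f) uT) ⟩
        c Kτ.* u Kτ.+ ψᵏ T Kτ.* u Kτ.* ψᵏ f  ≈⟨ Kτ.+-congˡ (c Kτ.* u) (Kτ.*-assoc (ψᵏ T) u (ψᵏ f)) ⟩
        c Kτ.* u Kτ.+ ψᵏ T Kτ.* (u Kτ.* ψᵏ f)  ≈⟨ Kτ.+-congˡ (c Kτ.* u) (Kτ.*-congˡ (ψᵏ T) (centralizes u uT f)) ⟩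
        c Kτ.* u Kτ.+ ψᵏ T Kτ.* (ψᵏ f Kτ.* u)  ≈⟨ Kτ.+-congˡ (c Kτ.* u) (Kτ.*-assoc (ψᵏ T) (ψᵏ f) u) ⟨
        c Kτ.* u Kτ.+ ψᵏ T Kτ.* ψᵏ f Kτ.* u  ≈⟨ Kτ.distribʳ u c (ψᵏ T Kτ.* ψᵏ f) ⟨
        (c Kτ.+ ψᵏ T Kτ.* ψᵏ f) Kτ.* u  ≈⟨ Kτ.*-congʳ u (ψᵏ-∷ x f) ⟨
        ψᵏ (x ∷ f) Kτ.* u  ∎
        where
        open ≈-Reasoning Kτ.≋-setoid
        c = const (η (A.const x))

      √Δ : ∃ λ s → s K.* s K.≈ η Δ
      √Δ = let s , e = closed (K.- η Δ ∷ K.0# ∷ K.1# ∷ []) 1 (K.1≉0 , λ { (suc (suc (suc m))) _ → K.refl ; (suc zero) (ℕ.s≤s ()) ; (suc (suc zero)) (ℕ.s≤s (ℕ.s≤s ())) }) in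
        s , root s e
        where
        root : ∀ s → K.- η Δ K.+ s K.* (K.0# K.+ s K.* (K.1# K.+ s K.* K.0#)) K.≈ K.0# → s K.* s K.≈ η Δ
        root s e = K.trans (K.sym (K.trans (K.*-congˡ (K.+-identityˡ _)) (K.*-congˡ (K.trans (K.*-congˡ (K.trans (K.+-congˡ (K.zeroʳ s)) (K.+-identityʳ _))) (K.*-identityʳ s)))))
          (RingProperties.x∙y⁻¹≈ε⇒x≈y K.ring _ _ (K.trans (K.+-comm _ _) e))

      s : K.Carrier
      s = proj₁ √Δ

      open Recursion A.commutativeRing q A.h A.X B G₁ G₂ Δ using (N; M)
      private
        module Rec = Recursion KR q A.h (η A.X) (η B) (η G₁) (η G₂) (η Δ)
      open RecursionHomomorphism A.commutativeRing KR q A.h η.isRingHomomorphism A.X B G₁ G₂ Δ using (N-homo; M-homo)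

      M≉0 : ∀ k → Rec.M k K.≉ K.0#
      M≉0 k e = RecursionNonvanishing.M≉0 𝔽 q-odd B G₁ G₂ Δ B≉0 k (η.injective (K.trans (M-homo k) (K.trans e (K.sym η.0#-homo))))

      γ≈ : ∀ i G → Ψ.g i F.* F.ι B F.≈ F.ι G → embed (Ψ.g i) K.* η B K.≈ η G
      γ≈ i G e = K.trans (K.sym (embed.*-homo _ _)) (embed.⟦⟧-cong e)

      open RecursionOverField closure A.q≡1+2h (η A.X) (η B) (η G₁) (η G₂) (η Δ) {embed (Ψ.g 1)} {embed (Ψ.g 2)} {s}
        (γ≈ 1 G₁ g₁B≈G₁) (γ≈ 2 G₂ g₂B≈G₂) (proj₂ √Δ) M≉0

      module _ (n : ℕ) (N[2+n]≈0 : N (2 ℕ.+ n) A.≈ []) (N[3+n]≈0 : N (3 ℕ.+ n) A.≈ []) where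
        N≈0⇒w≈0 : ∀ k → N k A.≈ [] → w k K.≈ K.0#
        N≈0⇒w≈0 k e = w≈0 k (K.trans (K.sym (N-homo k)) (K.trans (η.⟦⟧-cong e) η.0#-homo))

        open Truncation KR q (ℕₚ.≤-trans (ℕ.s≤s ℕ.z≤n) A.2≤q) ^q-homᵏ (η A.X) (embed (Ψ.g 1)) (embed (Ψ.g 2)) w n
          (w≈0 0 K.refl) (N≈0⇒w≈0 (2 ℕ.+ n) N[2+n]≈0) (N≈0⇒w≈0 (3 ℕ.+ n) N[3+n]≈0) recurrence

        ψᵏT≋ : ψᵏ T ≋ η A.X ∷ embed (Ψ.g 1) ∷ embed (Ψ.g 2) ∷ []
        ψᵏT≋ = map-cong {ψ T} {F.ι T ∷ Ψ.g 1 ∷ Ψ.g 2 ∷ []} (ψT≋ .Lτ.at)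

        u-centralizes : ∀ a → u Kτ.* ψᵏ a ≋ ψᵏ a Kτ.* u
        u-centralizes = centralizes u (≋-trans (Kτ.*-congˡ u ψᵏT≋) (≋-trans commutes (Kτ.*-congʳ u (≋-sym ψᵏT≋))))

        -- The truncated solution is an endomorphism with constant coefficient s. Were it equal to
        -- `ψᵏ a`, comparison of constant coefficients would give s = η a, hence Δ = a² in A by the
        -- injectivity of η.
        recursion-terminates⇒⊥ : ⊥
        recursion-terminates⇒⊥ = let a , u≈ψᵏa = Equivalence.to (onlyScalar u) (λ a → u-centralizes a .at) in
          Δ-nonsquare a (square a (K.trans (K.sym w₁≈s) (K.trans (u≈ψᵏa 0) (K.trans (coeff-map (ψ a) 0) (embed.⟦⟧-cong (constant-coefficient a))))))
          where
          square : ∀ a → s K.≈ η a → Δ A.≈ a A.* a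
          square a s≈ηa = η.injective (K.trans (K.sym (proj₂ √Δ)) (K.trans (K.*-cong s≈ηa s≈ηa) (K.sym (η.*-homo a a))))

-- Rational estimates for log and log log.

module LogarithmBounds where
  open Reals
  open Q using (_<_; _≤_; _+_; _*_; _-_; -_)
  open Exp (CommutativeRing.commutativeSemiring ℚₚ.+-*-commutativeRing) using (^-assocʳ; ^-distrib-*; ^-homo-*)

  ⌞_⌟ : ℕ → ℚ
  ⌞ n ⌟ = + n Q./ 1

  ⌞⌟-toℚᵘ : ∀ n → Q.toℚᵘ ⌞ n ⌟ Qᵘ.≃ Qᵘ.mkℚᵘ (+ n) 0
  ⌞⌟-toℚᵘ n = ℚₚ.toℚᵘ-fromℚᵘ (Qᵘ.mkℚᵘ (+ n) 0)

  ⌞⌟-* : ∀ m n → ⌞ m ℕ.* n ⌟ ≡ ⌞ m ⌟ * ⌞ n ⌟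
  ⌞⌟-* m n = ℚₚ.toℚᵘ-injective (begin
    Q.toℚᵘ ⌞ m ℕ.* n ⌟  ≈⟨ ⌞⌟-toℚᵘ (m ℕ.* n) ⟩
    Qᵘ.mkℚᵘ (+ (m ℕ.* n)) 0  ≈⟨ Qᵘ.*≡* (≡.cong (ℤ._* + 1) (ℤₚ.pos-* m n)) ⟩
    Qᵘ.mkℚᵘ (+ m) 0 Qᵘ.* Qᵘ.mkℚᵘ (+ n) 0  ≈⟨ ℚᵘₚ.*-cong (⌞⌟-toℚᵘ m) (⌞⌟-toℚᵘ n) ⟨
    Q.toℚᵘ ⌞ m ⌟ Qᵘ.* Q.toℚᵘ ⌞ n ⌟  ≈⟨ ℚₚ.toℚᵘ-homo-* ⌞ m ⌟ ⌞ n ⌟ ⟨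
    Q.toℚᵘ (⌞ m ⌟ * ⌞ n ⌟)  ∎)
    where open ℚᵘₚ.≃-Reasoning

  ⌞⌟-suc : ∀ n → ⌞ suc n ⌟ ≡ 1ℚ + ⌞ n ⌟
  ⌞⌟-suc n = ℚₚ.toℚᵘ-injective (begin
    Q.toℚᵘ ⌞ suc n ⌟  ≈⟨ ⌞⌟-toℚᵘ (suc n) ⟩
    Qᵘ.mkℚᵘ (+ suc n) 0  ≈⟨ Qᵘ.*≡* (≡.cong (ℤ._* + 1) (≡.cong (ℤ._+_ (+ 1)) (≡.sym (ℤₚ.*-identityʳ (+ n))))) ⟩
    Q.toℚᵘ 1ℚ Qᵘ.+ Qᵘ.mkℚᵘ (+ n) 0  ≈⟨ ℚᵘₚ.+-congʳ (Q.toℚᵘ 1ℚ) (⌞⌟-toℚᵘ n) ⟨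
    Q.toℚᵘ 1ℚ Qᵘ.+ Q.toℚᵘ ⌞ n ⌟  ≈⟨ ℚₚ.toℚᵘ-homo-+ 1ℚ ⌞ n ⌟ ⟨
    Q.toℚᵘ (1ℚ + ⌞ n ⌟)  ∎)
    where open ℚᵘₚ.≃-Reasoning

  ⌞⌟-mono : ∀ {m n} → m ℕ.≤ n → ⌞ m ⌟ ≤ ⌞ n ⌟
  ⌞⌟-mono = /1-mono

  0≤⌞⌟ : ∀ n → 0ℚ ≤ ⌞ n ⌟
  0≤⌞⌟ n = ⌞⌟-mono {0} {n} ℕ.z≤n

  ⌞⌟-^ : ∀ m n → ⌞ m ℕ.^ n ⌟ ≡ ⌞ m ⌟ ^ℚ n
  ⌞⌟-^ m zero    = ≡.refl
  ⌞⌟-^ m (suc n) = ≡.trans (⌞⌟-* m (m ℕ.^ n)) (≡.cong (⌞ m ⌟ *_) (⌞⌟-^ m n))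

  0<1 : 0ℚ < 1ℚ
  0<1 = from-yes (0ℚ ℚₚ.<? 1ℚ)

  0≤1 : 0ℚ ≤ 1ℚ
  0≤1 = from-yes (0ℚ ℚₚ.≤? 1ℚ)

  ·ℚ≡* : ∀ n u → n ·ℚ u ≡ ⌞ n ⌟ * u
  ·ℚ≡* zero    u = ≡.sym (ℚₚ.*-zeroˡ u)
  ·ℚ≡* (suc n) u = ≡.trans (≡.cong₂ _+_ (≡.sym (ℚₚ.*-identityˡ u)) (·ℚ≡* n u))
    (≡.trans (≡.sym (ℚₚ.*-distribʳ-+ u 1ℚ ⌞ n ⌟)) (≡.cong (_* u) (≡.sym (⌞⌟-suc n))))

  *-monoʳ-≤ : ∀ {a b c} → 0ℚ ≤ a → b ≤ c → a * b ≤ a * c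
  *-monoʳ-≤ {a} 0≤a = ℚₚ.*-monoˡ-≤-nonNeg a {{Q.nonNegative 0≤a}}

  *-monoˡ-≤ : ∀ {a b c} → 0ℚ ≤ a → b ≤ c → b * a ≤ c * a
  *-monoˡ-≤ {a} 0≤a = ℚₚ.*-monoʳ-≤-nonNeg a {{Q.nonNegative 0≤a}}

  *-mono-≤ : ∀ {a b c d} → 0ℚ ≤ a → 0ℚ ≤ d → a ≤ b → c ≤ d → a * c ≤ b * d
  *-mono-≤ 0≤a 0≤d a≤b c≤d = ℚₚ.≤-trans (*-monoʳ-≤ 0≤a c≤d) (*-monoˡ-≤ 0≤d a≤b)

  0≤* : ∀ {a b} → 0ℚ ≤ a → 0ℚ ≤ b → 0ℚ ≤ a * b
  0≤* {a} {b} 0≤a 0≤b = ≡.subst (_≤ a * b) (ℚₚ.*-zeroʳ a) (*-monoʳ-≤ 0≤a 0≤b)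

  0≤^ : ∀ {x} n → 0ℚ ≤ x → 0ℚ ≤ x ^ℚ n
  0≤^ zero    0≤x = 0≤1
  0≤^ (suc n) 0≤x = 0≤* 0≤x (0≤^ n 0≤x)

  ^-mono-≤ : ∀ {x y} n → 0ℚ ≤ x → x ≤ y → x ^ℚ n ≤ y ^ℚ n
  ^-mono-≤ zero    0≤x x≤y = ℚₚ.≤-refl
  ^-mono-≤ (suc n) 0≤x x≤y = *-mono-≤ 0≤x (0≤^ n (ℚₚ.≤-trans 0≤x x≤y)) x≤y (^-mono-≤ n 0≤x x≤y)

  1^ : ∀ n → 1ℚ ^ℚ n ≡ 1ℚ
  1^ zero    = ≡.refl
  1^ (suc n) = ≡.trans (ℚₚ.*-identityˡ _) (1^ n)

  1≤^ : ∀ {x} n → 1ℚ ≤ x → 1ℚ ≤ x ^ℚ n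
  1≤^ {x} n 1≤x = ≡.subst (_≤ x ^ℚ n) (1^ n) (^-mono-≤ n 0≤1 1≤x)

  ^≤1 : ∀ {x} n → 0ℚ ≤ x → x ≤ 1ℚ → x ^ℚ n ≤ 1ℚ
  ^≤1 {x} n 0≤x x≤1 = ≡.subst (x ^ℚ n ≤_) (1^ n) (^-mono-≤ n 0≤x x≤1)

  1≤^⇒1≤ : ∀ {x} n → 0ℚ ≤ x → 1ℚ ≤ x ^ℚ suc n → 1ℚ ≤ x
  1≤^⇒1≤ {x} n 0≤x 1≤x^ = ℚₚ.≮⇒≥ λ x<1 → ℚₚ.<-irrefl ≡.refl (ℚₚ.≤-<-trans 1≤x^
    (ℚₚ.≤-<-trans (≡.subst (x * x ^ℚ n ≤_) (ℚₚ.*-identityʳ x) (*-monoʳ-≤ 0≤x (^≤1 n 0≤x (ℚₚ.<⇒≤ x<1)))) x<1))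

  module _ (q : ℕ) (3≤q : 3 ℕ.≤ q) where

    -- If m u < log q^d is witnessed by q^d (1 - u)^m ≥ 1, write m = r + j d: then
    -- q (1 - u)^j ≥ 1, hence 1 + j u ≤ q by Bernoulli.
    log-upper : ∀ d → 1 ℕ.≤ d → ∀ {N} → N ≡ q ℕ.^ d → (3≤N : 3 ℕ.≤ N) → ∀ {x} → real (logℕ N 3≤N) ∋ x → x ≤ ⌞ d ℕ.* q ⌟
    log-upper d@(suc d-1) 1≤d ≡.refl 3≤N {x} (m , u , a , x<mu , 0<1-u , a<q^d , 1≤at) = ℚₚ.≤-trans (ℚₚ.<⇒≤ x<mu) mu≤dq
      where
      t = 1ℚ - u
      j = m / d
      0≤t = ℚₚ.<⇒≤ 0<1-u

      m≤[1+j]d : m ℕ.≤ suc j ℕ.* d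
      m≤[1+j]d = ≡.subst (ℕ._≤ suc j ℕ.* d) (≡.sym (m≡m%n+[m/n]*n m d)) (ℕₚ.+-monoˡ-≤ (j ℕ.* d) (ℕₚ.<⇒≤ (m%n<n m d)))

      mu≤dq : m ·ℚ u ≤ ⌞ d ℕ.* q ⌟
      mu≤dq with ℚₚ.≤-total u 0ℚ
      ... | inj₁ u≤0 = ℚₚ.≤-trans (≡.subst₂ _≤_ (≡.sym (·ℚ≡* m u)) (ℚₚ.*-zeroʳ ⌞ m ⌟) (*-monoʳ-≤ (0≤⌞⌟ m) u≤0)) (0≤⌞⌟ (d ℕ.* q))
      ... | inj₂ 0≤u = begin
        m ·ℚ u  ≡⟨ ·ℚ≡* m u ⟩
        ⌞ m ⌟ * u  ≤⟨ *-monoˡ-≤ 0≤u (⌞⌟-mono m≤[1+j]d) ⟩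
        ⌞ suc j ℕ.* d ⌟ * u  ≡⟨ ≡.cong (_* u) (≡.trans (⌞⌟-* (suc j) d) (≡.cong (_* ⌞ d ⌟) (⌞⌟-suc j))) ⟩
        (1ℚ + ⌞ j ⌟) * ⌞ d ⌟ * u  ≡⟨ solve 3 (λ j d u → (con 1ℚ :+ j) :* d :* u := d :* (u :+ j :* u)) ≡.refl ⌞ j ⌟ ⌞ d ⌟ u ⟩
        ⌞ d ⌟ * (u + ⌞ j ⌟ * u)  ≤⟨ *-monoʳ-≤ (0≤⌞⌟ d) (ℚₚ.+-monoˡ-≤ (⌞ j ⌟ * u) u≤1) ⟩
        ⌞ d ⌟ * (1ℚ + ⌞ j ⌟ * u)  ≡⟨ ≡.cong (λ z → ⌞ d ⌟ * (1ℚ + z)) (·ℚ≡* j u) ⟨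
        ⌞ d ⌟ * (1ℚ + j ·ℚ u)  ≤⟨ *-monoʳ-≤ (0≤⌞⌟ d) 1+ju≤q ⟩
        ⌞ d ⌟ * ⌞ q ⌟  ≡⟨ ⌞⌟-* d q ⟨
        ⌞ d ℕ.* q ⌟  ∎
        where
        open ℚₚ.≤-Reasoning
        open +-*-Solver

        u≤1 : u ≤ 1ℚ
        u≤1 = ℚₚ.<⇒≤ (≡.subst₂ _<_ (ℚₚ.+-identityˡ u) (solve 1 (λ u → con 1ℚ :- u :+ u := con 1ℚ) ≡.refl u) (ℚₚ.+-monoˡ-< u 0<1-u))

        t≤1 : t ≤ 1ℚ
        t≤1 = ≡.subst (t ≤_) (ℚₚ.+-identityʳ 1ℚ) (ℚₚ.+-monoʳ-≤ 1ℚ (ℚₚ.neg-antimono-≤ 0≤u))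

        t^m≤[t^j]^d : t ^ℚ m ≤ (t ^ℚ j) ^ℚ d
        t^m≤[t^j]^d = begin
          t ^ℚ m  ≡⟨ ≡.cong (t ^ℚ_) (m≡m%n+[m/n]*n m d) ⟩
          t ^ℚ (m % d ℕ.+ j ℕ.* d)  ≡⟨ ^-homo-* t (m % d) (j ℕ.* d) ⟩
          t ^ℚ (m % d) * t ^ℚ (j ℕ.* d)  ≤⟨ *-monoˡ-≤ (0≤^ (j ℕ.* d) 0≤t) (^≤1 (m % d) 0≤t t≤1) ⟩
          1ℚ * t ^ℚ (j ℕ.* d)  ≡⟨ ℚₚ.*-identityˡ _ ⟩
          t ^ℚ (j ℕ.* d)  ≡⟨ ^-assocʳ t j d ⟨
          (t ^ℚ j) ^ℚ d  ∎

        1≤qt^j : 1ℚ ≤ ⌞ q ⌟ * t ^ℚ j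
        1≤qt^j = 1≤^⇒1≤ d-1 (0≤* (0≤⌞⌟ q) (0≤^ j 0≤t)) (begin
          1ℚ  ≤⟨ 1≤at ⟩
          a * t ^ℚ m  ≤⟨ *-monoˡ-≤ (0≤^ m 0≤t) (ℚₚ.<⇒≤ a<q^d) ⟩
          ⌞ q ℕ.^ d ⌟ * t ^ℚ m  ≤⟨ *-monoʳ-≤ (0≤⌞⌟ (q ℕ.^ d)) t^m≤[t^j]^d ⟩
          ⌞ q ℕ.^ d ⌟ * (t ^ℚ j) ^ℚ d  ≡⟨ ≡.cong (_* (t ^ℚ j) ^ℚ d) (⌞⌟-^ q d) ⟩
          ⌞ q ⌟ ^ℚ d * (t ^ℚ j) ^ℚ d  ≡⟨ ^-distrib-* ⌞ q ⌟ (t ^ℚ j) d ⟨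
          (⌞ q ⌟ * t ^ℚ j) ^ℚ d  ∎)

        0≤1+ju : 0ℚ ≤ 1ℚ + j ·ℚ u
        0≤1+ju = ≡.subst (λ z → 0ℚ ≤ 1ℚ + z) (≡.sym (·ℚ≡* j u)) (ℚₚ.+-mono-≤ 0≤1 (0≤* (0≤⌞⌟ j) 0≤u))

        1+ju≤q : 1ℚ + j ·ℚ u ≤ ⌞ q ⌟
        1+ju≤q = begin
          1ℚ + j ·ℚ u  ≡⟨ ℚₚ.*-identityˡ _ ⟨
          1ℚ * (1ℚ + j ·ℚ u)  ≤⟨ *-monoˡ-≤ 0≤1+ju 1≤qt^j ⟩
          ⌞ q ⌟ * t ^ℚ j * (1ℚ + j ·ℚ u)  ≡⟨ ℚₚ.*-assoc ⌞ q ⌟ (t ^ℚ j) _ ⟩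
          ⌞ q ⌟ * (t ^ℚ j * (1ℚ + j ·ℚ u))  ≤⟨ *-monoʳ-≤ (0≤⌞⌟ q) (bernoulli 0<1-u j) ⟩
          ⌞ q ⌟ * 1ℚ  ≡⟨ ℚₚ.*-identityʳ ⌞ q ⌟ ⟩
          ⌞ q ⌟  ∎

    -- The integer part of the logarithm of d to base q. As log |p| = d log q, the number e + 1
    -- takes the place of log log |p| up to constants.
    logarithm : ∀ d → 1 ℕ.≤ d → ∃ λ e → q ℕ.^ e ℕ.≤ d × d ℕ.< q ℕ.^ suc e
    logarithm 1 _ = 0 , ℕₚ.≤-refl , ≡.subst (2 ℕ.≤_) (≡.sym (ℕₚ.*-identityʳ q)) (ℕₚ.≤-trans (ℕₚ.n≤1+n 2) 3≤q)
    logarithm (suc d@(suc _)) _ with logarithm d (ℕ.s≤s ℕ.z≤n)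
    ... | e , q^e≤d , d<q^[1+e] with suc d ℕₚ.<? q ℕ.^ suc e
    ...   | yes d+1<q^[1+e] = e , ℕₚ.m≤n⇒m≤1+n q^e≤d , d+1<q^[1+e]
    ...   | no  d+1≮q^[1+e] = suc e , ℕₚ.≮⇒≥ d+1≮q^[1+e] , ℕₚ.≤-<-trans d<q^[1+e]
      (≡.subst (ℕ._< q ℕ.^ suc (suc e)) (ℕₚ.*-identityˡ (q ℕ.^ suc e)) (ℕₚ.*-monoˡ-< (q ℕ.^ suc e) {{ℕₚ.m^n≢0 q (suc e) {{q≢0}}}} (ℕₚ.≤-trans (ℕₚ.n≤1+n 2) 3≤q)))
      where
      q≢0 = ℕ.>-nonZero (ℕₚ.≤-trans (ℕ.s≤s ℕ.z≤n) 3≤q)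

    -- The hypotheses on w and u₁ certify c < log 3 through (1 - u₁)⁻²¹ ≤ w < 3. Those on u₂ say
    -- that (1 - u₂)⁻¹ is at most c and at most 3, which yields u₂ as a lower bound for log c and
    -- log 3; z₀ lies strictly below u₂ because cuts are open, and k is the inverse square of z₀.
    module Constants (w u₁ c u₂ z₀ : ℚ)
      (0<w : 0ℚ < w) (w<3 : w < ⌞ 3 ⌟) (0<1-u₁ : 0ℚ < 1ℚ - u₁) (1≤w[1-u₁]²¹ : 1ℚ ≤ w * (1ℚ - u₁) ^ℚ 21) (c<21u₁ : c < ⌞ 21 ⌟ * u₁)
      (0≤c : 0ℚ ≤ c) (0<1-u₂ : 0ℚ < 1ℚ - u₂) (1≤c[1-u₂] : 1ℚ ≤ c * (1ℚ - u₂)) (1≤3[1-u₂] : 1ℚ ≤ ⌞ 3 ⌟ * (1ℚ - u₂))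
      (0<z₀ : 0ℚ < z₀) (z₀<u₂ : z₀ < u₂) (k : ℕ) (1≤k : 1 ℕ.≤ k) (kz₀²≡1 : ⌞ k ⌟ * (z₀ * z₀) ≡ 1ℚ)
      where

      -- The d-th power of the certificate for log 3 serves as a certificate for log q^d, since w <
      -- 3 ≤ q.
      log-lower : ∀ d → 1 ℕ.≤ d → ∀ {N} → N ≡ q ℕ.^ d → (3≤N : 3 ℕ.≤ N) → real (logℕ N 3≤N) ∋ ⌞ d ⌟ * c
      log-lower d@(suc d-1) 1≤d ≡.refl 3≤N =
        d ℕ.* 21 , u₁ , w ^ℚ d , <du , 0<1-u₁ , <q^d , 1≤
        where
        open ℚₚ.≤-Reasoning
        0<d : 0ℚ < ⌞ d ⌟
        0<d = ℚₚ.<-≤-trans 0<1 (⌞⌟-mono 1≤d)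
        <du : ⌞ d ⌟ * c < (d ℕ.* 21) ·ℚ u₁
        <du = begin-strict
          ⌞ d ⌟ * c  <⟨ ℚₚ.*-monoʳ-<-pos ⌞ d ⌟ {{Q.positive 0<d}} c<21u₁ ⟩
          ⌞ d ⌟ * (⌞ 21 ⌟ * u₁)  ≡⟨ ℚₚ.*-assoc ⌞ d ⌟ ⌞ 21 ⌟ _ ⟨
          ⌞ d ⌟ * ⌞ 21 ⌟ * u₁  ≡⟨ ≡.cong (_* u₁) (⌞⌟-* d 21) ⟨
          ⌞ d ℕ.* 21 ⌟ * u₁  ≡⟨ ·ℚ≡* (d ℕ.* 21) _ ⟨
          (d ℕ.* 21) ·ℚ u₁  ∎
        w<q : w < ⌞ q ⌟
        w<q = ℚₚ.<-≤-trans w<3 (⌞⌟-mono 3≤q)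
        <q^d : w ^ℚ d < ⌞ q ℕ.^ d ⌟
        <q^d = begin-strict
          w * w ^ℚ d-1  <⟨ ℚₚ.*-monoˡ-<-pos _ {{Q.positive (^ℚ-pos 0<w d-1)}} w<q ⟩
          ⌞ q ⌟ * w ^ℚ d-1  ≤⟨ *-monoʳ-≤ (0≤⌞⌟ q) (^-mono-≤ d-1 (ℚₚ.<⇒≤ 0<w) (ℚₚ.<⇒≤ w<q)) ⟩
          ⌞ q ⌟ * ⌞ q ⌟ ^ℚ d-1  ≡⟨ ⌞⌟-^ q d ⟨
          ⌞ q ℕ.^ d ⌟  ∎
        1≤ : 1ℚ ≤ w ^ℚ d * (1ℚ - u₁) ^ℚ (d ℕ.* 21)
        1≤ = begin
          1ℚ  ≤⟨ 1≤^ d 1≤w[1-u₁]²¹ ⟩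
          (w * (1ℚ - u₁) ^ℚ 21) ^ℚ d  ≡⟨ ^-distrib-* w _ d ⟩
          w ^ℚ d * ((1ℚ - u₁) ^ℚ 21) ^ℚ d  ≡⟨ ≡.cong (w ^ℚ d *_) (≡.trans (^-assocʳ (1ℚ - u₁) 21 d) (≡.cong ((1ℚ - u₁) ^ℚ_) (ℕₚ.*-comm 21 d))) ⟩
          w ^ℚ d * (1ℚ - u₁) ^ℚ (d ℕ.* 21)  ∎

      -- The bound log q^d > d c with d ≥ 3^e supplies e factors 3 and one factor c, each at least
      -- (1 - u₂)⁻¹. The factor c gives the multiple e + 1 in place of e, so that the bound stays
      -- positive for e = 0.
      loglog-lower : ∀ d e → 3 ℕ.^ e ℕ.≤ d → ∀ {N} → N ≡ q ℕ.^ d → (3≤N : 3 ℕ.≤ N) → real (loglogℕ N 3≤N) ∋ ⌞ suc e ⌟ * z₀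
      loglog-lower d e 3^e≤d N≡ 3≤N =
        suc e , u₂ , ⌞ d ⌟ * c , <eu , 0<1-u₂ , log-lower d (ℕₚ.≤-trans (ℕₚ.m^n>0 3 e) 3^e≤d) N≡ 3≤N , 1≤
        where
        open ℚₚ.≤-Reasoning
        v = 1ℚ - u₂
        <eu : ⌞ suc e ⌟ * z₀ < suc e ·ℚ u₂
        <eu = begin-strict
          ⌞ suc e ⌟ * z₀  <⟨ ℚₚ.*-monoʳ-<-pos ⌞ suc e ⌟ {{Q.positive (ℚₚ.<-≤-trans 0<1 (⌞⌟-mono {1} {suc e} (ℕ.s≤s ℕ.z≤n)))}} z₀<u₂ ⟩
          ⌞ suc e ⌟ * u₂  ≡⟨ ·ℚ≡* (suc e) _ ⟨
          suc e ·ℚ u₂  ∎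
        0≤v : 0ℚ ≤ v
        0≤v = ℚₚ.<⇒≤ 0<1-u₂
        1≤ : 1ℚ ≤ ⌞ d ⌟ * c * v ^ℚ suc e
        1≤ = begin
          1ℚ  ≤⟨ 1≤c[1-u₂] ⟩
          c * v  ≡⟨ ℚₚ.*-identityˡ _ ⟨
          1ℚ * (c * v)  ≤⟨ *-monoˡ-≤ (0≤* 0≤c 0≤v) (1≤^ e 1≤3[1-u₂]) ⟩
          (⌞ 3 ⌟ * v) ^ℚ e * (c * v)  ≡⟨ ≡.cong (_* (c * v)) (≡.trans (^-distrib-* ⌞ 3 ⌟ v e) (≡.cong (_* v ^ℚ e) (≡.sym (⌞⌟-^ 3 e)))) ⟩
          ⌞ 3 ℕ.^ e ⌟ * v ^ℚ e * (c * v)  ≤⟨ *-monoˡ-≤ (0≤* 0≤c 0≤v) (*-monoˡ-≤ (0≤^ e 0≤v) (⌞⌟-mono 3^e≤d)) ⟩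
          ⌞ d ⌟ * v ^ℚ e * (c * v)  ≡⟨ rearrange′ ⌞ d ⌟ (v ^ℚ e) c v ⟩
          ⌞ d ⌟ * c * v ^ℚ suc e  ∎
          where
          open +-*-Solver
          rearrange′ : ∀ d w c v → d * w * (c * v) ≡ d * c * (v * w)
          rearrange′ = solve 4 (λ d w c v → d :* w :* (c :* v) := d :* c :* (v :* w)) ≡.refl

      module _ (K : ℕ) (1≤K : 1 ℕ.≤ K) where
        -- K comes from the degree bound, q from log q^d ≤ d q, and k compensates the factor z₀²
        -- lost in the lower bound for (log log)².
        constant : ℕ
        constant = k ℕ.* (q ℕ.* K)

        1≤constant : 1 ℕ.≤ constant
        1≤constant = ℕₚ.*-mono-≤ 1≤k (ℕₚ.*-mono-≤ (ℕₚ.≤-trans (ℕ.s≤s ℕ.z≤n) 3≤q) 1≤K)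

        0<constant : 0ℚ < ⌞ constant ⌟
        0<constant = ℚₚ.<-≤-trans 0<1 (⌞⌟-mono 1≤constant)

        C : ℝ⁺
        C = record
          { real     = fromℚ (proj₁ (1/⁺ 0<constant))
          ; positive = 0ℚ , proj₁ (proj₂ (1/⁺ 0<constant)) , ℚₚ.<-irrefl ≡.refl }

        -- A member r of the left side comes with a < C, with x below log q^d and y above (log log
        -- q^d)² such that b y < x, and with r < a b. If q^n ≤ r, then d q ≤ constant q^n y ≤
        -- constant a (b y) < d q, since x ≤ d q and constant a < 1.
        real-bound : ∀ d n → d ℕ.≤ K ℕ.* (suc n ℕ.* suc n) ℕ.* q ℕ.^ n → ∀ {N} → N ≡ q ℕ.^ d → (3≤N : 3 ℕ.≤ N) →
          real (C *⁺ (logℕ N 3≤N /⁺ (loglogℕ N 3≤N *⁺ loglogℕ N 3≤N))) ≤ℝ fromℕ (q ℕ.^ n)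
        real-bound zero n d≤ ≡.refl (ℕ.s≤s ())
        real-bound d@(suc _) n d≤ N≡ 3≤N r (a , b , (0<a , a<C) , (0<b , x , y , x∈ , (0<y , y∉) , by<x) , r<ab) =
          ℚₚ.≰⇒> λ q^n≤r → ℚₚ.<-irrefl ≡.refl (begin-strict
            ⌞ d ℕ.* q ⌟  ≤⟨ dq≤ ⟩
            ⌞ constant ⌟ * (⌞ q ℕ.^ n ⌟ * y)  ≤⟨ *-monoʳ-≤ (ℚₚ.<⇒≤ 0<constant) (*-monoˡ-≤ (ℚₚ.<⇒≤ 0<y) (ℚₚ.≤-trans q^n≤r (ℚₚ.<⇒≤ r<ab))) ⟩
            ⌞ constant ⌟ * (a * b * y)  ≡⟨ ≡.trans (≡.cong (⌞ constant ⌟ *_) (ℚₚ.*-assoc a b y)) (≡.sym (ℚₚ.*-assoc ⌞ constant ⌟ a (b * y))) ⟩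
            ⌞ constant ⌟ * a * (b * y)  ≤⟨ *-monoʳ-≤ (0≤* (ℚₚ.<⇒≤ 0<constant) (ℚₚ.<⇒≤ 0<a)) (ℚₚ.≤-trans (ℚₚ.<⇒≤ by<x) x≤dq) ⟩
            ⌞ constant ⌟ * a * ⌞ d ℕ.* q ⌟  <⟨ ℚₚ.*-monoˡ-<-pos ⌞ d ℕ.* q ⌟ {{Q.positive 0<dq}} Ka<1 ⟩
            1ℚ * ⌞ d ℕ.* q ⌟  ≡⟨ ℚₚ.*-identityˡ _ ⟩
            ⌞ d ℕ.* q ⌟  ∎)
          where
          open ℚₚ.≤-Reasoning
          1≤d : 1 ℕ.≤ d
          1≤d = ℕ.s≤s ℕ.z≤n
          q≢0 = ℕ.>-nonZero (ℕₚ.≤-trans (ℕ.s≤s ℕ.z≤n) 3≤q)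
          e = proj₁ (logarithm d 1≤d)
          q^e≤d = proj₁ (proj₂ (logarithm d 1≤d))
          d<q^[1+e] = proj₂ (proj₂ (logarithm d 1≤d))
          z = ⌞ suc e ⌟ * z₀

          x≤dq : x ≤ ⌞ d ℕ.* q ⌟
          x≤dq = log-upper d 1≤d N≡ 3≤N x∈

          0<dq : 0ℚ < ⌞ d ℕ.* q ⌟
          0<dq = ℚₚ.<-≤-trans 0<1 (⌞⌟-mono {1} (ℕₚ.*-mono-≤ 1≤d (ℕₚ.≤-trans (ℕ.s≤s ℕ.z≤n) 3≤q)))

          Ka<1 : ⌞ constant ⌟ * a < 1ℚ
          Ka<1 = ≡.subst (⌞ constant ⌟ * a <_) (≡.trans (ℚₚ.*-comm ⌞ constant ⌟ _) (proj₂ (proj₂ (1/⁺ 0<constant))))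
            (ℚₚ.*-monoʳ-<-pos ⌞ constant ⌟ {{Q.positive 0<constant}} a<C)

          0<z : 0ℚ < z
          0<z = *-pos (ℚₚ.<-≤-trans 0<1 (⌞⌟-mono {1} {suc e} (ℕ.s≤s ℕ.z≤n))) 0<z₀

          z∈ : real (loglogℕ _ 3≤N) ∋ z
          z∈ = loglog-lower d e (ℕₚ.≤-trans (ℕₚ.^-monoˡ-≤ e 3≤q) q^e≤d) N≡ 3≤N

          z²≤y : z * z ≤ y
          z²≤y = ℚₚ.≮⇒≥ λ y<z² → y∉ (z , z , (0<z , z∈) , (0<z , z∈) , y<z²)

          -- The unknown n in the polynomial factor is traded for e: either n ≤ e, or n ≥ e + 1 and
          -- then q^n alone exceeds d.
          d≤′ : d ℕ.≤ K ℕ.* (suc e ℕ.* suc e) ℕ.* q ℕ.^ n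
          d≤′ with n ℕₚ.≤? e
          ... | yes n≤e = ℕₚ.≤-trans d≤ (ℕₚ.*-monoˡ-≤ (q ℕ.^ n) (ℕₚ.*-monoʳ-≤ K (ℕₚ.*-mono-≤ (ℕ.s≤s n≤e) (ℕ.s≤s n≤e))))
          ... | no  n≰e = ℕₚ.≤-trans (ℕₚ.<⇒≤ d<q^[1+e]) (ℕₚ.≤-trans (ℕₚ.^-monoʳ-≤ q {{q≢0}} (ℕₚ.≰⇒> n≰e))
            (ℕₚ.m≤n*m (q ℕ.^ n) (K ℕ.* (suc e ℕ.* suc e)) {{ℕ.>-nonZero (ℕₚ.*-mono-≤ 1≤K (ℕₚ.*-mono-≤ {1} {suc e} {1} {suc e} (ℕ.s≤s ℕ.z≤n) (ℕ.s≤s ℕ.z≤n)))}}))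

          dq≤ : ⌞ d ℕ.* q ⌟ ≤ ⌞ constant ⌟ * (⌞ q ℕ.^ n ⌟ * y)
          dq≤ = begin
            ⌞ d ℕ.* q ⌟  ≤⟨ ⌞⌟-mono (ℕₚ.*-monoˡ-≤ q d≤′) ⟩
            ⌞ K ℕ.* (suc e ℕ.* suc e) ℕ.* q ℕ.^ n ℕ.* q ⌟  ≡⟨ ≡.cong ⌞_⌟ (ℕS.solve 4 (λ K e Q q → K ℕS.:* (e ℕS.:* e) ℕS.:* Q ℕS.:* q ℕS.:= q ℕS.:* K ℕS.:* (Q ℕS.:* (e ℕS.:* e))) ≡.refl K (suc e) (q ℕ.^ n) q) ⟩
            ⌞ q ℕ.* K ℕ.* (q ℕ.^ n ℕ.* (suc e ℕ.* suc e)) ⌟  ≡⟨ ≡.trans (⌞⌟-* (q ℕ.* K) _) (≡.cong (⌞ q ℕ.* K ⌟ *_) (≡.trans (⌞⌟-* (q ℕ.^ n) _) (≡.cong (⌞ q ℕ.^ n ⌟ *_) (⌞⌟-* (suc e) (suc e))))) ⟩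
            ⌞ q ℕ.* K ⌟ * (⌞ q ℕ.^ n ⌟ * (⌞ suc e ⌟ * ⌞ suc e ⌟))  ≡⟨ scale ⌞ q ℕ.* K ⌟ ⌞ q ℕ.^ n ⌟ ⌞ suc e ⌟ ⟩
            ⌞ k ⌟ * ⌞ q ℕ.* K ⌟ * (⌞ q ℕ.^ n ⌟ * (z * z))  ≡⟨ ≡.cong (_* (⌞ q ℕ.^ n ⌟ * (z * z))) (⌞⌟-* k (q ℕ.* K)) ⟨
            ⌞ constant ⌟ * (⌞ q ℕ.^ n ⌟ * (z * z))  ≤⟨ *-monoʳ-≤ (ℚₚ.<⇒≤ 0<constant) (*-monoʳ-≤ (0≤⌞⌟ (q ℕ.^ n)) z²≤y) ⟩
            ⌞ constant ⌟ * (⌞ q ℕ.^ n ⌟ * y)  ∎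
            where
            module ℕS = ℕSolver.+-*-Solver
            open +-*-Solver
            scale : ∀ K Q e → K * (Q * (e * e)) ≡ ⌞ k ⌟ * K * (Q * ((e * z₀) * (e * z₀)))
            scale K Q e = ≡.trans (≡.sym (ℚₚ.*-identityˡ _)) (≡.trans (≡.cong (_* (K * (Q * (e * e)))) (≡.sym kz₀²≡1))
              (solve 5 (λ N z K Q e → N :* (z :* z) :* (K :* (Q :* (e :* e))) := N :* K :* (Q :* ((e :* z) :* (e :* z)))) ≡.refl ⌞ k ⌟ z₀ K Q e))

      log-quotient-bound′ : ∀ K → 1 ℕ.≤ K → ∃ λ C → ∀ d n → d ℕ.≤ K ℕ.* (suc n ℕ.* suc n) ℕ.* q ℕ.^ n → ∀ {N} → N ≡ q ℕ.^ d → (3≤N : 3 ℕ.≤ N) →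
        real (C *⁺ (logℕ N 3≤N /⁺ (loglogℕ N 3≤N *⁺ loglogℕ N 3≤N))) ≤ℝ fromℕ (q ℕ.^ n)
      log-quotient-bound′ K 1≤K = C K 1≤K , real-bound K 1≤K

    -- log 3 ≥ 21/20 > 26/25, because (59/20) (19/20)²¹ ≥ 1.
    log-quotient-bound : ∀ K → 1 ℕ.≤ K → ∃ λ C → ∀ d n → d ℕ.≤ K ℕ.* (suc n ℕ.* suc n) ℕ.* q ℕ.^ n → ∀ {N} → N ≡ q ℕ.^ d → (3≤N : 3 ℕ.≤ N) →
      real (C *⁺ (logℕ N 3≤N /⁺ (loglogℕ N 3≤N *⁺ loglogℕ N 3≤N))) ≤ℝ fromℕ (q ℕ.^ n)
    log-quotient-bound = Constants.log-quotient-bound′ (+ 59 Q./ 20) (+ 1 Q./ 20) (+ 26 Q./ 25) (+ 1 Q./ 30) (+ 1 Q./ 31)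
      (from-yes (0ℚ ℚₚ.<? + 59 Q./ 20)) (from-yes (+ 59 Q./ 20 ℚₚ.<? + 3 Q./ 1)) (from-yes (0ℚ ℚₚ.<? 1ℚ - + 1 Q./ 20))
      (from-yes (1ℚ ℚₚ.≤? + 59 Q./ 20 * (1ℚ - + 1 Q./ 20) ^ℚ 21)) (from-yes (+ 26 Q./ 25 ℚₚ.<? + 21 Q./ 1 * (+ 1 Q./ 20)))
      (from-yes (0ℚ ℚₚ.≤? + 26 Q./ 25)) (from-yes (0ℚ ℚₚ.<? 1ℚ - + 1 Q./ 30)) (from-yes (1ℚ ℚₚ.≤? + 26 Q./ 25 * (1ℚ - + 1 Q./ 30)))
      (from-yes (1ℚ ℚₚ.≤? + 3 Q./ 1 * (1ℚ - + 1 Q./ 30))) (from-yes (0ℚ ℚₚ.<? + 1 Q./ 31)) (from-yes (+ 1 Q./ 31 ℚₚ.<? + 1 Q./ 30))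
      961 (ℕ.s≤s ℕ.z≤n) (from-yes (+ 961 Q./ 1 * (+ 1 Q./ 31 * (+ 1 Q./ 31)) ℚₚ.≟ 1ℚ))

-- The bound for deg p in terms of deg Δ, and the theorem.

module _ {cℓ ℓ q} (𝔽 : FiniteField cℓ ℓ q) (q-odd : OddPrimePower q) {c′ ℓ′} (F : FunctionField.FractionField 𝔽 c′ ℓ′) where
  private module A = PolynomialsOverFiniteField 𝔽 q-odd
  open FunctionField 𝔽 hiding (module A)
  private module F = FractionField F

  -- Only the coefficients of `ψ_T` are parameters here: the constant has to be fixed before the
  -- Drinfeld module, the closure and the prime are given.
  module DiscriminantBound (g₁ g₂ : F.Carrier) where
    private
      module ι = RingMorphisms.IsRingMonomorphism F.isEmbedding

    record CommonDenominator : Set (cℓ ⊔ ℓ ⊔ ℓ′) where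
      field
        B G₁ G₂ : A.Poly
        B≉0     : ¬ B A.≈ []
        g₁B≈G₁  : g₁ F.* F.ι B F.≈ F.ι G₁
        g₂B≈G₂  : g₂ F.* F.ι B F.≈ F.ι G₂
        b       : ℕ
        degB    : A.Degree≤ B b
        degG₁   : A.Degree≤ G₁ b
        degG₂   : A.Degree≤ G₂ b

    commonDenominator : CommonDenominator
    commonDenominator = build (F.fraction g₁) (F.fraction g₂)
      where
      ι≉0 : ∀ b → F.ι b F.≉ F.0# → ¬ b A.≈ []
      ι≉0 b ιb≉0 b≈0 = ιb≉0 (F.trans (ι.⟦⟧-cong b≈0) ι.0#-homo)

      build : (∃₂ λ a b → F.ι b F.≉ F.0# × g₁ F.* F.ι b F.≈ F.ι a) → (∃₂ λ a b → F.ι b F.≉ F.0# × g₂ F.* F.ι b F.≈ F.ι a) → CommonDenominator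
      build (a₁ , b₁ , b₁≉0 , e₁) (a₂ , b₂ , b₂≉0 , e₂) = record
        { B = B ; G₁ = G₁ ; G₂ = G₂
        ; B≉0 = A.*-≉0′ b₁ b₂ (ι≉0 b₁ b₁≉0) (ι≉0 b₂ b₂≉0)
        ; g₁B≈G₁ = begin
            g₁ F.* F.ι B  ≈⟨ F.*-congˡ (ι.*-homo b₁ b₂) ⟩
            g₁ F.* (F.ι b₁ F.* F.ι b₂)  ≈⟨ F.*-assoc _ _ _ ⟨
            g₁ F.* F.ι b₁ F.* F.ι b₂  ≈⟨ F.*-congʳ e₁ ⟩
            F.ι a₁ F.* F.ι b₂  ≈⟨ ι.*-homo a₁ b₂ ⟨
            F.ι G₁  ∎
        ; g₂B≈G₂ = begin
            g₂ F.* F.ι B  ≈⟨ F.*-congˡ (F.trans (ι.*-homo b₁ b₂) (F.*-comm _ _)) ⟩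
            g₂ F.* (F.ι b₂ F.* F.ι b₁)  ≈⟨ F.*-assoc _ _ _ ⟨
            g₂ F.* F.ι b₂ F.* F.ι b₁  ≈⟨ F.*-congʳ e₂ ⟩
            F.ι a₂ F.* F.ι b₁  ≈⟨ ι.*-homo a₂ b₁ ⟨
            F.ι G₂  ∎
        ; b = dB ℕ.+ (dG₁ ℕ.+ dG₂)
        ; degB  = A.degree≤-mono B (ℕₚ.m≤m+n dB _) (proj₂ (A.some-degree B))
        ; degG₁ = A.degree≤-mono G₁ (ℕₚ.≤-trans (ℕₚ.m≤m+n dG₁ dG₂) (ℕₚ.m≤n+m _ dB)) (proj₂ (A.some-degree G₁))
        ; degG₂ = A.degree≤-mono G₂ (ℕₚ.≤-trans (ℕₚ.m≤n+m dG₂ dG₁) (ℕₚ.m≤n+m _ dB)) (proj₂ (A.some-degree G₂)) }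
        where
        open ≈-Reasoning F.setoid
        B  = b₁ A.* b₂
        G₁ = a₁ A.* b₂
        G₂ = a₂ A.* b₁
        dB  = proj₁ (A.some-degree B)
        dG₁ = proj₁ (A.some-degree G₁)
        dG₂ = proj₁ (A.some-degree G₂)

    open CommonDenominator commonDenominator

    1≤q : 1 ℕ.≤ q
    1≤q = ℕₚ.≤-trans (ℕ.s≤s ℕ.z≤n) A.2≤q

    3≤q : 3 ℕ.≤ q
    3≤q = ℕₚ.≤∧≢⇒< A.2≤q (λ 2≡q → proj₁ q-odd (≡.subst (2 ∣ⁿ_) 2≡q ∣ⁿ-refl))

    -- For j at most n + 3, the factor 6 b + 1 + n is at most (6 b + 1)(n + 1), j is at most 3 (n +
    -- 1), and q^j is at most q^3 q^n; the parts free of n are collected here.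
    K₀ : ℕ
    K₀ = suc (6 ℕ.* b) ℕ.* (3 ℕ.* q ℕ.^ 3)

    1≤K₀ : 1 ℕ.≤ K₀
    1≤K₀ = ℕₚ.*-mono-≤ {1} {suc (6 ℕ.* b)} (ℕ.s≤s ℕ.z≤n) (ℕₚ.*-mono-≤ {1} {3} (ℕ.s≤s ℕ.z≤n) (ℕₚ.m^n>0 q {{ℕ.>-nonZero 1≤q}} 3))

    bound-arithmetic : ∀ n j → j ℕ.≤ 3 ℕ.+ n → (suc (6 ℕ.* b) ℕ.+ n) ℕ.* (j ℕ.* q ℕ.^ j) ℕ.≤ K₀ ℕ.* (suc n ℕ.* suc n) ℕ.* q ℕ.^ n
    bound-arithmetic n j j≤3+n = begin
      (suc (6 ℕ.* b) ℕ.+ n) ℕ.* (j ℕ.* q ℕ.^ j)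
        ≤⟨ ℕₚ.*-mono-≤ c+n≤ (ℕₚ.*-mono-≤ (ℕₚ.≤-trans j≤3+n 3+n≤) (ℕₚ.^-monoʳ-≤ q {{ℕ.>-nonZero 1≤q}} j≤3+n)) ⟩
      suc (6 ℕ.* b) ℕ.* suc n ℕ.* (3 ℕ.* suc n ℕ.* q ℕ.^ (3 ℕ.+ n))
        ≡⟨ ≡.cong (λ z → suc (6 ℕ.* b) ℕ.* suc n ℕ.* (3 ℕ.* suc n ℕ.* z)) (ℕₚ.^-distribˡ-+-* q 3 n) ⟩
      suc (6 ℕ.* b) ℕ.* suc n ℕ.* (3 ℕ.* suc n ℕ.* (q ℕ.^ 3 ℕ.* q ℕ.^ n))
        ≡⟨ solve 4 (λ c m x y → c :* m :* (con 3 :* m :* (x :* y)) := c :* (con 3 :* x) :* (m :* m) :* y) ≡.refl (suc (6 ℕ.* b)) (suc n) (q ℕ.^ 3) (q ℕ.^ n) ⟩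
      K₀ ℕ.* (suc n ℕ.* suc n) ℕ.* q ℕ.^ n ∎
      where
      open ℕₚ.≤-Reasoning
      open ℕSolver.+-*-Solver using (solve; _:=_; _:*_; con)
      c+n≤ : suc (6 ℕ.* b) ℕ.+ n ℕ.≤ suc (6 ℕ.* b) ℕ.* suc n
      c+n≤ = ≡.subst (suc (6 ℕ.* b) ℕ.+ n ℕ.≤_) (≡.sym (ℕₚ.*-suc (suc (6 ℕ.* b)) n)) (ℕₚ.+-monoʳ-≤ (suc (6 ℕ.* b)) (ℕₚ.m≤n*m n (suc (6 ℕ.* b))))
      3+n≤ : 3 ℕ.+ n ℕ.≤ 3 ℕ.* suc n
      3+n≤ = ≡.subst (3 ℕ.+ n ℕ.≤_) (≡.sym (ℕₚ.*-suc 3 n)) (ℕₚ.+-monoʳ-≤ 3 (ℕₚ.m≤n*m n 3))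

    module _ (Ψ : DrinfeldModule F.rawRing F.ι 2) (P : MonicPrime) where
      private module Ψ = DrinfeldModule Ψ
      open Rank2 F Ψ
      open MonicPrime P
      open AtPrime P

      module _ (Ψg₁≈g₁ : Ψ.g 1 F.≈ g₁) (Ψg₂≈g₂ : Ψ.g 2 F.≈ g₂) {c″ ℓ″} (Fᵃˡᵍ : AlgebraicClosure F.base c″ ℓ″)
        (onlyScalar : EndomorphismsOverClosureAreScalar Fᵃˡᵍ) (Φ : Reduction) (Δ : A.Poly) (disc : IsDiscriminant Φ Δ) where

        private
          Ψg₁B≈G₁ : Ψ.g 1 F.* F.ι B F.≈ F.ι G₁
          Ψg₁B≈G₁ = F.trans (F.*-congʳ Ψg₁≈g₁) g₁B≈G₁
          Ψg₂B≈G₂ : Ψ.g 2 F.* F.ι B F.≈ F.ι G₂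
          Ψg₂B≈G₂ = F.trans (F.*-congʳ Ψg₂≈g₂) g₂B≈G₂
          traceZero = TraceZeroEndomorphism.traceZero 𝔽 q-odd F Ψ P Φ Δ disc
          module RS = ReductionSide 𝔽 q-odd F Ψ P Φ Δ (proj₁ traceZero) (proj₁ (proj₂ traceZero)) (proj₁ (proj₂ (proj₂ traceZero))) (proj₂ (proj₂ (proj₂ traceZero)))
          open Recursion A.commutativeRing q A.h A.X B G₁ G₂ Δ using (N)

        prime-degree≤ : ∀ n → A.Degree≤ Δ n → d ℕ.≤ K₀ ℕ.* (suc n ℕ.* suc n) ℕ.* q ℕ.^ n
        prime-degree≤ n degΔ = cases (A.zero? (N (2 ℕ.+ n))) (A.zero? (N (3 ℕ.+ n)))
          where
          bound : ∀ k → n ℕ.< k → suc k ℕ.≤ 3 ℕ.+ n → ¬ N (suc k) A.≈ [] → d ℕ.≤ K₀ ℕ.* (suc n ℕ.* suc n) ℕ.* q ℕ.^ n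
          bound k n<k k≤ N≉0 = ℕₚ.≤-trans (RS.prime-degree-bound B G₁ G₂ Ψg₁B≈G₁ Ψg₂B≈G₂ n b degΔ degB degG₁ degG₂ k n<k N≉0) (bound-arithmetic n (suc k) k≤)

          -- The numerators at n + 2 and n + 3 belong to the coefficients of v at n + 1 and n + 2,
          -- the first two beyond its degree. Equality in A is decidable, so one of them is known to
          -- be nonzero or both are zero.
          cases : Dec (N (2 ℕ.+ n) A.≈ []) → Dec (N (3 ℕ.+ n) A.≈ []) → d ℕ.≤ K₀ ℕ.* (suc n ℕ.* suc n) ℕ.* q ℕ.^ n
          cases (no N≉0)  _         = bound (1 ℕ.+ n) ℕₚ.≤-refl (ℕₚ.n≤1+n _) N≉0
          cases (yes _)   (no N≉0)  = bound (2 ℕ.+ n) (ℕₚ.n≤1+n _) ℕₚ.≤-refl N≉0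
          cases (yes e)   (yes e′)  = ⊥-elim (ClosureSide.recursion-terminates⇒⊥ 𝔽 q-odd F Ψ Fᵃˡᵍ onlyScalar B G₁ G₂ B≉0 Ψg₁B≈G₁ Ψg₂B≈G₂ Δ RS.Δ-nonsquare n e e′)

        discriminant-degree : ∃ λ n → deg Δ ≡ just n × d ℕ.≤ K₀ ℕ.* (suc n ℕ.* suc n) ℕ.* q ℕ.^ n
        discriminant-degree = cases (A.degree Δ)
          where
          cases : Δ A.≈ [] ⊎ (∃ λ n → deg Δ ≡ just n) → ∃ λ n → deg Δ ≡ just n × d ℕ.≤ K₀ ℕ.* (suc n ℕ.* suc n) ℕ.* q ℕ.^ n
          cases (inj₁ Δ≈0)       = contradiction Δ≈0 RS.Δ≉0
          cases (inj₂ (n , deg≡)) = n , deg≡ , prime-degree≤ n (proj₂ (A.deg-just Δ deg≡))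

open Reals

theorem1 : ∀ {c ℓ c′ ℓ′ c″ ℓ″} (q : ℕ) (q-odd : OddPrimePower q) (𝔽 : FiniteField c ℓ q) →
    let open FunctionField 𝔽 in
    (F : FractionField c′ ℓ′) →
    let module F = FractionField F in
    (g₁ g₂ : F.Carrier) →
    ∃ λ (C : ℝ⁺) →
      (ψ : DrinfeldModule F.rawRing F.ι 2) →
      DrinfeldModule.g ψ 1 F.≈ g₁ → DrinfeldModule.g ψ 2 F.≈ g₂ →
      let open Rank2 F ψ in
      (Fᵃˡᵍ : AlgebraicClosure F.base c″ ℓ″) →
      EndomorphismsOverClosureAreScalar Fᵃˡᵍ →
      (P : MonicPrime) →
      let open AtPrime P
          ∣p∣    = ∣ MonicPrime.p P ∣
          log-p    = logℕ ∣p∣ (3≤∣p∣ q-odd P)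
          loglog-p = loglogℕ ∣p∣ (3≤∣p∣ q-odd P)
      in
      GoodReduction → (Φ : Reduction) →
      ∀ Δ → IsDiscriminant Φ Δ →
      real (C *⁺ (log-p /⁺ (loglog-p *⁺ loglog-p))) ≤ℝ fromℕ ∣ Δ ∣
theorem1 q q-odd 𝔽 F g₁ g₂ =
  let open DiscriminantBound 𝔽 q-odd F g₁ g₂
      C , bound = LogarithmBounds.log-quotient-bound q 3≤q K₀ 1≤K₀
  in C , λ ψ e₁ e₂ Fᵃˡᵍ onlyScalar P _ Φ Δ disc →
    let n , deg≡n , d≤ = discriminant-degree ψ P e₁ e₂ Fᵃˡᵍ onlyScalar Φ Δ disc
        open FunctionField 𝔽
        open MonicPrime P
    -- Both absolute values unfold to powers of q once the two degrees are known to be `just`.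
    in λ r r∈ → ≡.subst (λ m → fromℕ m ∋ r) (≡.sym (≡.cong (maybe (q ℕ.^_) 0) deg≡n))
         (bound d n d≤ (≡.cong (maybe (q ℕ.^_) 0) deg≡d) (3≤∣p∣ q-odd P) r r∈)
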